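{- Let $f(X)\in\mathbb{Z}[X]$ be a polynomial of degree $n\ge 1$. Let $S$ be a finite set of primes, and let $S'\subseteq S$ be the subset of all $p\in S$ such that $f$ has a root in $\mathbb{Z}_p$. Suppose that $s':=\#S'\ge 1$. For real $B>0$ let $$\widetilde{N}(f,S,\varepsilon,B):=\#\{x\in\mathbb{Z} : |x|\le B,\ 0<|f(x)|^{\varepsilon}\le [f(x)]_{f,S}\}.$$ Then, for any $\varepsilon\in(0,R_{S'}(f)/n)$, one has $$\widetilde{N}(f,S,\varepsilon,B)\asymp_{f,S,\varepsilon} B^{1-(n\varepsilon)/R_{S'}(f)}(\log B)^{s'-1}\quad\text{as } B\to\infty.$$
   Context: $\mathbb{Z}_p$ is the ring of $p$-adic integers and $v_p$ the $p$-adic valuation. For $p\in S'$, $R_p(f)$ denotes the largest multiplicity of a root of $f$ in $\mathbb{Z}_p$, and $R_{S'}(f):=\max_{p\in S'}R_p(f)$. For $p\in S$ put $r_{p,S}(f):=R_{S'}(f)/R_p(f)$ if $p\in S'$ and $r_{p,S}(f):=1$ if $p\in S\setminus S'$. The $f$-normalized $S$-part of a non-zero integer $y$ is $[y]_{f,S}:=\prod_{p\in S}p^{v_p(y)\,r_{p,S}(f)}$. The variable $B$ ranges over the positive reals. $F(B)\asymp_{f,S,\varepsilon} G(B)$ as $B\to\infty$ means that there are constants $c_1,c_2>0$ depending only on $f,S,\varepsilon$ such that $c_1G(B)\le F(B)\le c_2G(B)$ for all sufficiently large $B$. -}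

module Defs where

open import Algebra.Bundles.Raw using (RawRing)
import Algebra.Definitions.RawSemiring as RawSemiringDefinitions
open import Axiom.ExcludedMiddle using (ExcludedMiddle)
open import Data.Integer.Base as ℤ using (ℤ; +_)
import Data.Integer.Divisibility.Signed as ℤ∣
import Data.Integer.Properties as ℤ
import Data.Integer.Solver as ℤSolver
open import Data.List.Base using (List; []; _∷_; map; foldr; filter; length)
open import Data.List.Membership.Propositional using (_∈_)
open import Data.List.Relation.Unary.Unique.Propositional using (Unique)
open import Data.Nat.Base as ℕ using (ℕ; zero; suc)
import Data.Nat.Divisibility as ℕ∣
import Data.Nat.Properties as ℕ
open import Data.Product.Base using (Σ; ∃; _×_; _,_; proj₁; proj₂)
open import Data.Rational.Base as ℚ using (ℚ; 0ℚ; 1ℚ; ½)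
import Data.Rational.Properties as ℚ
import Data.Rational.Solver as ℚSolver
open import Function.Base using (case_of_)
open import Function.Bundles using (_⇔_)
open import Level using (0ℓ)
open import Relation.Binary.PropositionalEquality
  using (_≡_; refl; sym; trans; cong; cong₂; subst)
open import Relation.Nullary using (¬_; yes; no)

-- A polynomial is its list of coefficients, constant term first.
-- Trailing zeros are permitted, so equality is equality of all
-- coefficients.

module Polynomial (R : RawRing 0ℓ 0ℓ) where
  private
    module R = RawRing R
  open R using () renaming (Carrier to A)

  Poly : Set
  Poly = List A

  coeff : Poly → ℕ → A
  coeff []      _       = R.0#
  coeff (a ∷ _) zero    = a
  coeff (_ ∷ f) (suc i) = coeff f i

  HasDegree : Poly → ℕ → Set
  HasDegree f n =
    (¬ coeff f n R.≈ R.0#) × (∀ i → n ℕ.< i → coeff f i R.≈ R.0#)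

  eval : Poly → A → A
  eval f x = foldr (λ a y → a R.+ x R.* y) R.0# f

  private
    add : Poly → Poly → Poly
    add []      g       = g
    add (a ∷ f) []      = a ∷ f
    add (a ∷ f) (b ∷ g) = (a R.+ b) ∷ add f g

    mul : Poly → Poly → Poly
    mul []      g = []
    mul (a ∷ f) g = add (map (a R.*_) g) (R.0# ∷ mul f g)

  rawRing : RawRing 0ℓ 0ℓ
  rawRing = record
    { Carrier = Poly
    ; _≈_     = λ f g → ∀ i → coeff f i R.≈ coeff g i
    ; _+_     = add
    ; _*_     = mul
    ; -_      = map R.-_
    ; 0#      = []
    ; 1#      = R.1# ∷ []
    }

  open RawSemiringDefinitions (RawRing.rawSemiring rawRing) public
    using (_∣_; _^_)

  X-_ : A → Poly
  X- a = (R.- a) ∷ R.1# ∷ []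

  IsRoot : Poly → A → Set
  IsRoot f a = eval f a R.≈ R.0#

  HasMultiplicity : Poly → A → ℕ → Set
  HasMultiplicity f a m = ((X- a) ^ m ∣ f) × ¬ ((X- a) ^ suc m ∣ f)

module ℤ[X] = Polynomial ℤ.+-*-rawRing

-- The p-adic integers, as the inverse limit of the rings ℤ/pᵏ
module Padic (p : ℕ) where

  infix 4 _≡_[p^_]

  _≡_[p^_] : ℤ → ℤ → ℕ → Set
  a ≡ b [p^ k ] = (+ p) ℤ.^ k ℤ∣.∣ a ℤ.- b

  -- approx k represents the image of the p-adic integer in ℤ/pᵏ.
  record ℤₚ : Set where
    constructor mkℤₚ
    field
      approx   : ℕ → ℤ
      coherent : ∀ k → approx (suc k) ≡ approx k [p^ k ]

  open ℤₚ public

  infix 4 _≈_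

  _≈_ : ℤₚ → ℤₚ → Set
  a ≈ b = ∀ k → approx a k ≡ approx b k [p^ k ]

  fromℤ : ℤ → ℤₚ
  fromℤ n = mkℤₚ (λ _ → n)
    (λ k → subst (_ ℤ∣.∣_) (sym (ℤ.+-inverseʳ n)) (ℤ∣.divides ℤ.0ℤ refl))

  private
    open ℤSolver.+-*-Solver

    add : ℤₚ → ℤₚ → ℤₚ
    add a b = mkℤₚ (λ k → approx a k ℤ.+ approx b k) λ k →
      subst (_ ℤ∣.∣_)
        (solve 4 (λ a a′ b b′ →
           (a′ :- a) :+ (b′ :- b) := (a′ :+ b′) :- (a :+ b)) refl
           (approx a k) (approx a (suc k)) (approx b k) (approx b (suc k)))
        (ℤ∣.∣m∣n⇒∣m+n (coherent a k) (coherent b k))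

    mul : ℤₚ → ℤₚ → ℤₚ
    mul a b = mkℤₚ (λ k → approx a k ℤ.* approx b k) λ k →
      subst (_ ℤ∣.∣_)
        (solve 4 (λ a a′ b b′ →
           (a′ :- a) :* b′ :+ a :* (b′ :- b) := a′ :* b′ :- a :* b) refl
           (approx a k) (approx a (suc k)) (approx b k) (approx b (suc k)))
        (ℤ∣.∣m∣n⇒∣m+n
          (ℤ∣.∣m⇒∣m*n (approx b (suc k)) (coherent a k))
          (ℤ∣.∣n⇒∣m*n (approx a k) (coherent b k)))

    neg : ℤₚ → ℤₚ
    neg a = mkℤₚ (λ k → ℤ.- approx a k) λ k →
      subst (_ ℤ∣.∣_)
        (solve 2 (λ a a′ → :- (a′ :- a) := (:- a′) :- (:- a)) refl
           (approx a k) (approx a (suc k)))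
        (ℤ∣.∣m⇒∣-m (coherent a k))

  rawRing : RawRing 0ℓ 0ℓ
  rawRing = record
    { Carrier = ℤₚ
    ; _≈_     = _≈_
    ; _+_     = add
    ; _*_     = mul
    ; -_      = neg
    ; 0#      = fromℤ ℤ.0ℤ
    ; 1#      = fromℤ ℤ.1ℤ
    }

module ℤₚ[X] (p : ℕ) = Polynomial (Padic.rawRing p)

-- Real numbers, as Cauchy sequences of rationals
IsCauchy : (ℕ → ℚ) → Set
IsCauchy x = ∀ {δ} → 0ℚ ℚ.< δ →
  ∃ λ N → ∀ m n → N ℕ.≤ m → N ℕ.≤ n → ℚ.∣ x m ℚ.- x n ∣ ℚ.≤ δ

record ℝ : Set where
  constructor mkℝ
  field
    seq    : ℕ → ℚ
    cauchy : IsCauchy seq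

open ℝ public

infix 4 _≤ᴿ_ _<ᴿ_ _≈ᴿ_

_≤ᴿ_ : ℝ → ℝ → Set
x ≤ᴿ y = ∀ {δ} → 0ℚ ℚ.< δ →
  ∃ λ N → ∀ n → N ℕ.≤ n → seq x n ℚ.≤ seq y n ℚ.+ δ

_<ᴿ_ : ℝ → ℝ → Set
x <ᴿ y = ∃ λ δ → 0ℚ ℚ.< δ ×
  ∃ λ N → ∀ n → N ℕ.≤ n → seq x n ℚ.+ δ ℚ.≤ seq y n

_≈ᴿ_ : ℝ → ℝ → Set
x ≈ᴿ y = x ≤ᴿ y × y ≤ᴿ x

fromℚ : ℚ → ℝ
fromℚ q = mkℝ (λ _ → q) λ 0<δ → 0 , λ _ _ _ _ →
  subst (ℚ._≤ _) (sym (cong ℚ.∣_∣ (ℚ.+-inverseʳ q))) (ℚ.<⇒≤ 0<δ)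

fromℕ : ℕ → ℝ
fromℕ n = fromℚ (+ n ℚ./ 1)

0ᴿ 1ᴿ : ℝ
0ᴿ = fromℕ 0
1ᴿ = fromℕ 1

private
  open ℚSolver.+-*-Solver

  half>0 : ∀ {δ} → 0ℚ ℚ.< δ → 0ℚ ℚ.< δ ℚ.* ½
  half>0 {δ} 0<δ =
    subst (ℚ._< δ ℚ.* ½) (ℚ.*-zeroˡ ½) (ℚ.*-monoˡ-<-pos ½ 0<δ)

  halves : ∀ δ → δ ℚ.* ½ ℚ.+ δ ℚ.* ½ ≡ δ
  halves = solve 1 (λ d → d :* con ½ :+ d :* con ½ := d) refl

  +-cauchy : ∀ {x y} → IsCauchy x → IsCauchy y →
             IsCauchy (λ n → x n ℚ.+ y n)
  +-cauchy {x} {y} cx cy {δ} 0<δ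
    with cx (half>0 0<δ) | cy (half>0 0<δ)
  ... | N₁ , h₁ | N₂ , h₂ = N₁ ℕ.⊔ N₂ , λ m n N≤m N≤n →
    let open ℚ.≤-Reasoning in begin
    ℚ.∣ (x m ℚ.+ y m) ℚ.- (x n ℚ.+ y n) ∣
      ≡⟨ cong ℚ.∣_∣ (solve 4 (λ a b c d →
           (a :+ b) :- (c :+ d) := (a :- c) :+ (b :- d)) refl
           (x m) (y m) (x n) (y n)) ⟩
    ℚ.∣ (x m ℚ.- x n) ℚ.+ (y m ℚ.- y n) ∣
      ≤⟨ ℚ.∣p+q∣≤∣p∣+∣q∣ (x m ℚ.- x n) (y m ℚ.- y n) ⟩
    ℚ.∣ x m ℚ.- x n ∣ ℚ.+ ℚ.∣ y m ℚ.- y n ∣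
      ≤⟨ ℚ.+-mono-≤
           (h₁ m n (ℕ.m⊔n≤o⇒m≤o N₁ N₂ N≤m) (ℕ.m⊔n≤o⇒m≤o N₁ N₂ N≤n))
           (h₂ m n (ℕ.m⊔n≤o⇒n≤o N₁ N₂ N≤m) (ℕ.m⊔n≤o⇒n≤o N₁ N₂ N≤n)) ⟩
    δ ℚ.* ½ ℚ.+ δ ℚ.* ½
      ≡⟨ halves δ ⟩
    δ ∎

  neg-cauchy : ∀ {x} → IsCauchy x → IsCauchy (λ n → ℚ.- x n)
  neg-cauchy {x} cx {δ} 0<δ with cx 0<δ
  ... | N , h = N , λ m n N≤m N≤n →
    subst (ℚ._≤ δ)
      (trans (sym (ℚ.∣-p∣≡∣p∣ (x m ℚ.- x n)))
             (cong ℚ.∣_∣ (ℚ.neg-distrib-+ (x m) (ℚ.- x n))))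
      (h m n N≤m N≤n)

  eventually-bounded : ∀ {x} → IsCauchy x →
    ∃ λ K → 0ℚ ℚ.< K × ∃ λ N → ∀ n → N ℕ.≤ n → ℚ.∣ x n ∣ ℚ.≤ K
  eventually-bounded {x} cx with cx (ℚ.positive⁻¹ 1ℚ)
  ... | N , h = 1ℚ ℚ.+ ℚ.∣ x N ∣ , 0<K , N , bound
    where
    0<K : 0ℚ ℚ.< 1ℚ ℚ.+ ℚ.∣ x N ∣
    0<K = ℚ.+-mono-<-≤ (ℚ.positive⁻¹ 1ℚ) (ℚ.0≤∣p∣ (x N))

    open ℚ.≤-Reasoning

    bound : ∀ n → N ℕ.≤ n → ℚ.∣ x n ∣ ℚ.≤ 1ℚ ℚ.+ ℚ.∣ x N ∣
    bound n N≤n = begin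
      ℚ.∣ x n ∣
        ≡⟨ cong ℚ.∣_∣ (solve 2 (λ a b → a := (a :- b) :+ b) refl (x n) (x N)) ⟩
      ℚ.∣ (x n ℚ.- x N) ℚ.+ x N ∣
        ≤⟨ ℚ.∣p+q∣≤∣p∣+∣q∣ (x n ℚ.- x N) (x N) ⟩
      ℚ.∣ x n ℚ.- x N ∣ ℚ.+ ℚ.∣ x N ∣
        ≤⟨ ℚ.+-monoˡ-≤ ℚ.∣ x N ∣ (h n N N≤n ℕ.≤-refl) ⟩
      1ℚ ℚ.+ ℚ.∣ x N ∣ ∎

  *-mono-≤ : ∀ {a b c d} → 0ℚ ℚ.≤ a → 0ℚ ℚ.≤ d →
             a ℚ.≤ b → c ℚ.≤ d → a ℚ.* c ℚ.≤ b ℚ.* d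
  *-mono-≤ {a} {b} {c} {d} 0≤a 0≤d a≤b c≤d = ℚ.≤-trans
    (ℚ.*-monoˡ-≤-nonNeg a {{ℚ.nonNegative 0≤a}} c≤d)
    (ℚ.*-monoʳ-≤-nonNeg d {{ℚ.nonNegative 0≤d}} a≤b)

  divide : ∀ C {δ} → 0ℚ ℚ.< C → 0ℚ ℚ.< δ → ∃ λ η → 0ℚ ℚ.< η × C ℚ.* η ≡ δ
  divide C {δ} 0<C 0<δ = ℚ.1/ C ℚ.* δ ,
    subst (ℚ._< ℚ.1/ C ℚ.* δ) (ℚ.*-zeroʳ (ℚ.1/ C))
      (ℚ.*-monoʳ-<-pos (ℚ.1/ C) {{ℚ.1/pos⇒pos C}} 0<δ) ,
    trans (sym (ℚ.*-assoc C (ℚ.1/ C) δ))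
      (trans (cong (ℚ._* δ) (ℚ.*-inverseʳ C)) (ℚ.*-identityˡ δ))
    where
    instance
      C-pos : ℚ.Positive C
      C-pos = ℚ.positive 0<C
      C-nonZero : ℚ.NonZero C
      C-nonZero = ℚ.pos⇒nonZero C

  *-close : ∀ {a b c d K L η} → 0ℚ ℚ.< K → 0ℚ ℚ.< L → 0ℚ ℚ.< η →
    ℚ.∣ a ∣ ℚ.≤ K → ℚ.∣ d ∣ ℚ.≤ L →
    ℚ.∣ b ℚ.- d ∣ ℚ.≤ η → ℚ.∣ a ℚ.- c ∣ ℚ.≤ η →
    ℚ.∣ a ℚ.* b ℚ.- c ℚ.* d ∣ ℚ.≤ (K ℚ.+ L) ℚ.* η
  *-close {a} {b} {c} {d} {K} {L} {η} 0<K 0<L 0<η a≤K d≤L b-d≤η a-c≤η = begin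
    ℚ.∣ a ℚ.* b ℚ.- c ℚ.* d ∣
      ≡⟨ cong ℚ.∣_∣ (solve 4 (λ a b c d →
           a :* b :- c :* d := a :* (b :- d) :+ d :* (a :- c)) refl a b c d) ⟩
    ℚ.∣ a ℚ.* (b ℚ.- d) ℚ.+ d ℚ.* (a ℚ.- c) ∣
      ≤⟨ ℚ.∣p+q∣≤∣p∣+∣q∣ (a ℚ.* (b ℚ.- d)) (d ℚ.* (a ℚ.- c)) ⟩
    ℚ.∣ a ℚ.* (b ℚ.- d) ∣ ℚ.+ ℚ.∣ d ℚ.* (a ℚ.- c) ∣
      ≡⟨ cong₂ ℚ._+_ (ℚ.∣p*q∣≡∣p∣*∣q∣ a (b ℚ.- d))
                     (ℚ.∣p*q∣≡∣p∣*∣q∣ d (a ℚ.- c)) ⟩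
    ℚ.∣ a ∣ ℚ.* ℚ.∣ b ℚ.- d ∣ ℚ.+ ℚ.∣ d ∣ ℚ.* ℚ.∣ a ℚ.- c ∣
      ≤⟨ ℚ.+-mono-≤
           (*-mono-≤ (ℚ.0≤∣p∣ a) (ℚ.<⇒≤ 0<η) a≤K b-d≤η)
           (*-mono-≤ (ℚ.0≤∣p∣ d) (ℚ.<⇒≤ 0<η) d≤L a-c≤η) ⟩
    K ℚ.* η ℚ.+ L ℚ.* η
      ≡⟨ sym (ℚ.*-distribʳ-+ η K L) ⟩
    (K ℚ.+ L) ℚ.* η ∎
    where open ℚ.≤-Reasoning

  *-cauchy : ∀ {x y} → IsCauchy x → IsCauchy y →
             IsCauchy (λ n → x n ℚ.* y n)
  *-cauchy {x} {y} cx cy {δ} 0<δ =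
    let K , 0<K , M₁ , b₁ = eventually-bounded cx
        L , 0<L , M₂ , b₂ = eventually-bounded cy
        η , 0<η , Cη≡δ    = divide (K ℚ.+ L) (ℚ.+-mono-< 0<K 0<L) 0<δ
        N₁ , h₁           = cx 0<η
        N₂ , h₂           = cy 0<η
        M                 = M₁ ℕ.⊔ M₂
        N                 = N₁ ℕ.⊔ N₂
    in M ℕ.⊔ N , λ m n ≤m ≤n →
      let M≤m = ℕ.m⊔n≤o⇒m≤o M N ≤m
          M≤n = ℕ.m⊔n≤o⇒m≤o M N ≤n
          N≤m = ℕ.m⊔n≤o⇒n≤o M N ≤m
          N≤n = ℕ.m⊔n≤o⇒n≤o M N ≤n
      in subst (ℚ.∣ x m ℚ.* y m ℚ.- x n ℚ.* y n ∣ ℚ.≤_) Cη≡δ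
        (*-close {x m} {y m} {x n} {y n} {K} {L} {η} 0<K 0<L 0<η
          (b₁ m (ℕ.m⊔n≤o⇒m≤o M₁ M₂ M≤m))
          (b₂ n (ℕ.m⊔n≤o⇒n≤o M₁ M₂ M≤n))
          (h₂ m n (ℕ.m⊔n≤o⇒n≤o N₁ N₂ N≤m) (ℕ.m⊔n≤o⇒n≤o N₁ N₂ N≤n))
          (h₁ m n (ℕ.m⊔n≤o⇒m≤o N₁ N₂ N≤m) (ℕ.m⊔n≤o⇒m≤o N₁ N₂ N≤n)))

infixl 6 _+ᴿ_ _-ᴿ_
infixl 7 _*ᴿ_ _÷_
infix  8 -ᴿ_
infixr 8 _^ₙ_

_+ᴿ_ : ℝ → ℝ → ℝ
x +ᴿ y = mkℝ (λ n → seq x n ℚ.+ seq y n)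
             (+-cauchy {seq x} {seq y} (cauchy x) (cauchy y))

-ᴿ_ : ℝ → ℝ
-ᴿ x = mkℝ (λ n → ℚ.- seq x n) (neg-cauchy {seq x} (cauchy x))

_-ᴿ_ : ℝ → ℝ → ℝ
x -ᴿ y = x +ᴿ -ᴿ y

_*ᴿ_ : ℝ → ℝ → ℝ
x *ᴿ y = mkℝ (λ n → seq x n ℚ.* seq y n)
             (*-cauchy {seq x} {seq y} (cauchy x) (cauchy y))

-- Division by 0 is 0 by convention.
_÷_ : ℝ → ℕ → ℝ
x ÷ zero  = 0ᴿ
x ÷ suc d = x *ᴿ fromℚ (+ 1 ℚ./ suc d)

_^ₙ_ : ℝ → ℕ → ℝ
x ^ₙ zero  = 1ᴿ
x ^ₙ suc n = x *ᴿ (x ^ₙ n)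

_⟶_ : (ℕ → ℝ) → ℝ → Set
s ⟶ l = ∀ {δ} → 0ℚ ℚ.< δ → ∃ λ N → ∀ n → N ℕ.≤ n →
  (s n ≤ᴿ l +ᴿ fromℚ δ) × (l ≤ᴿ s n +ᴿ fromℚ δ)

expPartial : ℝ → ℕ → ℝ
expPartial x zero    = 0ᴿ
expPartial x (suc n) = expPartial x n +ᴿ (x ^ₙ n) ÷ (n ℕ.!)

infix 4 _≍_

_≍_ : (ℝ → ℝ) → (ℝ → ℝ) → Set
F ≍ G = ∃ λ c₁ → ∃ λ c₂ → 0ᴿ <ᴿ c₁ × 0ᴿ <ᴿ c₂ ×
  ∃ λ B₀ → 0ᴿ <ᴿ B₀ ×
  (∀ B → B₀ ≤ᴿ B → c₁ *ᴿ G B ≤ᴿ F B × F B ≤ᴿ c₂ *ᴿ G B)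

-- Comparison of reals is undecidable constructively, so neither the set
-- counted below nor its cardinality is available without excluded middle.
module Classical (em : ExcludedMiddle 0ℓ) where

  -- Definite description: used below only for predicates that determine
  -- their argument (up to the equality of the type in question).
  -- If nothing satisfies P the result is the default value.
  the : {A : Set} → A → (A → Set) → A
  the default P = case em {P = ∃ P} of λ where
    (yes (a , _)) → a
    (no _)        → default

  largest : (ℕ → Set) → ℕ
  largest P = the 0 λ m → P m × (∀ k → P k → k ℕ.≤ m)

  # : {A : Set} → (A → Set) → ℕ
  # {A} P = the 0 λ k → Σ (List A) λ xs →
    Unique xs × length xs ≡ k × (∀ x → x ∈ xs ⇔ P x)

  exp : ℝ → ℝ
  exp x = the 0ᴿ (expPartial x ⟶_)

  log : ℝ → ℝ
  log x = the 0ᴿ λ y → exp y ≈ᴿ x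

  infixr 8 _^ᴿ_

  -- The value 0 off the positive reals gives 0 ^ y = 0, which is correct
  -- for y > 0.
  _^ᴿ_ : ℝ → ℝ → ℝ
  x ^ᴿ y = case em {P = 0ᴿ <ᴿ x} of λ where
    (yes _) → exp (y *ᴿ log x)
    (no _)  → 0ᴿ

  v : ℕ → ℤ → ℕ
  v p y = largest λ k → p ℕ.^ k ℕ∣.∣ ℤ.∣ y ∣

  HasRootIn-ℤₚ : ℤ[X].Poly → ℕ → Set
  HasRootIn-ℤₚ f p = ∃ (ℤₚ[X].IsRoot p (map (Padic.fromℤ p) f))

  primesWithRoot : ℤ[X].Poly → List ℕ → List ℕ
  primesWithRoot f S = filter (λ p → em {P = HasRootIn-ℤₚ f p}) S

  -- If f has no root in ℤₚ then R f p is 0, a value that is never used.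
  R : ℤ[X].Poly → ℕ → ℕ
  R f p = largest λ m → ∃ λ a →
    ℤₚ[X].IsRoot p fₚ a × ℤₚ[X].HasMultiplicity p fₚ a m
    where
    fₚ = map (Padic.fromℤ p) f

  Rmax : ℤ[X].Poly → List ℕ → ℕ
  Rmax f S = foldr ℕ._⊔_ 0 (map (R f) (primesWithRoot f S))

  r : ℤ[X].Poly → List ℕ → ℕ → ℝ
  r f S p = case em {P = HasRootIn-ℤₚ f p} of λ where
    (yes _) → fromℕ (Rmax f S) ÷ R f p
    (no _)  → 1ᴿ

  normalizedPart : ℤ[X].Poly → List ℕ → ℤ → ℝ
  normalizedPart f S y =
    foldr (λ p z → fromℕ p ^ᴿ (fromℕ (v p y) *ᴿ r f S p) *ᴿ z) 1ᴿ S

  Ñ : ℤ[X].Poly → List ℕ → ℝ → ℝ → ℕ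
  Ñ f S ε B = # λ (x : ℤ) →
    let y = ℤ[X].eval f x in
    fromℕ ℤ.∣ x ∣ ≤ᴿ B ×
    0ᴿ <ᴿ fromℕ ℤ.∣ y ∣ ^ᴿ ε ×
    fromℕ ℤ.∣ y ∣ ^ᴿ ε ≤ᴿ normalizedPart f S y

{-# OPTIONS --safe #-}
-- Let p run over S'. By Hensel-type arguments, for f(x) ≠ 0 the valuation
-- v_p(f(x)) differs from R_p(f) k_p, where k_p is the largest precision to
-- which x agrees with a suitable root of f in ℤ_p, by an amount that is
-- bounded above (and below, for one root of maximal multiplicity).
-- Therefore [f(x)]_{f,S} is of the order of D ^ R_{S'}(f) with
-- D = ∏ p ^ k_p, and x is counted essentially when D ≥ |x| ^ α, where
-- α = n ε / R_{S'}(f).  For fixed exponents k_p the x with |x| ≤ B form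
-- boundedly many residue classes modulo D, hence about B / D elements.
-- It suffices to let D be of the order of B ^ α, so one exponent is
-- determined by the s' - 1 others, each of which has about log B values.
module Submission where

open import Defs
open import Algebra.Bundles using (CommutativeRing)
import Algebra.Solver.Ring
import Algebra.Solver.Ring.AlmostCommutativeRing as ACR
open import Axiom.ExcludedMiddle using (ExcludedMiddle)
open import Data.Empty using (⊥; ⊥-elim)
open import Data.Integer.Base as ℤ using (ℤ; +_; -[1+_])
import Data.Integer.Properties as ℤ
open import Data.List.Base using (List)
open import Data.Maybe.Base using (Maybe; just; nothing)
open import Data.Nat.Base as ℕ using (ℕ; zero; suc; _!)
import Data.Nat.Properties as ℕ
open import Data.Product.Base using (Σ; ∃; _×_; _,_; proj₁; proj₂)
open import Data.Rational.Base as ℚ using (ℚ; 0ℚ; 1ℚ; ½)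
import Data.Rational.Properties as ℚ
import Data.Rational.Solver as ℚSolver
import Data.Rational.Unnormalised.Base as ℚᵘ
import Data.Rational.Unnormalised.Properties as ℚᵘ
open import Data.Sum.Base using (_⊎_; inj₁; inj₂)
open import Level using (0ℓ)
open import Relation.Binary.PropositionalEquality using (_≡_; refl; sym; trans; cong; cong₂; subst; subst₂)
import Relation.Binary.Reasoning.Base.Triple
open import Relation.Binary.Structures using (IsPreorder)
open import Relation.Nullary using (¬_; yes; no; Dec)

module RatioCases (em : ExcludedMiddle 0ℓ) where

  -- A nominal type, so that with-abstraction does not normalise the values.
  data RatioValue (f : ℤ[X].Poly) (S : List ℕ) (p : ℕ) : ℝ → Set where
    at-root  : Classical.HasRootIn-ℤₚ em f p → RatioValue f S p (fromℕ (Classical.Rmax em f S) ÷ Classical.R em f p)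
    off-root : ¬ Classical.HasRootIn-ℤₚ em f p → RatioValue f S p 1ᴿ

  ratio-value : ∀ f S p → RatioValue f S p (Classical.r em f S p)
  ratio-value f S p with em {Classical.HasRootIn-ℤₚ em f p}
  ... | yes q = at-root q
  ... | no ¬q = off-root ¬q

module ℚ-Lemmas where

  open ℚSolver.+-*-Solver

  half>0 : ∀ {δ} → 0ℚ ℚ.< δ → 0ℚ ℚ.< ½ ℚ.* δ
  half>0 {δ} 0<δ = subst (ℚ._< ½ ℚ.* δ) (ℚ.*-zeroʳ ½) (ℚ.*-monoʳ-<-pos ½ 0<δ)

  ≤-via : ∀ {a b c d} → c ℚ.≤ d → b ℚ.- a ≡ d ℚ.- c → a ℚ.≤ b
  ≤-via {a} {b} {c} {d} c≤d e = subst₂ ℚ._≤_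
    (solve 2 (λ a c → c :+ (a :- c) := a) refl a c)
    (trans (cong (λ z → d ℚ.+ (a ℚ.- c)) e)
      (trans (solve 3 (λ a c d → d :+ (a :- c) := (d :- c) :+ a) refl a c d)
        (trans (cong (ℚ._+ a) (sym e))
          (solve 2 (λ a b → (b :- a) :+ a := b) refl a b))))
    (ℚ.+-monoˡ-≤ (a ℚ.- c) c≤d)

  p≤∣p∣ : ∀ p → p ℚ.≤ ℚ.∣ p ∣
  p≤∣p∣ p with ℚ.∣p∣≡p∨∣p∣≡-p p
  ... | inj₁ e = ℚ.≤-reflexive (sym e)
  ... | inj₂ e = ≤-via {p} {ℚ.∣ p ∣} {0ℚ} {ℚ.∣ p ∣ ℚ.+ ℚ.∣ p ∣}
    (ℚ.+-mono-≤ (ℚ.0≤∣p∣ p) (ℚ.0≤∣p∣ p))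
    (trans (cong (λ z → ℚ.∣ p ∣ ℚ.- z) (trans (solve 1 (λ p → p := :- (:- p)) refl p) (cong ℚ.-_ (sym e))))
      (solve 1 (λ a → a :- (:- a) := (a :+ a) :- con 0ℚ) refl ℚ.∣ p ∣))

  ∣-∣-≤ : ∀ {p q δ} → ℚ.∣ p ℚ.- q ∣ ℚ.≤ δ → p ℚ.≤ q ℚ.+ δ
  ∣-∣-≤ {p} {q} {δ} h = ≤-via (ℚ.≤-trans (p≤∣p∣ (p ℚ.- q)) h)
    (solve 3 (λ p q d → (q :+ d) :- p := d :- (p :- q)) refl p q δ)

  ∣-∣-≥ : ∀ {p q δ} → ℚ.∣ p ℚ.- q ∣ ℚ.≤ δ → q ℚ.≤ p ℚ.+ δ
  ∣-∣-≥ {p} {q} {δ} h = ∣-∣-≤ (subst (ℚ._≤ δ)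
    (trans (sym (ℚ.∣-p∣≡∣p∣ (p ℚ.- q)))
      (cong ℚ.∣_∣ (solve 2 (λ p q → :- (p :- q) := q :- p) refl p q))) h)

  ≤-∣-∣ : ∀ {p q δ} → p ℚ.≤ q ℚ.+ δ → q ℚ.≤ p ℚ.+ δ → ℚ.∣ p ℚ.- q ∣ ℚ.≤ δ
  ≤-∣-∣ {p} {q} {δ} h k with ℚ.∣p∣≡p∨∣p∣≡-p (p ℚ.- q)
  ... | inj₁ e = subst (ℚ._≤ δ) (sym e) (≤-via h
        (solve 3 (λ p q d → d :- (p :- q) := (q :+ d) :- p) refl p q δ))
  ... | inj₂ e = subst (ℚ._≤ δ) (sym e) (≤-via k
        (solve 3 (λ p q d → d :- (:- (p :- q)) := (p :+ d) :- q) refl p q δ))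

  p≤p+δ : ∀ {p δ} → 0ℚ ℚ.≤ δ → p ℚ.≤ p ℚ.+ δ
  p≤p+δ {p} {δ} h = ≤-via h (solve 2 (λ p d → (p :+ d) :- p := d :- con 0ℚ) refl p δ)

  0≤* : ∀ {p q} → 0ℚ ℚ.≤ p → 0ℚ ℚ.≤ q → 0ℚ ℚ.≤ p ℚ.* q
  0≤* {p} {q} 0≤p 0≤q = subst (ℚ._≤ p ℚ.* q) (ℚ.*-zeroʳ p)
    (ℚ.*-monoˡ-≤-nonNeg p {{ℚ.nonNegative 0≤p}} 0≤q)

  0<* : ∀ {p q} → 0ℚ ℚ.< p → 0ℚ ℚ.< q → 0ℚ ℚ.< p ℚ.* q
  0<* {p} {q} 0<p 0<q = subst (ℚ._< p ℚ.* q) (ℚ.*-zeroʳ p)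
    (ℚ.*-monoʳ-<-pos p {{ℚ.positive 0<p}} 0<q)

  toℚᵘ-/1 : ∀ z → ℚ.toℚᵘ (z ℚ./ 1) ℚᵘ.≃ ℚᵘ.mkℚᵘ z 0
  toℚᵘ-/1 z = ℚ.toℚᵘ-fromℚᵘ (ℚᵘ.mkℚᵘ z 0)

  /1-+ : ∀ a b → (a ℤ.+ b) ℚ./ 1 ≡ a ℚ./ 1 ℚ.+ b ℚ./ 1
  /1-+ a b = ℚ.toℚᵘ-injective (ℚᵘ.≃-trans (toℚᵘ-/1 (a ℤ.+ b)) (ℚᵘ.≃-sym
    (ℚᵘ.≃-trans (ℚ.toℚᵘ-homo-+ (a ℚ./ 1) (b ℚ./ 1))
      (ℚᵘ.≃-trans (ℚᵘ.+-cong (toℚᵘ-/1 a) (toℚᵘ-/1 b))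
        (ℚᵘ.*≡* (cong (ℤ._* + 1) (cong₂ ℤ._+_ (ℤ.*-identityʳ a) (ℤ.*-identityʳ b))))))))

  /1-* : ∀ a b → (a ℤ.* b) ℚ./ 1 ≡ (a ℚ./ 1) ℚ.* (b ℚ./ 1)
  /1-* a b = ℚ.toℚᵘ-injective (ℚᵘ.≃-trans (toℚᵘ-/1 (a ℤ.* b)) (ℚᵘ.≃-sym
    (ℚᵘ.≃-trans (ℚ.toℚᵘ-homo-* (a ℚ./ 1) (b ℚ./ 1))
      (ℚᵘ.≃-trans (ℚᵘ.*-cong (toℚᵘ-/1 a) (toℚᵘ-/1 b)) (ℚᵘ.*≡* refl)))))

  /1-neg : ∀ a → (ℤ.- a) ℚ./ 1 ≡ ℚ.- (a ℚ./ 1)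
  /1-neg a = ℚ.toℚᵘ-injective (ℚᵘ.≃-trans (toℚᵘ-/1 (ℤ.- a)) (ℚᵘ.≃-sym
    (ℚᵘ.≃-trans (ℚ.toℚᵘ-homo‿- (a ℚ./ 1))
      (ℚᵘ.≃-trans (ℚᵘ.-‿cong (toℚᵘ-/1 a)) (ℚᵘ.*≡* refl)))))

  /1-mono : ∀ {a b} → a ℤ.≤ b → a ℚ./ 1 ℚ.≤ b ℚ./ 1
  /1-mono {a} {b} h = ℚ.toℚᵘ-cancel-≤
    (ℚᵘ.≤-respˡ-≃ (ℚᵘ.≃-sym (toℚᵘ-/1 a)) (ℚᵘ.≤-respʳ-≃ (ℚᵘ.≃-sym (toℚᵘ-/1 b))
      (ℚᵘ.*≤* (ℤ.*-monoʳ-≤-nonNeg (+ 1) h))))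

  /1-cancel : ∀ {a b} → a ℚ./ 1 ℚ.≤ b ℚ./ 1 → a ℤ.≤ b
  /1-cancel {a} {b} h with ℚᵘ.≤-respˡ-≃ (toℚᵘ-/1 a) (ℚᵘ.≤-respʳ-≃ (toℚᵘ-/1 b) (ℚ.toℚᵘ-mono-≤ h))
  ... | ℚᵘ.*≤* h′ = subst₂ ℤ._≤_ (ℤ.*-identityʳ a) (ℤ.*-identityʳ b) h′

  ≤-archimedean : ∀ q → ∃ λ N → q ℚ.≤ + N ℚ./ 1
  ≤-archimedean q@(ℚ.mkℚ (+ n) d _) = n , ℚ.toℚᵘ-cancel-≤
    (ℚᵘ.≤-respʳ-≃ (ℚᵘ.≃-sym (toℚᵘ-/1 (+ n))) (ℚᵘ.*≤*
      (subst₂ ℤ._≤_ (ℤ.pos-* n 1) (ℤ.pos-* n (suc d)) (ℤ.+≤+ (ℕ.*-monoʳ-≤ n (ℕ.s≤s ℕ.z≤n))))))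
  ≤-archimedean q@(ℚ.mkℚ -[1+ n ] d _) = 0 , ℚ.<⇒≤ (ℚ.negative⁻¹ q)

  reciprocal : ∀ n → ℚ
  reciprocal n = + 1 ℚ./ suc n

  toℚᵘ-reciprocal : ∀ n → ℚ.toℚᵘ (reciprocal n) ℚᵘ.≃ ℚᵘ.mkℚᵘ (+ 1) n
  toℚᵘ-reciprocal n = ℚ.toℚᵘ-fromℚᵘ (ℚᵘ.mkℚᵘ (+ 1) n)

  reciprocal-inverse : ∀ n → (+ suc n ℚ./ 1) ℚ.* reciprocal n ≡ 1ℚ
  reciprocal-inverse n = ℚ.toℚᵘ-injective
    (ℚᵘ.≃-trans (ℚ.toℚᵘ-homo-* (+ suc n ℚ./ 1) (reciprocal n))
      (ℚᵘ.≃-trans (ℚᵘ.*-cong (toℚᵘ-/1 (+ suc n)) (toℚᵘ-reciprocal n))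
        (ℚᵘ.*≡* (trans (ℤ.*-identityʳ (+ suc n ℤ.* + 1)) lemma))))
    where
    lemma : + suc n ℤ.* + 1 ≡ + 1 ℤ.* + (1 ℕ.* suc n)
    lemma = trans (ℤ.*-comm (+ suc n) (+ 1)) (cong (λ k → + 1 ℤ.* + k) (sym (ℕ.*-identityˡ (suc n))))

  reciprocal>0 : ∀ n → 0ℚ ℚ.< reciprocal n
  reciprocal>0 n = ℚ.toℚᵘ-cancel-< (ℚᵘ.<-respʳ-≃ (ℚᵘ.≃-sym (toℚᵘ-reciprocal n)) (ℚᵘ.positive⁻¹ (ℚᵘ.mkℚᵘ (+ 1) n)))

  reciprocal-archimedean : ∀ {δ} → 0ℚ ℚ.< δ → ∃ λ N → ∀ n → N ℕ.≤ n → reciprocal n ℚ.≤ δ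
  reciprocal-archimedean {ℚ.mkℚ (+ 0) d c} 0<δ = ⊥-elim (ℚ.<-irrefl (sym (ℚ.↥p≡0⇒p≡0 _ refl)) 0<δ)
  reciprocal-archimedean {ℚ.mkℚ -[1+ a ] d c} 0<δ = ⊥-elim (ℚ.<-asym 0<δ (ℚ.negative⁻¹ (ℚ.mkℚ -[1+ a ] d c)))
  reciprocal-archimedean {δ@(ℚ.mkℚ (+ suc a) d c)} 0<δ = d , λ n d≤n → ℚ.toℚᵘ-cancel-≤
    (ℚᵘ.≤-respˡ-≃ (ℚᵘ.≃-sym (toℚᵘ-reciprocal n)) (ℚᵘ.*≤*
      (subst₂ ℤ._≤_ (ℤ.pos-* 1 (suc d)) (ℤ.pos-* (suc a) (suc n))
        (ℤ.+≤+ (ℕ.*-mono-≤ (ℕ.s≤s (ℕ.z≤n {a})) (ℕ.s≤s d≤n))))))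

  -- x y ≥ - η (x + y + η) once x, y ≥ - η.
  *-nearly-nonNeg : ∀ {a b η δ} → 0ℚ ℚ.≤ a ℚ.+ η → 0ℚ ℚ.≤ b ℚ.+ η →
                    η ℚ.* (a ℚ.+ b ℚ.+ η) ℚ.≤ δ → 0ℚ ℚ.≤ a ℚ.* b ℚ.+ δ
  *-nearly-nonNeg {a} {b} {η} {δ} p q r = ≤-via (ℚ.+-mono-≤ (0≤* p q) r)
    (solve 4 (λ a b e d → (a :* b :+ d) :- con 0ℚ :=
        ((a :+ e) :* (b :+ e) :+ d) :- (con 0ℚ :+ e :* (a :+ b :+ e))) refl a b η δ)

  shift-nonNeg : ∀ {a k δ} → ℚ.- a ℚ.≤ k → 0ℚ ℚ.≤ δ → 0ℚ ℚ.≤ (a ℚ.+ k) ℚ.+ δ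
  shift-nonNeg {a} {k} {δ} p q = ≤-via (ℚ.+-mono-≤ p q)
    (solve 3 (λ x k d → ((x :+ k) :+ d) :- con 0ℚ := (k :+ d) :- (:- x :+ con 0ℚ)) refl a k δ)

module RealField where

  open ℚ-Lemmas

  infix  4 _≤_ _<_ _≈_
  infixl 6 _+_ _-_
  infixl 7 _*_
  infix  8 -_

  -- Opaque copies of the operations of the definitions: these keep Agda
  -- from unfolding reals into sequences while it checks real identities.
  opaque
    _≤_ _<_ _≈_ : ℝ → ℝ → Set
    _≤_ = _≤ᴿ_
    _<_ = _<ᴿ_
    _≈_ = _≈ᴿ_

    _+_ _*_ : ℝ → ℝ → ℝ
    _+_ = _+ᴿ_
    _*_ = _*ᴿ_

    -_ : ℝ → ℝ
    -_ = -ᴿ_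

    ιᵠ : ℚ → ℝ
    ιᵠ = fromℚ

    ι : ℤ → ℝ
    ι z = fromℚ (z ℚ./ 1)

  _-_ : ℝ → ℝ → ℝ
  x - y = x + - y

  0# 1# : ℝ
  0# = ι (+ 0)
  1# = ι (+ 1)

  ιₙ : ℕ → ℝ
  ιₙ n = ι (+ n)

  private
    open ℚSolver.+-*-Solver

    bounded : ∀ x → ∃ λ K → 0ℚ ℚ.≤ K × ∃ λ N → ∀ n → N ℕ.≤ n → seq x n ℚ.≤ K
    bounded x with cauchy x (ℚ.positive⁻¹ 1ℚ)
    ... | N , h = 1ℚ ℚ.+ ℚ.∣ seq x N ∣ ,
      ℚ.+-mono-≤ (ℚ.<⇒≤ (ℚ.positive⁻¹ 1ℚ)) (ℚ.0≤∣p∣ (seq x N)) , N , λ n N≤n →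
      ℚ.≤-trans (∣-∣-≤ {seq x n} {seq x N} (h n N N≤n ℕ.≤-refl))
        (subst (seq x N ℚ.+ 1ℚ ℚ.≤_) (ℚ.+-comm ℚ.∣ seq x N ∣ 1ℚ) (ℚ.+-monoˡ-≤ 1ℚ (p≤∣p∣ (seq x N))))

    split : ∀ C {δ} → 0ℚ ℚ.≤ C → 0ℚ ℚ.< δ →
            ∃ λ η → 0ℚ ℚ.< η × η ℚ.≤ 1ℚ × η ℚ.* C ℚ.≤ δ
    split C {δ} 0≤C 0<δ with ≤-archimedean C | reciprocal-archimedean 0<δ
    ... | K , C≤K | N , h = η , 0<* (reciprocal>0 K) (reciprocal>0 N) , η≤1 ,
      ℚ.≤-trans (ℚ.*-monoˡ-≤-nonNeg η {{0≤η}} C≤1+K)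
        (subst (ℚ._≤ δ) eq (h N ℕ.≤-refl))
      where
      η = reciprocal K ℚ.* reciprocal N
      0≤η : ℚ.NonNegative η
      0≤η = ℚ.nonNegative (ℚ.<⇒≤ (0<* (reciprocal>0 K) (reciprocal>0 N)))
      r≤1 : ∀ n → reciprocal n ℚ.≤ 1ℚ
      r≤1 n = subst₂ ℚ._≤_ (ℚ.*-identityˡ _) (reciprocal-inverse n)
        (ℚ.*-monoʳ-≤-nonNeg (reciprocal n) {{ℚ.nonNegative (ℚ.<⇒≤ (reciprocal>0 n))}}
          (/1-mono {+ 1} {+ suc n} (ℤ.+≤+ (ℕ.s≤s ℕ.z≤n))))
      η≤1 : η ℚ.≤ 1ℚ
      η≤1 = ℚ.≤-trans (subst (η ℚ.≤_) (ℚ.*-identityʳ (reciprocal K))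
        (ℚ.*-monoˡ-≤-nonNeg (reciprocal K) {{ℚ.nonNegative (ℚ.<⇒≤ (reciprocal>0 K))}} (r≤1 N))) (r≤1 K)
      C≤1+K : C ℚ.≤ (+ suc K) ℚ./ 1
      C≤1+K = ℚ.≤-trans C≤K (/1-mono {+ K} {+ suc K} (ℤ.+≤+ (ℕ.n≤1+n K)))
      eq : reciprocal N ≡ η ℚ.* ((+ suc K) ℚ./ 1)
      eq = trans (sym (ℚ.*-identityˡ (reciprocal N)))
        (trans (cong (ℚ._* reciprocal N) (sym (reciprocal-inverse K)))
          (solve 3 (λ a b c → (c :* a) :* b := (a :* b) :* c) refl (reciprocal K) (reciprocal N) ((+ suc K) ℚ./ 1)))

    halves : ∀ δ → ½ ℚ.* δ ℚ.+ ½ ℚ.* δ ≡ δ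
    halves = solve 1 (λ d → con ½ :* d :+ con ½ :* d := d) refl

    weaken : ∀ {p q δ} → p ℚ.≤ q → 0ℚ ℚ.< δ → p ℚ.≤ q ℚ.+ δ
    weaken p≤q 0<δ = ℚ.≤-trans p≤q (p≤p+δ (ℚ.<⇒≤ 0<δ))

    collect : ∀ {xn xk qM qn δ} → xk ℚ.≤ qM ℚ.+ ½ ℚ.* δ → qM ℚ.≤ qn ℚ.+ ½ ℚ.* (½ ℚ.* δ) →
              xn ℚ.≤ xk ℚ.+ ½ ℚ.* (½ ℚ.* δ) → xn ℚ.≤ qn ℚ.+ δ
    collect {xn} {xk} {qM} {qn} {δ} i j l = ≤-via (ℚ.+-mono-≤ i (ℚ.+-mono-≤ j l))
      (solve 5 (λ xn xk qM qn d → (qn :+ d) :- xn :=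
        ((qM :+ con ½ :* d) :+ ((qn :+ con ½ :* (con ½ :* d)) :+ (xk :+ con ½ :* (con ½ :* d))))
          :- (xk :+ (qM :+ xn))) refl xn xk qM qn δ)

    collect₂ : ∀ {xm xn ym yn δ} → yn ℚ.+ δ ℚ.≤ xn → xn ℚ.≤ xm ℚ.+ ½ ℚ.* (½ ℚ.* δ) →
               ym ℚ.≤ yn ℚ.+ ½ ℚ.* (½ ℚ.* δ) → 0ℚ ℚ.≤ ½ ℚ.* (½ ℚ.* δ) → ym ℚ.+ ½ ℚ.* (½ ℚ.* δ) ℚ.≤ xm
    collect₂ {xm} {xn} {ym} {yn} {δ} g i j l = ≤-via (ℚ.+-mono-≤ g (ℚ.+-mono-≤ i (ℚ.+-mono-≤ j l)))
      (solve 5 (λ xm xn ym yn δ → let d = con ½ :* (con ½ :* δ) in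
        xm :- (ym :+ d) := (xn :+ ((xm :+ d) :+ ((yn :+ d) :+ d))) :- ((yn :+ δ) :+ (xn :+ (ym :+ con 0ℚ))))
        refl xm xn ym yn δ)

  opaque
    unfolding _≤_

    pointwise-≤ : ∀ {x y} → (∀ n → seq x n ℚ.≤ seq y n) → x ≤ y
    pointwise-≤ h 0<δ = 0 , λ n _ → ℚ.≤-trans (h n) (p≤p+δ (ℚ.<⇒≤ 0<δ))

    pointwise-≈ : ∀ {x y} → (∀ n → seq x n ≡ seq y n) → x ≈ y
    pointwise-≈ {x} {y} h = pointwise-≤ {x} {y} (λ n → ℚ.≤-reflexive (h n)) ,
                            pointwise-≤ {y} {x} (λ n → ℚ.≤-reflexive (sym (h n)))

    ≤-trans : ∀ {x y z} → x ≤ y → y ≤ z → x ≤ z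
    ≤-trans {x} {y} {z} p q {δ} 0<δ with p (half>0 0<δ) | q (half>0 0<δ)
    ... | N₁ , h₁ | N₂ , h₂ = N₁ ℕ.⊔ N₂ , λ n N≤n →
      ≤-via (ℚ.+-mono-≤ (h₁ n (ℕ.m⊔n≤o⇒m≤o N₁ N₂ N≤n)) (h₂ n (ℕ.m⊔n≤o⇒n≤o N₁ N₂ N≤n)))
        (solve 4 (λ x y z d → (z :+ d) :- x :=
            ((y :+ con ½ :* d) :+ (z :+ con ½ :* d)) :- (x :+ y)) refl
          (seq x n) (seq y n) (seq z n) δ)

    ≈⇒≤ : ∀ {x y} → x ≈ y → x ≤ y
    ≈⇒≤ = proj₁

    ≈⇒≥ : ∀ {x y} → x ≈ y → y ≤ x
    ≈⇒≥ = proj₂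

    ≤-antisym : ∀ {x y} → x ≤ y → y ≤ x → x ≈ y
    ≤-antisym p q = p , q

    <⇒≤ : ∀ {x y} → x < y → x ≤ y
    <⇒≤ (δ , 0<δ , N , h) 0<η = N , λ n N≤n →
      ℚ.≤-trans (p≤p+δ (ℚ.<⇒≤ 0<δ)) (ℚ.≤-trans (h n N≤n) (p≤p+δ (ℚ.<⇒≤ 0<η)))

    <-≤-trans : ∀ {x y z} → x < y → y ≤ z → x < z
    <-≤-trans {x} {y} {z} (δ , 0<δ , N₁ , h₁) q with q (half>0 0<δ)
    ... | N₂ , h₂ = ½ ℚ.* δ , half>0 0<δ , N₁ ℕ.⊔ N₂ , λ n N≤n →
      ≤-via (ℚ.+-mono-≤ (h₁ n (ℕ.m⊔n≤o⇒m≤o N₁ N₂ N≤n)) (h₂ n (ℕ.m⊔n≤o⇒n≤o N₁ N₂ N≤n)))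
        (solve 4 (λ x y z d → z :- (x :+ con ½ :* d) :=
            (y :+ (z :+ con ½ :* d)) :- ((x :+ d) :+ y)) refl
          (seq x n) (seq y n) (seq z n) δ)

    ≤-<-trans : ∀ {x y z} → x ≤ y → y < z → x < z
    ≤-<-trans {x} {y} {z} q (δ , 0<δ , N₁ , h₁) with q (half>0 0<δ)
    ... | N₂ , h₂ = ½ ℚ.* δ , half>0 0<δ , N₁ ℕ.⊔ N₂ , λ n N≤n →
      ≤-via (ℚ.+-mono-≤ (h₁ n (ℕ.m⊔n≤o⇒m≤o N₁ N₂ N≤n)) (h₂ n (ℕ.m⊔n≤o⇒n≤o N₁ N₂ N≤n)))
        (solve 4 (λ x y z d → z :- (x :+ con ½ :* d) :=
            (z :+ (y :+ con ½ :* d)) :- ((y :+ d) :+ x)) refl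
          (seq x n) (seq y n) (seq z n) δ)

    <-irrefl : ∀ {x} → ¬ x < x
    <-irrefl {x} (δ , 0<δ , N , h) = ℚ.<-irrefl refl (ℚ.<-≤-trans 0<δ
      (≤-via (h N ℕ.≤-refl) (solve 2 (λ x d → con 0ℚ :- d := x :- (x :+ d)) refl (seq x N) δ)))

    +-mono-≤ : ∀ {x y u v} → x ≤ y → u ≤ v → x + u ≤ y + v
    +-mono-≤ {x} {y} {u} {v} p q {δ} 0<δ with p (half>0 0<δ) | q (half>0 0<δ)
    ... | N₁ , h₁ | N₂ , h₂ = N₁ ℕ.⊔ N₂ , λ n N≤n →
      ≤-via (ℚ.+-mono-≤ (h₁ n (ℕ.m⊔n≤o⇒m≤o N₁ N₂ N≤n)) (h₂ n (ℕ.m⊔n≤o⇒n≤o N₁ N₂ N≤n)))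
        (solve 5 (λ x y u v d → ((y :+ v) :+ d) :- (x :+ u) :=
            ((y :+ con ½ :* d) :+ (v :+ con ½ :* d)) :- (x :+ u)) refl
          (seq x n) (seq y n) (seq u n) (seq v n) δ)

    neg-antimono : ∀ {x y} → x ≤ y → - y ≤ - x
    neg-antimono {x} {y} p {δ} 0<δ with p 0<δ
    ... | N , h = N , λ n N≤n → ≤-via (h n N≤n)
      (solve 3 (λ x y d → (:- x :+ d) :- (:- y) := (y :+ d) :- x) refl (seq x n) (seq y n) δ)

    *-nonNeg : ∀ {x y} → 0# ≤ x → 0# ≤ y → 0# ≤ x * y
    *-nonNeg {x} {y} p q {δ} 0<δ =
      let K , 0≤K , M₁ , b₁ = bounded x
          L , 0≤L , M₂ , b₂ = bounded y
          η , 0<η , η≤1 , ηC≤δ = split (K ℚ.+ L ℚ.+ 1ℚ)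
            (ℚ.+-mono-≤ (ℚ.+-mono-≤ 0≤K 0≤L) (ℚ.<⇒≤ (ℚ.positive⁻¹ 1ℚ))) 0<δ
          N₁ , h₁ = p 0<η
          N₂ , h₂ = q 0<η
      in (M₁ ℕ.⊔ M₂) ℕ.⊔ (N₁ ℕ.⊔ N₂) , λ n ≤n →
      let M≤n = ℕ.m⊔n≤o⇒m≤o (M₁ ℕ.⊔ M₂) (N₁ ℕ.⊔ N₂) ≤n
          N≤n = ℕ.m⊔n≤o⇒n≤o (M₁ ℕ.⊔ M₂) (N₁ ℕ.⊔ N₂) ≤n
          a = seq x n
          b = seq y n
          a≤K = b₁ n (ℕ.m⊔n≤o⇒m≤o M₁ M₂ M≤n)
          b≤L = b₂ n (ℕ.m⊔n≤o⇒n≤o M₁ M₂ M≤n)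
          0≤a+η = h₁ n (ℕ.m⊔n≤o⇒m≤o N₁ N₂ N≤n)
          0≤b+η = h₂ n (ℕ.m⊔n≤o⇒n≤o N₁ N₂ N≤n)
          S≤C = ℚ.+-mono-≤ (ℚ.+-mono-≤ a≤K b≤L) η≤1
          ηS≤δ = ℚ.≤-trans (ℚ.*-monoˡ-≤-nonNeg η {{ℚ.nonNegative (ℚ.<⇒≤ 0<η)}} S≤C) ηC≤δ
      in *-nearly-nonNeg {a} {b} {η} 0≤a+η 0≤b+η ηS≤δ

    ιᵠ-mono : ∀ {p q} → p ℚ.≤ q → ιᵠ p ≤ ιᵠ q
    ιᵠ-mono h = pointwise-≤ {ιᵠ _} {ιᵠ _} (λ _ → h)

    ιᵠ-mono-< : ∀ {p q} → p ℚ.< q → ιᵠ p < ιᵠ q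
    ιᵠ-mono-< {p} {q} h = q ℚ.- p , subst (ℚ._< q ℚ.- p) (ℚ.+-inverseʳ p) (ℚ.+-monoˡ-< (ℚ.- p) h) , 0 ,
      λ _ _ → ℚ.≤-reflexive (solve 2 (λ p q → p :+ (q :- p) := q) refl p q)

    ιᵠ-cancel : ∀ {p q} → ιᵠ p ≤ ιᵠ q → p ℚ.≤ q
    ιᵠ-cancel {p} {q} h with p ℚ.≤? q
    ... | yes p≤q = p≤q
    ... | no  p≰q = ⊥-elim (<-irrefl {ιᵠ q} (<-≤-trans {ιᵠ q} {ιᵠ p} {ιᵠ q} (ιᵠ-mono-< (ℚ.≰⇒> p≰q)) h))

    ι-ιᵠ : ∀ z → ι z ≈ ιᵠ (z ℚ./ 1)
    ι-ιᵠ z = pointwise-≈ {ι z} {ιᵠ (z ℚ./ 1)} (λ _ → refl)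

    ι-+ : ∀ a b → ι (a ℤ.+ b) ≈ ι a + ι b
    ι-+ a b = pointwise-≈ {ι (a ℤ.+ b)} {ι a + ι b} (λ _ → /1-+ a b)

    ι-* : ∀ a b → ι (a ℤ.* b) ≈ ι a * ι b
    ι-* a b = pointwise-≈ {ι (a ℤ.* b)} {ι a * ι b} (λ _ → /1-* a b)

    ι-neg : ∀ a → ι (ℤ.- a) ≈ - ι a
    ι-neg a = pointwise-≈ {ι (ℤ.- a)} { - ι a} (λ _ → /1-neg a)

    ιᵠ-+ : ∀ a b → ιᵠ (a ℚ.+ b) ≈ ιᵠ a + ιᵠ b
    ιᵠ-+ a b = pointwise-≈ {ιᵠ (a ℚ.+ b)} {ιᵠ a + ιᵠ b} (λ _ → refl)

    ιᵠ-* : ∀ a b → ιᵠ (a ℚ.* b) ≈ ιᵠ a * ιᵠ b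
    ιᵠ-* a b = pointwise-≈ {ιᵠ (a ℚ.* b)} {ιᵠ a * ιᵠ b} (λ _ → refl)

    +-assoc : ∀ x y z → (x + y) + z ≈ x + (y + z)
    +-assoc x y z = pointwise-≈ {(x + y) + z} {x + (y + z)} (λ n → ℚ.+-assoc (seq x n) (seq y n) (seq z n))

    +-comm : ∀ x y → x + y ≈ y + x
    +-comm x y = pointwise-≈ {x + y} {y + x} (λ n → ℚ.+-comm (seq x n) (seq y n))

    +-identityˡ : ∀ x → 0# + x ≈ x
    +-identityˡ x = pointwise-≈ {0# + x} {x} (λ n → ℚ.+-identityˡ (seq x n))

    +-inverseˡ : ∀ x → - x + x ≈ 0#
    +-inverseˡ x = pointwise-≈ { - x + x} {0#} (λ n → ℚ.+-inverseˡ (seq x n))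

    *-assoc : ∀ x y z → (x * y) * z ≈ x * (y * z)
    *-assoc x y z = pointwise-≈ {(x * y) * z} {x * (y * z)} (λ n → ℚ.*-assoc (seq x n) (seq y n) (seq z n))

    *-comm : ∀ x y → x * y ≈ y * x
    *-comm x y = pointwise-≈ {x * y} {y * x} (λ n → ℚ.*-comm (seq x n) (seq y n))

    *-identityˡ : ∀ x → 1# * x ≈ x
    *-identityˡ x = pointwise-≈ {1# * x} {x} (λ n → ℚ.*-identityˡ (seq x n))

    distribˡ : ∀ x y z → x * (y + z) ≈ x * y + x * z
    distribˡ x y z = pointwise-≈ {x * (y + z)} {x * y + x * z} (λ n → ℚ.*-distribˡ-+ (seq x n) (seq y n) (seq z n))

    *-negˡ : ∀ x y → (- x) * y ≈ - (x * y)
    *-negˡ x y = pointwise-≈ {(- x) * y} { - (x * y)} (λ n → sym (ℚ.neg-distribˡ-* (seq x n) (seq y n)))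

    -- Every real is a difference of nonnegative ones.
    nonNeg-difference : ∀ x → ∃ λ K → 0# ≤ K × 0# ≤ x + K
    nonNeg-difference x = let K , 0≤K , N , h = bounded (- x) in
      ιᵠ K , pointwise-≤ {0#} {ιᵠ K} (λ _ → 0≤K) , λ {δ} 0<δ → N , λ n N≤n →
      shift-nonNeg {seq x n} {K} {δ} (h n N≤n) (ℚ.<⇒≤ 0<δ)

    ≤-archimedean-ℝ : ∀ x → ∃ λ n → x ≤ ιₙ n
    ≤-archimedean-ℝ x =
      let K , _ , N , h = bounded x
          n , K≤n = ≤-archimedean K
      in n , λ {δ} 0<δ → N , λ m N≤m →
        weaken {seq x m} {(+ n) ℚ./ 1} {δ} (ℚ.≤-trans (h m N≤m) K≤n) 0<δ

    <-rational : ∀ {x y} → x < y → ∃ λ δ → 0ℚ ℚ.< δ × x + ιᵠ δ ≤ y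
    <-rational {x} {y} (δ , 0<δ , N , h) = δ , 0<δ , λ {η} 0<η → N , λ n N≤n →
      weaken {seq x n ℚ.+ δ} {seq y n} {η} (h n N≤n) 0<η

    rational-approx : ∀ x {δ} → 0ℚ ℚ.< δ → ∃ λ q → x ≤ ιᵠ q + ιᵠ δ × ιᵠ q ≤ x + ιᵠ δ
    rational-approx x {δ} 0<δ = let N , h = cauchy x 0<δ in seq x N ,
      (λ {η} 0<η → N , λ n N≤n → weaken {seq x n} {seq x N ℚ.+ δ} {η}
        (∣-∣-≤ {seq x n} {seq x N} {δ} (h n N N≤n ℕ.≤-refl)) 0<η) ,
      (λ {η} 0<η → N , λ n N≤n → weaken {seq x N} {seq x n ℚ.+ δ} {η}
        (∣-∣-≥ {seq x n} {seq x N} {δ} (h n N N≤n ℕ.≤-refl)) 0<η)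

    -- The limit of a sequence of rationals, in terms of its one-sided bounds.
    ≤-lim : ∀ {q : ℕ → ℚ} (c : IsCauchy q) {x} N → (∀ n → N ℕ.≤ n → x ≤ ιᵠ (q n)) → x ≤ mkℝ q c
    ≤-lim {q} c {x} N h {δ} 0<δ =
      let N₁ , h₁ = c (half>0 (half>0 0<δ))
          N₂ , h₂ = cauchy x (half>0 (half>0 0<δ))
          M = N ℕ.⊔ (N₁ ℕ.⊔ N₂)
      in M , λ n M≤n →
      let N₃ , h₃ = h M (ℕ.m≤m⊔n N (N₁ ℕ.⊔ N₂)) (half>0 0<δ)
          k = N₃ ℕ.⊔ M
          N₁≤M = ℕ.≤-trans (ℕ.m≤m⊔n N₁ N₂) (ℕ.m≤n⊔m N (N₁ ℕ.⊔ N₂))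
          N₂≤M = ℕ.≤-trans (ℕ.m≤n⊔m N₁ N₂) (ℕ.m≤n⊔m N (N₁ ℕ.⊔ N₂))
          i = h₃ k (ℕ.m≤m⊔n N₃ M)
          j = ∣-∣-≤ {q M} {q n} (h₁ M n N₁≤M (ℕ.≤-trans N₁≤M M≤n))
          l = ∣-∣-≤ {seq x n} {seq x k} (h₂ n k (ℕ.≤-trans N₂≤M M≤n) (ℕ.≤-trans N₂≤M (ℕ.m≤n⊔m N₃ M)))
      in collect {seq x n} {seq x k} {q M} {q n} {δ} i j l

    neg-lim : ∀ {q : ℕ → ℚ} (c : IsCauchy q) (c′ : IsCauchy (λ n → ℚ.- q n)) →
              mkℝ (λ n → ℚ.- q n) c′ ≈ - mkℝ q c
    neg-lim {q} c c′ = pointwise-≈ {mkℝ (λ n → ℚ.- q n) c′} { - mkℝ q c} (λ _ → refl)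

    ιᵠ-neg : ∀ q → ιᵠ (ℚ.- q) ≈ - ιᵠ q
    ιᵠ-neg q = pointwise-≈ {ιᵠ (ℚ.- q)} { - ιᵠ q} (λ _ → refl)

    negᶜ : ∀ {q : ℕ → ℚ} → IsCauchy q → IsCauchy (λ n → ℚ.- q n)
    negᶜ {q} c = cauchy (- mkℝ q c)

  module _ (em : ExcludedMiddle 0ℓ) where
    private
      frequently : ∀ {u v : ℕ → ℚ} {δ} → ¬ (∃ λ N → ∀ n → N ℕ.≤ n → u n ℚ.≤ v n ℚ.+ δ) →
                   ∀ N → ∃ λ n → N ℕ.≤ n × v n ℚ.+ δ ℚ.≤ u n
      frequently {u} {v} {δ} ¬h N with em {∃ λ n → N ℕ.≤ n × v n ℚ.+ δ ℚ.≤ u n}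
      ... | yes p = p
      ... | no ¬p = ⊥-elim (¬h (N , λ n N≤n → ℚ.≮⇒≥ λ lt → ¬p (n , N≤n , ℚ.<⇒≤ lt)))

      separated : ∀ x y {δ} → 0ℚ ℚ.< δ → (∀ N → ∃ λ n → N ℕ.≤ n × seq y n ℚ.+ δ ℚ.≤ seq x n) → y <ᴿ x
      separated x y {δ} 0<δ far =
        let 0<d = half>0 (half>0 0<δ)
            N₁ , h₁ = cauchy x 0<d
            N₂ , h₂ = cauchy y 0<d
            n , N≤n , g = far (N₁ ℕ.⊔ N₂)
        in ½ ℚ.* (½ ℚ.* δ) , 0<d , N₁ ℕ.⊔ N₂ , λ m N≤m →
          collect₂ {seq x m} {seq x n} {seq y m} {seq y n} {δ} g
            (∣-∣-≤ {seq x n} {seq x m} (h₁ n m (ℕ.m⊔n≤o⇒m≤o N₁ N₂ N≤n) (ℕ.m⊔n≤o⇒m≤o N₁ N₂ N≤m)))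
            (∣-∣-≤ {seq y m} {seq y n} (h₂ m n (ℕ.m⊔n≤o⇒n≤o N₁ N₂ N≤m) (ℕ.m⊔n≤o⇒n≤o N₁ N₂ N≤n)))
            (ℚ.<⇒≤ 0<d)

    opaque
      unfolding _≤_

      ≰⇒> : ∀ {x y} → ¬ x ≤ y → y < x
      ≰⇒> {x} {y} x≰y with em {y <ᴿ x}
      ... | yes y<x = y<x
      ... | no  y≮x = ⊥-elim (x≰y λ {δ} 0<δ → case₁ δ 0<δ em)
        where
        case₁ : ∀ δ → 0ℚ ℚ.< δ → Dec (∃ λ N → ∀ n → N ℕ.≤ n → seq x n ℚ.≤ seq y n ℚ.+ δ) →
                ∃ λ N → ∀ n → N ℕ.≤ n → seq x n ℚ.≤ seq y n ℚ.+ δ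
        case₁ δ 0<δ (yes h) = h
        case₁ δ 0<δ (no ¬h) = ⊥-elim (y≮x (separated x y 0<δ (frequently {seq x} {seq y} {δ} ¬h)))

module Reals (em : ExcludedMiddle 0ℓ) where
  open RealField public hiding (≰⇒>)
  open ℚ-Lemmas hiding (≤-via)

  ≰⇒> : ∀ {x y} → ¬ x ≤ y → y < x
  ≰⇒> = RealField.≰⇒> em

  infixr 8 _^_
  infixl 7 _/_

  _/_ : ℝ → ℕ → ℝ
  x / zero  = 0#
  x / suc d = x * ιᵠ (reciprocal d)

  _^_ : ℝ → ℕ → ℝ
  x ^ zero  = 1#
  x ^ suc n = x * x ^ n

  opaque
    unfolding _≤_
    ≈-reflexive : ∀ {x y} → x ≡ y → x ≈ y
    ≈-reflexive {x} refl = pointwise-≈ {x} {x} (λ _ → refl)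

  ≈-refl : ∀ {x} → x ≈ x
  ≈-refl = ≈-reflexive refl

  ≤-refl : ∀ {x} → x ≤ x
  ≤-refl = ≈⇒≤ ≈-refl

  ≈-sym : ∀ {x y} → x ≈ y → y ≈ x
  ≈-sym p = ≤-antisym (≈⇒≥ p) (≈⇒≤ p)

  ≈-trans : ∀ {x y z} → x ≈ y → y ≈ z → x ≈ z
  ≈-trans p q = ≤-antisym (≤-trans (≈⇒≤ p) (≈⇒≤ q)) (≤-trans (≈⇒≥ q) (≈⇒≥ p))

  <-trans : ∀ {x y z} → x < y → y < z → x < z
  <-trans p q = <-≤-trans p (<⇒≤ q)

  ≤⊎> : ∀ x y → x ≤ y ⊎ y < x
  ≤⊎> x y with em {x ≤ y}
  ... | yes p = inj₁ p
  ... | no ¬p = inj₂ (≰⇒> ¬p)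

  ≮⇒≥ : ∀ {x y} → ¬ x < y → y ≤ x
  ≮⇒≥ {x} {y} h with ≤⊎> y x
  ... | inj₁ p = p
  ... | inj₂ p = ⊥-elim (h p)

  <⇒≱ : ∀ {x y} → x < y → ¬ y ≤ x
  <⇒≱ p q = <-irrefl (<-≤-trans p q)

  ≤-isPreorder : IsPreorder _≈_ _≤_
  ≤-isPreorder = record
    { isEquivalence = record { refl = ≈-refl ; sym = ≈-sym ; trans = ≈-trans }
    ; reflexive = ≈⇒≤ ; trans = ≤-trans }

  module ≤-Reasoning = Relation.Binary.Reasoning.Base.Triple
    {_≈_ = _≈_} {_≤_ = _≤_} {_<_ = _<_}
    ≤-isPreorder
    (λ p q → <-irrefl (<-trans p q))
    <-trans
    ((λ e p → <-≤-trans p (≈⇒≤ e)) , (λ e p → ≤-<-trans (≈⇒≥ e) p))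
    <⇒≤ <-≤-trans ≤-<-trans

  +-cong : ∀ {x y u v} → x ≈ y → u ≈ v → x + u ≈ y + v
  +-cong p q = ≤-antisym (+-mono-≤ (≈⇒≤ p) (≈⇒≤ q)) (+-mono-≤ (≈⇒≥ p) (≈⇒≥ q))

  neg-cong : ∀ {x y} → x ≈ y → - x ≈ - y
  neg-cong p = ≤-antisym (neg-antimono (≈⇒≥ p)) (neg-antimono (≈⇒≤ p))

  +-identityʳ : ∀ x → x + 0# ≈ x
  +-identityʳ x = ≈-trans (+-comm x 0#) (+-identityˡ x)

  +-inverseʳ : ∀ x → x + - x ≈ 0#
  +-inverseʳ x = ≈-trans (+-comm x (- x)) (+-inverseˡ x)

  distribʳ : ∀ x y z → (y + z) * x ≈ y * x + z * x
  distribʳ x y z = ≈-trans (*-comm (y + z) x)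
    (≈-trans (distribˡ x y z) (+-cong (*-comm x y) (*-comm x z)))

  private
    x+y-y≈x : ∀ x y → (x + y) + - y ≈ x
    x+y-y≈x x y = ≈-trans (+-assoc x y (- y)) (≈-trans (+-cong ≈-refl (+-inverseʳ y)) (+-identityʳ x))

    x-y+y≈x : ∀ x y → (x + - y) + y ≈ x
    x-y+y≈x x y = ≈-trans (+-assoc x (- y) y) (≈-trans (+-cong ≈-refl (+-inverseˡ y)) (+-identityʳ x))

  x≤y⇒0≤y-x : ∀ {x y} → x ≤ y → 0# ≤ y - x
  x≤y⇒0≤y-x {x} {y} p = ≤-trans (≈⇒≥ (+-inverseʳ x)) (+-mono-≤ p ≤-refl)

  0≤y-x⇒x≤y : ∀ {x y} → 0# ≤ y - x → x ≤ y
  0≤y-x⇒x≤y {x} {y} p = ≤-trans (≈⇒≥ (+-identityˡ x)) (≤-trans (+-mono-≤ p ≤-refl) (≈⇒≤ (x-y+y≈x y x)))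

  private
    *-monoʳ-nonNeg : ∀ {x y z} → 0# ≤ z → x ≤ y → x * z ≤ y * z
    *-monoʳ-nonNeg {x} {y} {z} 0≤z p = 0≤y-x⇒x≤y (≤-trans (*-nonNeg (x≤y⇒0≤y-x p) 0≤z)
      (≈⇒≤ (≈-trans (distribʳ z y (- x)) (+-cong ≈-refl (*-negˡ x z)))))

    *-congʳ-nonNeg : ∀ {x y z} → 0# ≤ z → x ≈ y → x * z ≈ y * z
    *-congʳ-nonNeg 0≤z p = ≤-antisym (*-monoʳ-nonNeg 0≤z (≈⇒≤ p)) (*-monoʳ-nonNeg 0≤z (≈⇒≥ p))

    *-congʳ : ∀ {x y} z → x ≈ y → x * z ≈ y * z
    *-congʳ {x} {y} z p =
      let K , 0≤K , 0≤z+K = nonNeg-difference z in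
      ≈-trans (≈-sym (x+y-y≈x (x * z) (x * K)))
        (≈-trans (+-cong (≈-trans (≈-sym (distribˡ x z K)) (≈-trans (*-congʳ-nonNeg 0≤z+K p) (distribˡ y z K)))
                         (neg-cong (*-congʳ-nonNeg 0≤K p)))
          (x+y-y≈x (y * z) (y * K)))

  *-cong : ∀ {x y u v} → x ≈ y → u ≈ v → x * u ≈ y * v
  *-cong {x} {y} {u} {v} p q = ≈-trans (*-congʳ u p)
    (≈-trans (*-comm y u) (≈-trans (*-congʳ y q) (*-comm v y)))

  commutativeRing : CommutativeRing 0ℓ 0ℓ
  commutativeRing = record
    { Carrier = ℝ ; _≈_ = _≈_ ; _+_ = _+_ ; _*_ = _*_ ; -_ = -_ ; 0# = 0# ; 1# = 1#
    ; isCommutativeRing = record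
      { isRing = record
        { +-isAbelianGroup = record
          { isGroup = record
            { isMonoid = record
              { isSemigroup = record
                { isMagma = record
                  { isEquivalence = record { refl = ≈-refl ; sym = ≈-sym ; trans = ≈-trans }
                  ; ∙-cong = +-cong }
                ; assoc = +-assoc }
              ; identity = +-identityˡ , +-identityʳ }
            ; inverse = +-inverseˡ , +-inverseʳ
            ; ⁻¹-cong = neg-cong }
          ; comm = +-comm }
        ; *-cong = *-cong
        ; *-assoc = *-assoc
        ; *-identity = *-identityˡ , (λ x → ≈-trans (*-comm x 1#) (*-identityˡ x))
        ; distrib = distribˡ , distribʳ }
      ; *-comm = *-comm } }

  private
    ring = ACR.fromCommutativeRing commutativeRing

    ι-homomorphism : ℤ.+-*-rawRing ACR.-Raw-AlmostCommutative⟶ ring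
    ι-homomorphism = record
      { ⟦_⟧ = ι ; +-homo = ι-+ ; *-homo = ι-* ; -‿homo = ι-neg ; 0-homo = ≈-refl ; 1-homo = ≈-refl }

    ι-≟ : ∀ a b → Maybe (ι a ≈ ι b)
    ι-≟ a b with a ℤ.≟ b
    ... | yes refl = just ≈-refl
    ... | no  _    = nothing

  module Solver = Algebra.Solver.Ring ℤ.+-*-rawRing ring ι-homomorphism ι-≟
  open Solver

  +-monoʳ-≤ : ∀ z {x y} → x ≤ y → z + x ≤ z + y
  +-monoʳ-≤ z = +-mono-≤ ≤-refl

  +-monoˡ-≤ : ∀ z {x y} → x ≤ y → x + z ≤ y + z
  +-monoˡ-≤ z p = +-mono-≤ p ≤-refl

  *-monoˡ-≤ : ∀ {x y z} → 0# ≤ z → x ≤ y → x * z ≤ y * z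
  *-monoˡ-≤ = *-monoʳ-nonNeg

  *-monoʳ-≤ : ∀ {x y z} → 0# ≤ z → x ≤ y → z * x ≤ z * y
  *-monoʳ-≤ {x} {y} {z} 0≤z p = ≤-trans (≈⇒≤ (*-comm z x)) (≤-trans (*-monoˡ-≤ 0≤z p) (≈⇒≤ (*-comm y z)))

  *-mono-≤ : ∀ {x y u v} → 0# ≤ x → 0# ≤ v → x ≤ y → u ≤ v → x * u ≤ y * v
  *-mono-≤ 0≤x 0≤v p q = ≤-trans (*-monoʳ-≤ 0≤x q) (*-monoˡ-≤ 0≤v p)

  -- An inequality follows from another one with the same difference of sides.
  ≤-via : ∀ {x y u v} → u ≤ v → y - x ≈ v - u → x ≤ y
  ≤-via p e = 0≤y-x⇒x≤y (≤-trans (x≤y⇒0≤y-x p) (≈⇒≥ e))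

  +-nonNeg : ∀ {x y} → 0# ≤ x → 0# ≤ y → 0# ≤ x + y
  +-nonNeg p q = ≤-trans (≈⇒≥ (+-identityˡ 0#)) (+-mono-≤ p q)

  ι-mono : ∀ {a b} → a ℤ.≤ b → ι a ≤ ι b
  ι-mono p = ≤-trans (≈⇒≤ (ι-ιᵠ _)) (≤-trans (ιᵠ-mono (/1-mono p)) (≈⇒≥ (ι-ιᵠ _)))

  ι-cancel : ∀ {a b} → ι a ≤ ι b → a ℤ.≤ b
  ι-cancel p = /1-cancel (ιᵠ-cancel (≤-trans (≈⇒≥ (ι-ιᵠ _)) (≤-trans p (≈⇒≤ (ι-ιᵠ _)))))

  ιₙ-mono : ∀ {a b} → a ℕ.≤ b → ιₙ a ≤ ιₙ b
  ιₙ-mono p = ι-mono (ℤ.+≤+ p)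

  ιₙ-cancel : ∀ {a b} → ιₙ a ≤ ιₙ b → a ℕ.≤ b
  ιₙ-cancel p = ℤ.drop‿+≤+ (ι-cancel p)

  ιₙ-mono-< : ∀ {a b} → a ℕ.< b → ιₙ a < ιₙ b
  ιₙ-mono-< p = ≰⇒> λ q → ℕ.<⇒≱ p (ιₙ-cancel q)

  ιₙ-+ : ∀ a b → ιₙ (a ℕ.+ b) ≈ ιₙ a + ιₙ b
  ιₙ-+ a b = ι-+ (+ a) (+ b)

  ιₙ-* : ∀ a b → ιₙ (a ℕ.* b) ≈ ιₙ a * ιₙ b
  ιₙ-* a b = ≈-trans (≈-reflexive (cong ι (ℤ.pos-* a b))) (ι-* (+ a) (+ b))

  ιₙ-suc : ∀ a → ιₙ (suc a) ≈ 1# + ιₙ a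
  ιₙ-suc a = ιₙ-+ 1 a

  ιₙ-^ : ∀ a n → ιₙ (a ℕ.^ n) ≈ ιₙ a ^ n
  ιₙ-^ a zero    = ≈-refl
  ιₙ-^ a (suc n) = ≈-trans (ιₙ-* a (a ℕ.^ n)) (*-cong ≈-refl (ιₙ-^ a n))

  0≤ιₙ : ∀ n → 0# ≤ ιₙ n
  0≤ιₙ n = ιₙ-mono ℕ.z≤n

  0<1 : 0# < 1#
  0<1 = ιₙ-mono-< (ℕ.s≤s ℕ.z≤n)

  0≤1 : 0# ≤ 1#
  0≤1 = 0≤ιₙ 1

  *-pos : ∀ {x y} → 0# < x → 0# < y → 0# < x * y
  *-pos {x} {y} 0<x 0<y =
    let δ , 0<δ , δ≤x = <-rational 0<x
        η , 0<η , η≤y = <-rational 0<y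
        0≤δ = ≤-trans (≈⇒≤ (ι-ιᵠ (+ 0))) (ιᵠ-mono (ℚ.<⇒≤ 0<δ))
    in <-≤-trans (≤-<-trans (≈⇒≤ (ι-ιᵠ (+ 0))) (ιᵠ-mono-< (0<* 0<δ 0<η)))
      (≤-trans (≈⇒≤ (ιᵠ-* δ η))
        (*-mono-≤ 0≤δ (<⇒≤ 0<y)
          (≤-trans (≈⇒≥ (+-identityˡ _)) δ≤x) (≤-trans (≈⇒≥ (+-identityˡ _)) η≤y)))

  x<y⇒0<y-x : ∀ {x y} → x < y → 0# < y - x
  x<y⇒0<y-x {x} {y} p = ≰⇒> λ q → <⇒≱ p (0≤y-x⇒x≤y
    (≤-trans (≤-trans (≈⇒≥ (solve 0 (:- con (+ 0) := con (+ 0)) refl≈)) (neg-antimono q))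
      (≈⇒≤ (solve 2 (λ x y → :- (y :- x) := x :- y) refl≈ x y))))
    where
    refl≈ = ≈-refl

  0<y-x⇒x<y : ∀ {x y} → 0# < y - x → x < y
  0<y-x⇒x<y {x} {y} p = ≰⇒> λ q → <⇒≱ p
    (≤-trans (+-monoˡ-≤ (- x) q) (≈⇒≤ (+-inverseʳ x)))

  *-monoʳ-< : ∀ {x y z} → 0# < z → x < y → z * x < z * y
  *-monoʳ-< {x} {y} {z} 0<z p = 0<y-x⇒x<y (<-≤-trans (*-pos 0<z (x<y⇒0<y-x p))
    (≈⇒≤ (solve 3 (λ x y z → z :* (y :- x) := z :* y :- z :* x) ≈-refl x y z)))

  *-cancelˡ-≤ : ∀ {x y z} → 0# < z → z * x ≤ z * y → x ≤ y
  *-cancelˡ-≤ 0<z p = ≮⇒≥ λ q → <⇒≱ (*-monoʳ-< 0<z q) p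

  *-cancelˡ : ∀ {x y z} → 0# < z → z * x ≈ z * y → x ≈ y
  *-cancelˡ 0<z p = ≤-antisym (*-cancelˡ-≤ 0<z (≈⇒≤ p)) (*-cancelˡ-≤ 0<z (≈⇒≥ p))

  opaque
    unfolding _≤_

    reciprocal-inverse-ℝ : ∀ d → ιₙ (suc d) * ιᵠ (reciprocal d) ≈ 1#
    reciprocal-inverse-ℝ d = pointwise-≈ {ιₙ (suc d) * ιᵠ (reciprocal d)} {1#} (λ _ → reciprocal-inverse d)

    *ᴿ-* : ∀ x y → x *ᴿ y ≡ x * y
    *ᴿ-* x y = refl

    +ᴿ-+ : ∀ x y → x +ᴿ y ≡ x + y
    +ᴿ-+ x y = refl

    -ᴿ-neg : ∀ x → -ᴿ x ≡ - x
    -ᴿ-neg x = refl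

    fromℚ-ιᵠ : ∀ q → fromℚ q ≡ ιᵠ q
    fromℚ-ιᵠ q = refl

    fromℕ-ιₙ : ∀ n → fromℕ n ≡ ιₙ n
    fromℕ-ιₙ n = refl

    ≤ᴿ⇒≤ : ∀ {x y} → x ≤ᴿ y → x ≤ y
    ≤ᴿ⇒≤ p = p

    ≤⇒≤ᴿ : ∀ {x y} → x ≤ y → x ≤ᴿ y
    ≤⇒≤ᴿ p = p

    <ᴿ⇒< : ∀ {x y} → x <ᴿ y → x < y
    <ᴿ⇒< p = p

    <⇒<ᴿ : ∀ {x y} → x < y → x <ᴿ y
    <⇒<ᴿ p = p

  ÷-/ : ∀ x d → x ÷ d ≡ x / d
  ÷-/ x zero    = fromℕ-ιₙ 0
  ÷-/ x (suc d) = *ᴿ-ιᵠ (+ 1 ℚ./ suc d)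
    where
    *ᴿ-ιᵠ : ∀ q → x *ᴿ fromℚ q ≡ x * ιᵠ q
    *ᴿ-ιᵠ q = subst (λ z → x *ᴿ z ≡ x * ιᵠ q) {ιᵠ q} {fromℚ q} (sym (fromℚ-ιᵠ q)) (*ᴿ-* x (ιᵠ q))

  /-inverse : ∀ x d .{{_ : ℕ.NonZero d}} → ιₙ d * (x / d) ≈ x
  /-inverse x (suc d) = ≈-trans 
    (solve 3 (λ a x b → a :* (x :* b) := x :* (a :* b)) ≈-refl (ιₙ (suc d)) x (ιᵠ (reciprocal d)))
    (≈-trans (*-cong ≈-refl (reciprocal-inverse-ℝ d))
      (solve 1 (λ x → x :* con (+ 1) := x) ≈-refl x))

  ^ₙ-^ : ∀ x n → x ^ₙ n ≡ x ^ n
  ^ₙ-^ x zero    = fromℕ-ιₙ 1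
  ^ₙ-^ x (suc n) = subst (λ z → x *ᴿ (x ^ₙ n) ≡ x * z) {x ^ₙ n} {x ^ n} (^ₙ-^ x n) (*ᴿ-* x (x ^ₙ n))

  ^-nonNeg : ∀ {x} n → 0# ≤ x → 0# ≤ x ^ n
  ^-nonNeg zero    _ = 0≤1
  ^-nonNeg (suc n) p = *-nonNeg p (^-nonNeg n p)

  ^-pos : ∀ {x} n → 0# < x → 0# < x ^ n
  ^-pos zero    _ = 0<1
  ^-pos (suc n) p = *-pos p (^-pos n p)

  ^-mono : ∀ {x y} n → 0# ≤ x → x ≤ y → x ^ n ≤ y ^ n
  ^-mono zero    _ _ = ≤-refl
  ^-mono (suc n) p q = *-mono-≤ p (^-nonNeg n (≤-trans p q)) q (^-mono n p q)

  *-^ : ∀ x y n → (x * y) ^ n ≈ x ^ n * y ^ n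
  *-^ x y zero    = ≈-sym (*-identityˡ 1#)
  *-^ x y (suc n) = ≈-trans (*-cong ≈-refl (*-^ x y n))
    (solve 4 (λ x y u v → (x :* y) :* (u :* v) := (x :* u) :* (y :* v)) ≈-refl x y (x ^ n) (y ^ n))

  0<ιᵠ : ∀ {δ} → 0ℚ ℚ.< δ → 0# < ιᵠ δ
  0<ιᵠ h = ≤-<-trans (≈⇒≤ (ι-ιᵠ (+ 0))) (ιᵠ-mono-< h)

  ≤-archimedean-ratio : ∀ {x} y → 0# < x → ∃ λ n → y ≤ ιₙ n * x
  ≤-archimedean-ratio {x} y 0<x =
    let δ , 0<δ , δ≤x = <-rational 0<x
        K , hK = reciprocal-archimedean 0<δ
        n , y≤n = ≤-archimedean-ℝ y
        one : 1# ≤ ιₙ (suc K) * x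
        one = begin
          1#                                ≈⟨ ≈-trans (ι-ιᵠ (+ 1)) (≈-trans (≈-reflexive (cong ιᵠ (sym (reciprocal-inverse K)))) (≈-trans (ιᵠ-* _ _) (*-cong (≈-sym (ι-ιᵠ (+ suc K))) ≈-refl))) ⟩
          ιₙ (suc K) * ιᵠ (reciprocal K)    ≤⟨ *-monoʳ-≤ (0≤ιₙ (suc K)) (ιᵠ-mono (hK K ℕ.≤-refl)) ⟩
          ιₙ (suc K) * ιᵠ δ                 ≤⟨ *-monoʳ-≤ (0≤ιₙ (suc K)) (≤-trans (≈⇒≥ (+-identityˡ _)) δ≤x) ⟩
          ιₙ (suc K) * x                    ∎
    in n ℕ.* suc K , (begin
      y                          ≤⟨ y≤n ⟩
      ιₙ n                       ≈⟨ solve 1 (λ n → n := n :* con (+ 1)) ≈-refl (ιₙ n) ⟩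
      ιₙ n * 1#                  ≤⟨ *-monoʳ-≤ (0≤ιₙ n) one ⟩
      ιₙ n * (ιₙ (suc K) * x)    ≈⟨ ≈-sym (*-assoc _ _ _) ⟩
      ιₙ n * ιₙ (suc K) * x      ≈⟨ *-cong (≈-sym (ιₙ-* n (suc K))) ≈-refl ⟩
      ιₙ (n ℕ.* suc K) * x       ∎)
    where open ≤-Reasoning

module Series (em : ExcludedMiddle 0ℓ) where
  open Reals em
  open ℚ-Lemmas hiding (≤-via)
  open Solver
  open ≤-Reasoning

  lim-≤ : ∀ {q : ℕ → ℚ} (c : IsCauchy q) {x} N → (∀ n → N ℕ.≤ n → ιᵠ (q n) ≤ x) → mkℝ q c ≤ x
  lim-≤ {q} c {x} N h = ≤-via
    (≤-trans (≤-lim {λ n → ℚ.- q n} (negᶜ {q} c) { - x} N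
      (λ n N≤n → ≤-trans (neg-antimono (h n N≤n)) (≈⇒≥ (ιᵠ-neg (q n))))) (≈⇒≤ (neg-lim {q} c (negᶜ {q} c))))
    (solve 2 (λ l x → x :- l := (:- l) :- (:- x)) ≈-refl (mkℝ q c) x)

  half : ∀ {x} → 0# < x → ∃ λ y → 0# < y × y + y ≤ x
  half {x} 0<x = let δ , 0<δ , δ≤x = <-rational 0<x in
    ιᵠ (½ ℚ.* δ) , 0<ιᵠ (half>0 0<δ) , (begin
      ιᵠ (½ ℚ.* δ) + ιᵠ (½ ℚ.* δ)   ≈⟨ ≈-sym (ιᵠ-+ _ _) ⟩
      ιᵠ (½ ℚ.* δ ℚ.+ ½ ℚ.* δ)      ≈⟨ ≈-reflexive (cong ιᵠ (trans (sym (ℚ.*-distribʳ-+ δ ½ ½)) (ℚ.*-identityˡ δ))) ⟩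
      ιᵠ δ                          ≈⟨ ≈-sym (+-identityˡ _) ⟩
      0# + ιᵠ δ                     ≤⟨ δ≤x ⟩
      x                             ∎)

  ε-≤ : ∀ {x y} → (∀ {δ} → 0ℚ ℚ.< δ → x ≤ y + ιᵠ δ) → x ≤ y
  ε-≤ {x} {y} h = ≮⇒≥ λ y<x →
    let δ , 0<δ , y+δ≤x = <-rational y<x
        e , 0<e , e+e≤δ = half (0<ιᵠ 0<δ)
        η , 0<η , η≤e = <-rational 0<e
    in <-irrefl (begin-strict
      x              ≤⟨ h 0<η ⟩
      y + ιᵠ η       ≤⟨ +-monoʳ-≤ y (≤-trans (≈⇒≥ (+-identityˡ _)) η≤e) ⟩
      y + e          <⟨ 0<y-x⇒x<y (<-≤-trans 0<e (≈⇒≤ (solve 2 (λ y e → e := (y :+ (e :+ e)) :- (y :+ e)) ≈-refl y e))) ⟩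
      y + (e + e)    ≤⟨ +-monoʳ-≤ y e+e≤δ ⟩
      y + ιᵠ δ       ≤⟨ y+δ≤x ⟩
      x              ∎)

  h : ℝ
  h = 1# / 4

  4h≈1 : ιₙ 4 * h ≈ 1#
  4h≈1 = /-inverse 1# 4

  0<h : 0# < h
  0<h = ≰⇒> λ p → <⇒≱ 0<1 (begin
    1#        ≈⟨ ≈-sym 4h≈1 ⟩
    ιₙ 4 * h  ≤⟨ *-monoʳ-≤ (0≤ιₙ 4) p ⟩
    ιₙ 4 * 0# ≈⟨ solve 1 (λ a → a :* con (+ 0) := con (+ 0)) ≈-refl (ιₙ 4) ⟩
    0#        ∎)

  h≤1 : h ≤ 1#
  h≤1 = *-cancelˡ-≤ (ιₙ-mono-< {0} {4} (ℕ.s≤s ℕ.z≤n)) (begin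
    ιₙ 4 * h   ≈⟨ 4h≈1 ⟩
    1#         ≤⟨ ιₙ-mono {1} {4} (ℕ.s≤s ℕ.z≤n) ⟩
    ιₙ 4       ≈⟨ solve 1 (λ a → a := a :* con (+ 1)) ≈-refl (ιₙ 4) ⟩
    ιₙ 4 * 1#  ∎)

  0<h^ : ∀ n → 0# < h ^ n
  0<h^ n = ^-pos n 0<h

  0≤h^ : ∀ n → 0# ≤ h ^ n
  0≤h^ n = <⇒≤ (0<h^ n)

  h^-+ : ∀ m n → h ^ (m ℕ.+ n) ≈ h ^ m * h ^ n
  h^-+ zero    n = ≈-sym (*-identityˡ _)
  h^-+ (suc m) n = ≈-trans (*-cong ≈-refl (h^-+ m n)) (≈-sym (*-assoc _ _ _))

  h^≤1 : ∀ n → h ^ n ≤ 1#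
  h^≤1 zero    = ≤-refl
  h^≤1 (suc n) = ≤-trans (*-mono-≤ (<⇒≤ 0<h) 0≤1 h≤1 (h^≤1 n)) (≈⇒≤ (*-identityˡ 1#))

  h^-anti : ∀ {m n} → m ℕ.≤ n → h ^ n ≤ h ^ m
  h^-anti {m} {n} m≤n = begin
    h ^ n                    ≈⟨ ≈-reflexive (cong (h ^_) (sym (ℕ.m+[n∸m]≡n m≤n))) ⟩
    h ^ (m ℕ.+ (n ℕ.∸ m))    ≈⟨ h^-+ m (n ℕ.∸ m) ⟩
    h ^ m * h ^ (n ℕ.∸ m)    ≤⟨ *-monoʳ-≤ (0≤h^ m) (h^≤1 (n ℕ.∸ m)) ⟩
    h ^ m * 1#               ≈⟨ solve 1 (λ a → a :* con (+ 1) := a) ≈-refl (h ^ m) ⟩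
    h ^ m                    ∎

  n*h^n≤1 : ∀ n → ιₙ n * h ^ n ≤ 1#
  n*h^n≤1 zero    = ≤-trans (≈⇒≤ (solve 0 (con (+ 0) :* con (+ 1) := con (+ 0)) ≈-refl)) 0≤1
  n*h^n≤1 (suc n) = begin
    ιₙ (suc n) * (h * h ^ n)          ≈⟨ *-cong (ιₙ-suc n) ≈-refl ⟩
    (1# + ιₙ n) * (h * h ^ n)         ≈⟨ solve 3 (λ n h k → (con (+ 1) :+ n) :* (h :* k) := h :* (k :+ n :* k)) ≈-refl (ιₙ n) h (h ^ n) ⟩
    h * (h ^ n + ιₙ n * h ^ n)        ≤⟨ *-monoʳ-≤ (<⇒≤ 0<h) (≤-trans (+-mono-≤ (h^≤1 n) (n*h^n≤1 n)) (≤-trans (≈⇒≥ (ιₙ-+ 1 1)) (ιₙ-mono {2} {4} (ℕ.s≤s (ℕ.s≤s ℕ.z≤n))))) ⟩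
    h * ιₙ 4                          ≈⟨ ≈-trans (*-comm _ _) 4h≈1 ⟩
    1#                                ∎

  h^-small : ∀ A {x} → 0# < x → ∃ λ N → A * h ^ N < x
  h^-small A {x} 0<x = let n , A+1≤nx = ≤-archimedean-ratio (A + 1#) 0<x in n , (begin-strict
    A * h ^ n            ≈⟨ *-comm _ _ ⟩
    h ^ n * A            <⟨ *-monoʳ-< (0<h^ n) (0<y-x⇒x<y (<-≤-trans 0<1 (≈⇒≤ (solve 1 (λ a → con (+ 1) := (a :+ con (+ 1)) :- a) ≈-refl A)))) ⟩
    h ^ n * (A + 1#)     ≤⟨ *-monoʳ-≤ (0≤h^ n) A+1≤nx ⟩
    h ^ n * (ιₙ n * x)   ≈⟨ solve 3 (λ k n x → k :* (n :* x) := (n :* k) :* x) ≈-refl (h ^ n) (ιₙ n) x ⟩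
    (ιₙ n * h ^ n) * x   ≤⟨ *-monoˡ-≤ (<⇒≤ 0<x) (n*h^n≤1 n) ⟩
    1# * x               ≈⟨ *-identityˡ x ⟩
    x                    ∎)

  h^-≤ : ∀ A {x y} → (∀ n → x ≤ y + A * h ^ n) → x ≤ y
  h^-≤ A {x} {y} p = ≮⇒≥ λ y<x → let n , small = h^-small A (x<y⇒0<y-x y<x) in
    <-irrefl (begin-strict
      x                 ≤⟨ p n ⟩
      y + A * h ^ n     <⟨ 0<y-x⇒x<y (<-≤-trans (x<y⇒0<y-x small) (≈⇒≤ (solve 3 (λ x y a → (x :- y) :- a := x :- (y :+ a)) ≈-refl x y (A * h ^ n)))) ⟩
      x                 ∎)

  infix 4 ∣_∣≤_

  ∣_∣≤_ : ℝ → ℝ → Set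
  ∣ x ∣≤ b = - b ≤ x × x ≤ b

  abs-cong : ∀ {x y b} → x ≈ y → ∣ x ∣≤ b → ∣ y ∣≤ b
  abs-cong e (p , q) = ≤-trans p (≈⇒≤ e) , ≤-trans (≈⇒≥ e) q

  abs-mono : ∀ {x b c} → b ≤ c → ∣ x ∣≤ b → ∣ x ∣≤ c
  abs-mono e (p , q) = ≤-trans (neg-antimono e) p , ≤-trans q e

  abs-+ : ∀ {x y b c} → ∣ x ∣≤ b → ∣ y ∣≤ c → ∣ x + y ∣≤ b + c
  abs-+ {b = b} {c} (p , q) (r , s) =
    ≤-trans (≈⇒≤ (solve 2 (λ b c → :- (b :+ c) := (:- b) :+ (:- c)) ≈-refl b c)) (+-mono-≤ p r) , +-mono-≤ q s

  abs-neg : ∀ {x b} → ∣ x ∣≤ b → ∣ - x ∣≤ b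
  abs-neg {x} {b} (p , q) = neg-antimono q , ≤-trans (neg-antimono p) (≈⇒≤ (solve 1 (λ b → :- (:- b) := b) ≈-refl b))

  -- Both b c - x y and b c + x y are half the sum of two products of nonnegative factors.
  abs-* : ∀ {x y b c} → ∣ x ∣≤ b → ∣ y ∣≤ c → ∣ x * y ∣≤ b * c
  abs-* {x} {y} {b} {c} (p , q) (r , s) =
      *-cancelˡ-≤ 0<2 (≤-via (+-nonNeg (*-nonNeg b-x c-y) (*-nonNeg b+x c+y))
        (solve 4 (λ x y b c → con (+ 2) :* (x :* y) :- con (+ 2) :* (:- (b :* c)) :=
           ((b :- x) :* (c :- y) :+ (x :- (:- b)) :* (y :- (:- c))) :- con (+ 0)) ≈-refl x y b c))
    , *-cancelˡ-≤ 0<2 (≤-via (+-nonNeg (*-nonNeg b-x c+y) (*-nonNeg b+x c-y))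
        (solve 4 (λ x y b c → con (+ 2) :* (b :* c) :- con (+ 2) :* (x :* y) :=
           ((b :- x) :* (y :- (:- c)) :+ (x :- (:- b)) :* (c :- y)) :- con (+ 0)) ≈-refl x y b c))
    where
    0<2 = ιₙ-mono-< {0} {2} (ℕ.s≤s ℕ.z≤n)
    b-x = x≤y⇒0≤y-x q
    b+x = x≤y⇒0≤y-x p
    c-y = x≤y⇒0≤y-x s
    c+y = x≤y⇒0≤y-x r

  abs-0 : ∣ 0# ∣≤ 0#
  abs-0 = ≈⇒≤ (solve 0 (:- con (+ 0) := con (+ 0)) ≈-refl) , ≤-refl

  abs-nonNeg : ∀ {x} → 0# ≤ x → ∣ x ∣≤ x
  abs-nonNeg p = ≤-trans (neg-antimono p) (≤-trans (proj₂ (abs-neg abs-0)) p) , ≤-refl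

  abs-cancel : ∀ {x b c} → 0# < c → ∣ c * x ∣≤ c * b → ∣ x ∣≤ b
  abs-cancel {x} {b} {c} 0<c (p , q) =
    *-cancelˡ-≤ 0<c (≤-trans (≈⇒≤ (solve 2 (λ c b → c :* (:- b) := :- (c :* b)) ≈-refl c b)) p) , *-cancelˡ-≤ 0<c q

  abs-bound : ∀ x → ∃ λ K → ∣ x ∣≤ ιₙ K
  abs-bound x = let m , p = ≤-archimedean-ℝ x
                    n , q = ≤-archimedean-ℝ (- x)
                    n≤ = ιₙ-mono (ℕ.m≤n⊔m m n)
    in m ℕ.⊔ n , ≤-trans (neg-antimono (≤-trans q n≤)) (≈⇒≤ (solve 1 (λ x → :- (:- x) := x) ≈-refl x)) ,
       ≤-trans p (ιₙ-mono (ℕ.m≤m⊔n m n))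

  private
    module Completion (s : ℕ → ℝ) (A : ℝ) (s-fast : ∀ m k → ∣ s (m ℕ.+ k) - s m ∣≤ A * h ^ m) where

      approx-s : ∀ n → ∃ λ q → s n ≤ ιᵠ q + h ^ n × ιᵠ q ≤ s n + h ^ n
      approx-s n =
        let δ , 0<δ , δ≤ = <-rational (0<h^ n)
            q , a , b = rational-approx (s n) 0<δ
            δ≤h = ≤-trans (≈⇒≥ (+-identityˡ _)) δ≤
        in q , ≤-trans a (+-monoʳ-≤ _ δ≤h) , ≤-trans b (+-monoʳ-≤ _ δ≤h)

      q : ℕ → ℚ
      q n = proj₁ (approx-s n)

      s≤q : ∀ n → s n ≤ ιᵠ (q n) + h ^ n
      s≤q n = proj₁ (proj₂ (approx-s n))

      q≤s : ∀ n → ιᵠ (q n) ≤ s n + h ^ n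
      q≤s n = proj₂ (proj₂ (approx-s n))

      fast : ∀ {m n} → m ℕ.≤ n → ∣ s n - s m ∣≤ A * h ^ m
      fast {m} {n} m≤n = abs-cong (≈-reflexive (cong (λ k → s k - s m) (ℕ.m+[n∸m]≡n m≤n))) (s-fast m (n ℕ.∸ m))

      q≤ : ∀ {m n} → m ℕ.≤ n → ιᵠ (q n) ≤ (s m + A * h ^ m) + h ^ n
      q≤ {m} {n} m≤n = ≤-via (+-mono-≤ (q≤s n) (proj₂ (fast m≤n)))
        (solve 5 (λ a b c d e → ((b :+ c) :+ d) :- a := ((e :+ d) :+ c) :- (a :+ (e :- b))) ≈-refl (ιᵠ (q n)) (s m) (A * h ^ m) (h ^ n) (s n))

      ≤q : ∀ {m n} → m ℕ.≤ n → s m ≤ (ιᵠ (q n) + A * h ^ m) + h ^ n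
      ≤q {m} {n} m≤n = ≤-via (+-mono-≤ (s≤q n) (proj₁ (fast m≤n)))
        (solve 5 (λ a b c d e → ((a :+ c) :+ d) :- b := ((a :+ d) :+ (e :- b)) :- (e :+ :- c)) ≈-refl (ιᵠ (q n)) (s m) (A * h ^ m) (h ^ n) (s n))

      c : IsCauchy q
      c {δ} 0<δ = let N , small = h^-small (ιₙ 2 * (A + 1#)) (0<ιᵠ 0<δ) in N , λ m n N≤m N≤n →
        ≤-∣-∣ {q m} {q n} {δ} (close N small N≤m N≤n) (close N small N≤n N≤m)
        where
        close : ∀ N → ιₙ 2 * (A + 1#) * h ^ N < ιᵠ δ → ∀ {m n} → N ℕ.≤ m → N ℕ.≤ n → q m ℚ.≤ q n ℚ.+ δ
        close N small {m} {n} N≤m N≤n = ιᵠ-cancel (begin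
          ιᵠ (q m)                        ≤⟨ ≤-via (+-mono-≤ (+-mono-≤ (q≤ N≤m) (≤q N≤n)) (+-mono-≤ (+-mono-≤ (h^-anti N≤m) (h^-anti N≤n)) (<⇒≤ small)))
            (solve 8 (λ a b d s A k l m → (b :+ d) :- a :=
               (((s :+ A :* k) :+ l) :+ ((b :+ A :* k) :+ m) :+ ((k :+ k) :+ d)) :- ((a :+ s) :+ ((l :+ m) :+ con (+ 2) :* (A :+ con (+ 1)) :* k))) ≈-refl
               (ιᵠ (q m)) (ιᵠ (q n)) (ιᵠ δ) (s N) A (h ^ N) (h ^ m) (h ^ n)) ⟩
          ιᵠ (q n) + ιᵠ δ                 ≈⟨ ≈-sym (ιᵠ-+ (q n) δ) ⟩
          ιᵠ (q n ℚ.+ δ)                  ∎)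

      l : ℝ
      l = mkℝ q c

      limit : ∀ m → ∣ l - s m ∣≤ A * h ^ m
      limit m =
          ≤-via (h^-≤ 1# {s m} {l + A * h ^ m} λ n → ≤-via (≤-lim {q} c {(s m - A * h ^ m) - h ^ n} (m ℕ.⊔ n) λ k m⊔n≤k →
              ≤-via (+-mono-≤ (≤q (ℕ.m⊔n≤o⇒m≤o m n m⊔n≤k)) (h^-anti (ℕ.m⊔n≤o⇒n≤o m n m⊔n≤k)))
                (solve 5 (λ q s a k l → q :- ((s :- a) :- k) := (((q :+ a) :+ l) :+ k) :- (s :+ l)) ≈-refl (ιᵠ (q k)) (s m) (A * h ^ m) (h ^ n) (h ^ k)))
              (solve 4 (λ l s a k → ((l :+ a) :+ con (+ 1) :* k) :- s := l :- ((s :- a) :- k)) ≈-refl l (s m) (A * h ^ m) (h ^ n)))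
            (solve 3 (λ l s a → (l :- s) :- (:- a) := (l :+ a) :- s) ≈-refl l (s m) (A * h ^ m))
        , ≤-via (h^-≤ 1# {l} {s m + A * h ^ m} λ n → lim-≤ {q} c (m ℕ.⊔ n) λ k m⊔n≤k →
              ≤-via (+-mono-≤ (q≤ (ℕ.m⊔n≤o⇒m≤o m n m⊔n≤k)) (h^-anti (ℕ.m⊔n≤o⇒n≤o m n m⊔n≤k)))
                (solve 5 (λ q s a k l → ((s :+ a) :+ con (+ 1) :* k) :- q := (((s :+ a) :+ l) :+ k) :- (q :+ l)) ≈-refl (ιᵠ (q k)) (s m) (A * h ^ m) (h ^ n) (h ^ k)))
            (solve 3 (λ l s a → a :- (l :- s) := (s :+ a) :- l) ≈-refl l (s m) (A * h ^ m))

  complete : ∀ (s : ℕ → ℝ) A → (∀ m k → ∣ s (m ℕ.+ k) - s m ∣≤ A * h ^ m) →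
             ∃ λ l → ∀ m → ∣ l - s m ∣≤ A * h ^ m
  complete s A p = l , limit
    where open Completion s A p

module Exponential (em : ExcludedMiddle 0ℓ) where
  open Reals em
  open Series em
  open ℚ-Lemmas hiding (≤-via)
  open Solver
  open ≤-Reasoning

  partial : (ℕ → ℝ) → ℕ → ℝ
  partial u zero    = 0#
  partial u (suc n) = partial u n + u n

  partial-cong : ∀ {u w} → (∀ n → u n ≈ w n) → ∀ n → partial u n ≈ partial w n
  partial-cong p zero    = ≈-refl
  partial-cong p (suc n) = +-cong (partial-cong p n) (p n)

  partial-suc : ∀ u n → partial u (suc n) ≈ u 0 + partial (λ i → u (suc i)) n
  partial-suc u zero    = +-comm 0# (u 0)
  partial-suc u (suc n) = ≈-trans (+-cong (partial-suc u n) ≈-refl) (+-assoc _ _ _)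

  GeometricallyBounded : (ℕ → ℝ) → ℝ → Set
  GeometricallyBounded u A = ∀ n → ∣ u n ∣≤ A * h ^ n

  module _ {u A} (0≤A : 0# ≤ A) (u-bound : GeometricallyBounded u A) where

    -- The bound 2 A (h ^ m - h ^ (m + k)) telescopes, as 2 (1 - h) ≥ 1.
    private
      tail : ∀ m k → ∣ partial u (m ℕ.+ k) - partial u m ∣≤ ιₙ 2 * A * (h ^ m - h ^ (m ℕ.+ k))
      tail m zero = abs-cong (≈-trans (≈-sym (+-inverseʳ _)) (+-cong (≈-reflexive (cong (partial u) (sym (ℕ.+-identityʳ m)))) ≈-refl))
        (abs-mono (≈⇒≤ (≈-trans (solve 2 (λ a x → con (+ 0) := con (+ 2) :* a :* (x :- x)) ≈-refl A (h ^ m))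
          (*-cong ≈-refl (+-cong ≈-refl (neg-cong (≈-reflexive (cong (h ^_) (sym (ℕ.+-identityʳ m))))))))) abs-0)
      tail m (suc k) = abs-cong
        (≈-trans (solve 3 (λ a b c → (a :- b) :+ c := (a :+ c) :- b) ≈-refl (partial u (m ℕ.+ k)) (partial u m) (u (m ℕ.+ k)))
          (+-cong (≈-reflexive (cong (partial u) (sym (ℕ.+-suc m k)))) ≈-refl))
        (abs-mono bound (abs-+ (tail m k) (u-bound (m ℕ.+ k))))
        where
        g = h ^ (m ℕ.+ k)
        slack : 0# ≤ A * (g * (1# - ιₙ 2 * h))
        slack = *-nonNeg 0≤A (*-nonNeg (0≤h^ (m ℕ.+ k)) (x≤y⇒0≤y-x (*-cancelˡ-≤ (ιₙ-mono-< {0} {2} (ℕ.s≤s ℕ.z≤n)) (begin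
          ιₙ 2 * (ιₙ 2 * h)   ≈⟨ solve 1 (λ h → con (+ 2) :* (con (+ 2) :* h) := con (+ 4) :* h) ≈-refl h ⟩
          ιₙ 4 * h            ≈⟨ 4h≈1 ⟩
          1#                  ≤⟨ ιₙ-mono {1} {2} (ℕ.s≤s ℕ.z≤n) ⟩
          ιₙ 2                ≈⟨ solve 0 (con (+ 2) := con (+ 2) :* con (+ 1)) ≈-refl ⟩
          ιₙ 2 * 1#           ∎))))
        bound : ιₙ 2 * A * (h ^ m - g) + A * g ≤ ιₙ 2 * A * (h ^ m - h ^ (m ℕ.+ suc k))
        bound = ≤-trans (≤-via slack
          (solve 4 (λ a x g h → (con (+ 2) :* a :* (x :- h :* g)) :- ((con (+ 2) :* a :* (x :- g)) :+ a :* g) :=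
             a :* (g :* (con (+ 1) :- con (+ 2) :* h)) :- con (+ 0)) ≈-refl A (h ^ m) g h))
          (≈⇒≤ (*-cong ≈-refl (+-cong ≈-refl (neg-cong (≈-reflexive (cong (h ^_) (sym (ℕ.+-suc m k))))))))

    series-sum : ∃ λ U → ∀ n → ∣ U - partial u n ∣≤ ιₙ 2 * A * h ^ n
    series-sum = complete (partial u) (ιₙ 2 * A) λ m k → abs-mono
      (≤-via (*-nonNeg (*-nonNeg (0≤ιₙ 2) 0≤A) (0≤h^ (m ℕ.+ k)))
        (solve 3 (λ a x y → a :* x :- a :* (x :- y) := a :* y :- con (+ 0)) ≈-refl (ιₙ 2 * A) (h ^ m) (h ^ (m ℕ.+ k)))) (tail m k)

  opaque
    term : ℝ → ℕ → ℝ
    term x n = (x ^ n) / (n !)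

    term-def : ∀ x n → (x ^ n) / (n !) ≡ term x n
    term-def x n = refl

  private
    0<! : ∀ n → 0# < ιₙ (n !)
    0<! n = ιₙ-mono-< (ℕ.1≤n! n)

    0<suc : ∀ n → 0# < ιₙ (suc n)
    0<suc n = ιₙ-mono-< (ℕ.s≤s ℕ.z≤n)

  opaque
    unfolding term

    !*term : ∀ x n → ιₙ (n !) * term x n ≈ x ^ n
    !*term x n = /-inverse (x ^ n) (n !) {{n ℕ.!≢0}}

  term-0 : ∀ x → term x 0 ≈ 1#
  term-0 x = ≈-trans (≈-sym (*-identityˡ _)) (!*term x 0)

  term-suc : ∀ x n → ιₙ (suc n) * term x (suc n) ≈ x * term x n
  term-suc x n = *-cancelˡ (0<! n) (begin-equality
    ιₙ (n !) * (ιₙ (suc n) * term x (suc n))   ≈⟨ solve 3 (λ a b c → a :* (b :* c) := (b :* a) :* c) ≈-refl (ιₙ (n !)) (ιₙ (suc n)) (term x (suc n)) ⟩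
    (ιₙ (suc n) * ιₙ (n !)) * term x (suc n)   ≈⟨ *-cong (≈-sym (ιₙ-* (suc n) (n !))) ≈-refl ⟩
    ιₙ (suc n !) * term x (suc n)              ≈⟨ !*term x (suc n) ⟩
    x * x ^ n                                  ≈⟨ *-cong ≈-refl (≈-sym (!*term x n)) ⟩
    x * (ιₙ (n !) * term x n)                  ≈⟨ solve 3 (λ a b c → a :* (b :* c) := b :* (a :* c)) ≈-refl x (ιₙ (n !)) (term x n) ⟩
    ιₙ (n !) * (x * term x n)                  ∎)

  -- The recurrence determines the terms.
  term-unique : ∀ {x} (u : ℕ → ℝ) → u 0 ≈ 1# → (∀ n → ιₙ (suc n) * u (suc n) ≈ x * u n) → ∀ n → u n ≈ term x n
  term-unique u e r zero    = ≈-trans e (≈-sym (term-0 _))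
  term-unique {x} u e r (suc n) = *-cancelˡ (0<suc n)
    (≈-trans (r n) (≈-trans (*-cong ≈-refl (term-unique u e r n)) (≈-sym (term-suc x n))))

  term-cong : ∀ {x y} → x ≈ y → ∀ n → term x n ≈ term y n
  term-cong {x} p = term-unique (term x) (term-0 x) λ n → ≈-trans (term-suc x n) (*-cong p ≈-refl)

  term-scale : ∀ c x n → c ^ n * term x n ≈ term (c * x) n
  term-scale c x = term-unique (λ n → c ^ n * term x n)
    (≈-trans (*-identityˡ _) (term-0 x))
    λ n → ≈-trans (solve 4 (λ m c k t → m :* ((c :* k) :* t) := (c :* k) :* (m :* t)) ≈-refl (ιₙ (suc n)) c (c ^ n) (term x (suc n)))
      (≈-trans (*-cong ≈-refl (term-suc x n))
        (solve 4 (λ c k x t → (c :* k) :* (x :* t) := (c :* x) :* (k :* t)) ≈-refl c (c ^ n) x (term x n)))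

  term-nonNeg : ∀ {x} → 0# ≤ x → ∀ n → 0# ≤ term x n
  term-nonNeg {x} p n = *-cancelˡ-≤ (0<! n) (begin
    ιₙ (n !) * 0#           ≈⟨ solve 1 (λ a → a :* con (+ 0) := con (+ 0)) ≈-refl (ιₙ (n !)) ⟩
    0#                      ≤⟨ ^-nonNeg n p ⟩
    x ^ n                   ≈⟨ ≈-sym (!*term x n) ⟩
    ιₙ (n !) * term x n     ∎)

  initially-bounded : ∀ (u : ℕ → ℝ) m → ∃ λ A → 0# ≤ A × ∀ n → n ℕ.≤ m → ∣ u n ∣≤ A
  initially-bounded u zero = let k , p = abs-bound (u 0) in ιₙ k , 0≤ιₙ k , λ { zero _ → p }
  initially-bounded u (suc m) =
    let A , 0≤A , f = initially-bounded u m
        k , p = abs-bound (u (suc m))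
    in A + ιₙ k , +-nonNeg 0≤A (0≤ιₙ k) , λ n n≤ → extend 0≤A f p (ℕ.m≤n⇒m<n∨m≡n n≤)
    where
    extend : ∀ {A k n} → 0# ≤ A → (∀ n → n ℕ.≤ m → ∣ u n ∣≤ A) → ∣ u (suc m) ∣≤ ιₙ k →
             n ℕ.< suc m ⊎ n ≡ suc m → ∣ u n ∣≤ A + ιₙ k
    extend {A} {k} {n} 0≤A f p (inj₁ (ℕ.s≤s n≤m)) = abs-mono (≤-trans (≈⇒≥ (+-identityʳ A)) (+-monoʳ-≤ A (0≤ιₙ k))) (f n n≤m)
    extend {A} {k} 0≤A f p (inj₂ refl) = abs-mono (≤-trans (≈⇒≥ (+-identityˡ (ιₙ k))) (+-monoˡ-≤ (ιₙ k) 0≤A)) p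

  term-bounded : ∀ x → ∃ λ A → 0# ≤ A × ∀ n → ∣ term x n ∣≤ A
  term-bounded x =
    let K , x≤K = abs-bound x
        A , 0≤A , f = initially-bounded (term x) K
    in A , 0≤A , bound x≤K 0≤A f
    where
    bound : ∀ {K A} → ∣ x ∣≤ ιₙ K → 0# ≤ A → (∀ n → n ℕ.≤ K → ∣ term x n ∣≤ A) → ∀ n → ∣ term x n ∣≤ A
    step : ∀ {K A} → ∣ x ∣≤ ιₙ K → 0# ≤ A → (∀ n → n ℕ.≤ K → ∣ term x n ∣≤ A) → ∀ n → Dec (suc n ℕ.≤ K) → ∣ term x (suc n) ∣≤ A
    bound x≤K 0≤A f zero    = f 0 ℕ.z≤n
    bound {K} x≤K 0≤A f (suc n) = step x≤K 0≤A f n (suc n ℕ.≤? K)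
    step x≤K 0≤A f n (yes n<K) = f (suc n) n<K
    step x≤K 0≤A f n (no  n≮K) = abs-cancel (0<suc n) (abs-mono
      (*-monoˡ-≤ 0≤A (ιₙ-mono (ℕ.<⇒≤ (ℕ.≰⇒> n≮K))))
      (abs-cong (≈-sym (term-suc x n)) (abs-* x≤K (bound x≤K 0≤A f n))))

  term-geometric : ∀ x → ∃ λ A → 0# ≤ A × GeometricallyBounded (term x) A
  term-geometric x = let A , 0≤A , f = term-bounded (ιₙ 4 * x) in A , 0≤A , λ n →
    abs-cong (≈-trans (*-comm _ _) (≈-trans (term-scale h (ιₙ 4 * x) n) (term-cong h4x n)))
      (abs-* (f n) (abs-nonNeg (0≤h^ n)))
    where
    h4x : h * (ιₙ 4 * x) ≈ x
    h4x = ≈-trans (solve 3 (λ h a x → h :* (a :* x) := (a :* h) :* x) ≈-refl h (ιₙ 4) x)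
      (≈-trans (*-cong 4h≈1 ≈-refl) (*-identityˡ x))

  conv : (ℕ → ℝ) → (ℕ → ℝ) → ℕ → ℝ
  conv u w zero    = u 0 * w 0
  conv u w (suc n) = u 0 * w (suc n) + conv (λ i → u (suc i)) w n

  private
    ∂ : (ℕ → ℝ) → ℕ → ℝ
    ∂ u n = ιₙ (suc n) * u (suc n)

    conv-cong : ∀ {u u′ w w′} → (∀ n → u n ≈ u′ n) → (∀ n → w n ≈ w′ n) → ∀ n → conv u w n ≈ conv u′ w′ n
    conv-cong p q zero    = *-cong (p 0) (q 0)
    conv-cong p q (suc n) = +-cong (*-cong (p 0) (q (suc n))) (conv-cong (λ i → p (suc i)) q n)

    conv-+ : ∀ u u′ w n → conv (λ i → u i + u′ i) w n ≈ conv u w n + conv u′ w n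
    conv-+ u u′ w zero    = distribʳ (w 0) (u 0) (u′ 0)
    conv-+ u u′ w (suc n) = ≈-trans (+-cong ≈-refl (conv-+ (λ i → u (suc i)) (λ i → u′ (suc i)) w n))
      (solve 5 (λ a b c d e → (a :+ b) :* c :+ (d :+ e) := (a :* c :+ d) :+ (b :* c :+ e)) ≈-refl
        (u 0) (u′ 0) (w (suc n)) (conv (λ i → u (suc i)) w n) (conv (λ i → u′ (suc i)) w n))

    conv-scale : ∀ a b u w n → conv (λ i → a * u i) (λ i → b * w i) n ≈ (a * b) * conv u w n
    conv-scale a b u w zero    = solve 4 (λ a b u w → (a :* u) :* (b :* w) := (a :* b) :* (u :* w)) ≈-refl a b (u 0) (w 0)
    conv-scale a b u w (suc n) = ≈-trans (+-cong ≈-refl (conv-scale a b (λ i → u (suc i)) w n))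
      (solve 5 (λ a b u w c → (a :* u) :* (b :* w) :+ (a :* b) :* c := (a :* b) :* (u :* w :+ c)) ≈-refl
        a b (u 0) (w (suc n)) (conv (λ i → u (suc i)) w n))

    leibniz : ∀ u w n → ιₙ (suc n) * conv u w (suc n) ≈ conv (∂ u) w n + conv u (∂ w) n
    leibniz u w zero = solve 4 (λ u₀ u₁ w₀ w₁ → con (+ 1) :* (u₀ :* w₁ :+ u₁ :* w₀) :=
      (con (+ 1) :* u₁) :* w₀ :+ u₀ :* (con (+ 1) :* w₁)) ≈-refl (u 0) (u 1) (w 0) (w 1)
    leibniz u w (suc n) = begin-equality
      N * (u 0 * w (suc (suc n)) + C)                             ≈⟨ distribˡ N _ _ ⟩
      N * (u 0 * w (suc (suc n))) + N * C                         ≈⟨ +-cong ≈-refl (*-cong (ιₙ-suc (suc n)) ≈-refl) ⟩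
      N * (u 0 * w (suc (suc n))) + (1# + ιₙ (suc n)) * C         ≈⟨ solve 3 (λ a n c → a :+ (con (+ 1) :+ n) :* c := (a :+ c) :+ n :* c) ≈-refl (N * (u 0 * w (suc (suc n)))) (ιₙ (suc n)) C ⟩
      (N * (u 0 * w (suc (suc n))) + (u 1 * w (suc n) + conv u″ w n)) + ιₙ (suc n) * C
                                                                  ≈⟨ +-cong ≈-refl (leibniz u′ w n) ⟩
      (N * (u 0 * w (suc (suc n))) + (u 1 * w (suc n) + conv u″ w n)) + (conv (∂ u′) w n + conv u′ (∂ w) n)
         ≈⟨ solve 7 (λ N u₀ w₂ u₁w c d e → (N :* (u₀ :* w₂) :+ (u₁w :+ c)) :+ (d :+ e) := (con (+ 1) :* u₁w :+ (d :+ c)) :+ (u₀ :* (N :* w₂) :+ e)) ≈-refl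
              N (u 0) (w (suc (suc n))) (u 1 * w (suc n)) (conv u″ w n) (conv (∂ u′) w n) (conv u′ (∂ w) n) ⟩
      (1# * (u 1 * w (suc n)) + (conv (∂ u′) w n + conv u″ w n)) + (u 0 * (N * w (suc (suc n))) + conv u′ (∂ w) n)
         ≈⟨ +-cong (+-cong (≈-sym (*-assoc _ _ _)) (≈-sym (conv-+ (∂ u′) u″ w n))) ≈-refl ⟩
      ((1# * u 1) * w (suc n) + conv (λ i → ∂ u′ i + u″ i) w n) + (u 0 * (N * w (suc (suc n))) + conv u′ (∂ w) n)
         ≈⟨ +-cong (+-cong ≈-refl (conv-cong shift (λ _ → ≈-refl) n)) ≈-refl ⟩
      conv (∂ u) w (suc n) + conv u (∂ w) (suc n)                 ∎
      where
      N = ιₙ (suc (suc n))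
      C = conv (λ i → u (suc i)) w (suc n)
      u′ = λ i → u (suc i)
      u″ = λ i → u (suc (suc i))
      shift : ∀ i → ∂ u′ i + u″ i ≈ ∂ u (suc i)
      shift i = ≈-trans (solve 2 (λ n u → n :* u :+ u := (con (+ 1) :+ n) :* u) ≈-refl (ιₙ (suc i)) (u (suc (suc i))))
        (*-cong (≈-sym (ιₙ-suc (suc i))) ≈-refl)

  term-conv : ∀ x y n → conv (term x) (term y) n ≈ term (x + y) n
  term-conv x y = term-unique (conv (term x) (term y))
    (≈-trans (*-cong (term-0 x) (term-0 y)) (*-identityˡ 1#))
    λ n → begin-equality
      ιₙ (suc n) * conv (term x) (term y) (suc n)   ≈⟨ leibniz (term x) (term y) n ⟩
      conv (∂ (term x)) (term y) n + conv (term x) (∂ (term y)) n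
        ≈⟨ +-cong (conv-cong (term-suc x) (λ i → ≈-sym (*-identityˡ _)) n) (conv-cong (λ i → ≈-sym (*-identityˡ _)) (term-suc y) n) ⟩
      conv (λ i → x * term x i) (λ i → 1# * term y i) n + conv (λ i → 1# * term x i) (λ i → y * term y i) n
        ≈⟨ +-cong (conv-scale x 1# (term x) (term y) n) (conv-scale 1# y (term x) (term y) n) ⟩
      (x * 1#) * conv (term x) (term y) n + (1# * y) * conv (term x) (term y) n
        ≈⟨ solve 3 (λ x y c → (x :* con (+ 1)) :* c :+ (con (+ 1) :* y) :* c := (x :+ y) :* c) ≈-refl x y (conv (term x) (term y) n) ⟩
      (x + y) * conv (term x) (term y) n            ∎

  private
    partial-conv : ∀ u w n → partial (conv u w) (suc n) ≈ u 0 * partial w (suc n) + partial (conv (λ i → u (suc i)) w) n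
    partial-conv u w zero    = solve 2 (λ u w → con (+ 0) :+ u :* w := u :* (con (+ 0) :+ w) :+ con (+ 0)) ≈-refl (u 0) (w 0)
    partial-conv u w (suc n) = ≈-trans (+-cong (partial-conv u w n) ≈-refl)
      (solve 5 (λ u p w q c → (u :* p :+ q) :+ (u :* w :+ c) := u :* (p :+ w) :+ (q :+ c)) ≈-refl
        (u 0) (partial w (suc n)) (w (suc n)) (partial (conv (λ i → u (suc i)) w) n) (conv (λ i → u (suc i)) w n))

  -- The partial sums of the Cauchy product are Σ u i (W - tail), and the
  -- products u i * tail have total degree at least n.
  cauchy-product : ∀ u w {A A′ W} → GeometricallyBounded u A → (∀ n → ∣ W - partial w n ∣≤ A′ * h ^ n) →
    ∀ n → ∣ partial (conv u w) n - partial u n * W ∣≤ (A * A′) * (ιₙ n * h ^ n)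
  cauchy-product u w {A} {A′} {W} p q zero = abs-cong
    (solve 1 (λ W → con (+ 0) := con (+ 0) :- con (+ 0) :* W) ≈-refl W)
    (abs-mono (≈⇒≤ (solve 2 (λ a x → con (+ 0) := a :* (con (+ 0) :* x)) ≈-refl (A * A′) (h ^ 0))) abs-0)
  cauchy-product u w {A} {A′} {W} p q (suc n) = abs-cong
    (≈-trans (solve 5 (λ u₀ W P C U → u₀ :* (:- (W :- P)) :+ (C :- U :* W) := (u₀ :* P :+ C) :- (u₀ :+ U) :* W) ≈-refl
        (u 0) W (partial w (suc n)) (partial (conv u′ w) n) (partial u′ n))
      (+-cong (≈-sym (partial-conv u w n)) (neg-cong (*-cong (≈-sym (partial-suc u n)) ≈-refl))))
    (abs-mono (≈⇒≤ (≈-trans (solve 5 (λ A A′ n h k → (A :* con (+ 1)) :* (A′ :* (h :* k)) :+ ((A :* h) :* A′) :* (n :* k) :=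
          (A :* A′) :* ((con (+ 1) :+ n) :* (h :* k))) ≈-refl A A′ (ιₙ n) h (h ^ n))
        (*-cong ≈-refl (*-cong (≈-sym (ιₙ-suc n)) ≈-refl))))
      (abs-+ (abs-* (p 0) (abs-neg (q (suc n))))
        (cauchy-product u′ w (λ i → abs-mono (≈⇒≤ (≈-sym (*-assoc A h (h ^ i)))) (p (suc i))) q n)))
    where
    u′ = λ i → u (suc i)

  the-spec : ∀ {A : Set} {d : A} {P : A → Set} → ∃ P → P (Classical.the em d P)
  the-spec {P = P} p with em {∃ P}
  ... | yes (_ , q) = q
  ... | no ¬p       = ⊥-elim (¬p p)

  opaque
    exp : ℝ → ℝ
    exp = Classical.exp em

    exp-unfold : ∀ x → Classical.exp em x ≡ exp x
    exp-unfold x = refl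

  private
    expPartial-partial : ∀ x n → expPartial x n ≡ partial (term x) n
    expPartial-partial x zero    = fromℕ-ιₙ 0
    expPartial-partial x (suc n) = step (expPartial-partial x n) (trans (÷-/ (x ^ₙ n) (n !)) (trans (cong (_/ (n !)) {x ^ₙ n} {x ^ n} (^ₙ-^ x n)) (term-def x n)))
      where
      step : ∀ {a b c d} → a ≡ b → c ≡ d → a +ᴿ c ≡ b + d
      step {a} {_} {c} refl refl = +ᴿ-+ a c

    +ᴿ-ιᵠ : ∀ x δ → x +ᴿ fromℚ δ ≡ x + ιᵠ δ
    +ᴿ-ιᵠ x δ = subst (λ z → x +ᴿ z ≡ x + ιᵠ δ) {ιᵠ δ} {fromℚ δ} (sym (fromℚ-ιᵠ δ)) (+ᴿ-+ x (ιᵠ δ))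

    ⟶⇒close : ∀ {s l} → s ⟶ l → ∀ {δ} → 0ℚ ℚ.< δ → ∃ λ N → ∀ n → N ℕ.≤ n → s n ≤ l + ιᵠ δ × l ≤ s n + ιᵠ δ
    ⟶⇒close {s} {l} p {δ} 0<δ = let N , f = p 0<δ in N , λ n N≤n →
      subst (s n ≤_) {l +ᴿ fromℚ δ} (+ᴿ-ιᵠ l δ) (≤ᴿ⇒≤ {s n} {l +ᴿ fromℚ δ} (proj₁ (f n N≤n))) ,
      subst (l ≤_) {s n +ᴿ fromℚ δ} (+ᴿ-ιᵠ (s n) δ) (≤ᴿ⇒≤ {l} {s n +ᴿ fromℚ δ} (proj₂ (f n N≤n)))

    close⇒⟶ : ∀ {s l} → (∀ {δ} → 0ℚ ℚ.< δ → ∃ λ N → ∀ n → N ℕ.≤ n → s n ≤ l + ιᵠ δ × l ≤ s n + ιᵠ δ) → s ⟶ l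
    close⇒⟶ {s} {l} p {δ} 0<δ = let N , f = p 0<δ in N , λ n N≤n →
      ≤⇒≤ᴿ {s n} {l +ᴿ fromℚ δ} (subst (s n ≤_) {l + ιᵠ δ} (sym (+ᴿ-ιᵠ l δ)) (proj₁ (f n N≤n))) ,
      ≤⇒≤ᴿ {l} {s n +ᴿ fromℚ δ} (subst (l ≤_) {s n + ιᵠ δ} (sym (+ᴿ-ιᵠ (s n) δ)) (proj₂ (f n N≤n)))

  opaque
    unfolding exp

    exp-limit : ∀ {x l} → expPartial x ⟶ l → expPartial x ⟶ exp x
    exp-limit {x} {l} p = the-spec {d = 0ᴿ} {P = expPartial x ⟶_} (l , λ {δ} → p {δ})

  exp-series : ∀ x → ∃ λ A → 0# ≤ A × GeometricallyBounded (term x) A × (∀ n → ∣ exp x - partial (term x) n ∣≤ ιₙ 2 * A * h ^ n)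
  exp-series x =
    let A , 0≤A , t-bound = term-geometric x
        l , l-close = series-sum 0≤A t-bound
        lim : expPartial x ⟶ l
        lim = close⇒⟶ {expPartial x} {l} λ {δ} 0<δ →
          let N , small = h^-small (ιₙ 2 * A) (0<ιᵠ 0<δ) in N , λ n N≤n →
          let c = abs-mono (≤-trans (*-monoʳ-≤ (*-nonNeg (0≤ιₙ 2) 0≤A) (h^-anti N≤n)) (<⇒≤ small)) (l-close n)
              e = expPartial-partial x n
          in subst (_≤ l + ιᵠ δ) (sym e) (≤-via (proj₁ c) (solve 3 (λ s l d → (l :+ d) :- s := (l :- s) :- (:- d)) ≈-refl (partial (term x) n) l (ιᵠ δ))) ,
             subst (λ z → l ≤ z + ιᵠ δ) (sym e) (≤-via (proj₂ c) (solve 3 (λ s l d → (s :+ d) :- l := d :- (l :- s)) ≈-refl (partial (term x) n) l (ιᵠ δ)))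
        e≈l : exp x ≈ l
        e≈l = ≤-antisym (ε-≤ (λ {δ} 0<δ → both (⟶⇒close {expPartial x} {exp x} (exp-limit {x} {l} (λ {δ} → lim {δ})) (half>0 0<δ)) (⟶⇒close {expPartial x} {l} (λ {δ} → lim {δ}) (half>0 0<δ))))
          (ε-≤ (λ {δ} 0<δ → both (⟶⇒close {expPartial x} {l} (λ {δ} → lim {δ}) (half>0 0<δ)) (⟶⇒close {expPartial x} {exp x} (exp-limit {x} {l} (λ {δ} → lim {δ})) (half>0 0<δ))))
    in A , 0≤A , t-bound , λ n → abs-cong (+-cong (≈-sym e≈l) ≈-refl) (l-close n)
    where
    both : ∀ {s : ℕ → ℝ} {a b δ} →
      (∃ λ N → ∀ n → N ℕ.≤ n → s n ≤ a + ιᵠ (½ ℚ.* δ) × a ≤ s n + ιᵠ (½ ℚ.* δ)) →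
      (∃ λ N → ∀ n → N ℕ.≤ n → s n ≤ b + ιᵠ (½ ℚ.* δ) × b ≤ s n + ιᵠ (½ ℚ.* δ)) → a ≤ b + ιᵠ δ
    both {s} {a} {b} {δ} (M , f) (N , g) = let k = M ℕ.⊔ N in begin
      a                                         ≤⟨ proj₂ (f k (ℕ.m≤m⊔n M N)) ⟩
      s k + ιᵠ (½ ℚ.* δ)                        ≤⟨ +-monoˡ-≤ _ (proj₁ (g k (ℕ.m≤n⊔m M N))) ⟩
      (b + ιᵠ (½ ℚ.* δ)) + ιᵠ (½ ℚ.* δ)         ≈⟨ +-assoc _ _ _ ⟩
      b + (ιᵠ (½ ℚ.* δ) + ιᵠ (½ ℚ.* δ))         ≈⟨ +-cong ≈-refl (≈-trans (≈-sym (ιᵠ-+ _ _)) (≈-reflexive (cong ιᵠ (trans (sym (ℚ.*-distribʳ-+ δ ½ ½)) (ℚ.*-identityˡ δ))))) ⟩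
      b + ιᵠ δ                                  ∎

module Logarithm (em : ExcludedMiddle 0ℓ) where
  open Reals em
  open Series em
  open Exponential em
  open ℚ-Lemmas hiding (≤-via)
  open Solver
  open ≤-Reasoning

  private
    module ExpHom {x y z A A′ A″ : ℝ} {K : ℕ} (z≈x+y : z ≈ x + y) (0≤A : 0# ≤ A) (0≤A′ : 0# ≤ A′) (0≤A″ : 0# ≤ A″)
        (ta : GeometricallyBounded (term x) A)
        (ea : ∀ n → ∣ exp x - partial (term x) n ∣≤ ιₙ 2 * A * h ^ n)
        (eb : ∀ n → ∣ exp y - partial (term y) n ∣≤ ιₙ 2 * A′ * h ^ n)
        (ec : ∀ n → ∣ exp z - partial (term z) n ∣≤ ιₙ 2 * A″ * h ^ n)
        (y≤K : ∣ exp y ∣≤ ιₙ K) where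

      C : ℝ
      C = ιₙ 2 * A″ + (A * (ιₙ 2 * A′) * ιₙ 2 + ιₙ 2 * A * ιₙ K)

      bound : ∀ {P Q S} → 0# ≤ P → 0# ≤ Q → 0# ≤ S → ∀ m →
        P * h ^ (m ℕ.+ m) + (Q * (ιₙ (m ℕ.+ m) * h ^ (m ℕ.+ m)) + S * h ^ (m ℕ.+ m) * ιₙ K) ≤ (P + (Q * ιₙ 2 + S * ιₙ K)) * h ^ m
      bound {P} {Q} {S} 0≤P 0≤Q 0≤S m = begin
        P * h ^ (m ℕ.+ m) + (Q * (ιₙ (m ℕ.+ m) * h ^ (m ℕ.+ m)) + S * h ^ (m ℕ.+ m) * ιₙ K)
          ≤⟨ +-mono-≤ (*-monoʳ-≤ 0≤P anti) (+-mono-≤ (*-monoʳ-≤ 0≤Q twice) (*-monoˡ-≤ (0≤ιₙ K) (*-monoʳ-≤ 0≤S anti))) ⟩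
        P * h ^ m + (Q * (ιₙ 2 * h ^ m) + S * h ^ m * ιₙ K)
          ≈⟨ solve 5 (λ p q s k g → p :* g :+ (q :* (con (+ 2) :* g) :+ s :* g :* k) := (p :+ (q :* con (+ 2) :+ s :* k)) :* g) ≈-refl P Q S (ιₙ K) (h ^ m) ⟩
        (P + (Q * ιₙ 2 + S * ιₙ K)) * h ^ m ∎
        where
        anti = h^-anti (ℕ.m≤m+n m m)
        twice : ιₙ (m ℕ.+ m) * h ^ (m ℕ.+ m) ≤ ιₙ 2 * h ^ m
        twice = begin
          ιₙ (m ℕ.+ m) * h ^ (m ℕ.+ m)            ≈⟨ *-cong (ιₙ-+ m m) (h^-+ m m) ⟩
          (ιₙ m + ιₙ m) * (h ^ m * h ^ m)         ≈⟨ solve 2 (λ a g → (a :+ a) :* (g :* g) := (a :* g) :* (con (+ 2) :* g)) ≈-refl (ιₙ m) (h ^ m) ⟩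
          ιₙ m * h ^ m * (ιₙ 2 * h ^ m)           ≤⟨ *-monoˡ-≤ (*-nonNeg (0≤ιₙ 2) (0≤h^ m)) (n*h^n≤1 m) ⟩
          1# * (ιₙ 2 * h ^ m)                     ≈⟨ *-identityˡ _ ⟩
          ιₙ 2 * h ^ m                            ∎

      decompose : ∀ n → (exp z - partial (term z) n) + ((partial (conv (term x) (term y)) n - partial (term x) n * exp y) + - ((exp x - partial (term x) n) * exp y)) ≈ exp z - exp x * exp y
      decompose n = ≈-trans
        (+-cong (+-cong ≈-refl (neg-cong (≈-trans (partial-cong (term-cong z≈x+y) n) (partial-cong (λ i → ≈-sym (term-conv x y i)) n)))) ≈-refl)
        (solve 5 (λ ez c p ex ey → (ez :- c) :+ ((c :- p :* ey) :+ :- ((ex :- p) :* ey)) := ez :- ex :* ey) ≈-refl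
          (exp z) (partial (conv (term x) (term y)) n) (partial (term x) n) (exp x) (exp y))

      close : ∀ m → ∣ exp z - exp x * exp y ∣≤ C * h ^ m
      close m = abs-cong (decompose (m ℕ.+ m))
        (abs-mono (bound (*-nonNeg (0≤ιₙ 2) 0≤A″) (*-nonNeg 0≤A (*-nonNeg (0≤ιₙ 2) 0≤A′)) (*-nonNeg (0≤ιₙ 2) 0≤A) m)
          (abs-+ (ec (m ℕ.+ m)) (abs-+ (cauchy-product (term x) (term y) ta eb (m ℕ.+ m)) (abs-neg (abs-* (ea (m ℕ.+ m)) y≤K)))))

      hom : exp z ≈ exp x * exp y
      hom = ≤-antisym
        (h^-≤ C (λ m → ≤-via (proj₂ (close m)) (solve 3 (λ a b c → (b :+ c) :- a := c :- (a :- b)) ≈-refl (exp z) (exp x * exp y) (C * h ^ m))))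
        (h^-≤ C (λ m → ≤-via (proj₁ (close m)) (solve 3 (λ a b c → (a :+ c) :- b := (a :- b) :- (:- c)) ≈-refl (exp z) (exp x * exp y) (C * h ^ m))))

  exp-hom : ∀ {x y z} → z ≈ x + y → exp z ≈ exp x * exp y
  exp-hom {x} {y} {z} z≈x+y =
    let A , 0≤A , ta , ea = exp-series x
        A′ , 0≤A′ , tb , eb = exp-series y
        A″ , 0≤A″ , tc , ec = exp-series z
        K , y≤K = abs-bound (exp y)
    in ExpHom.hom z≈x+y 0≤A 0≤A′ 0≤A″ ta ea eb ec y≤K

  1+x≤exp : ∀ {x} → 0# ≤ x → 1# + x ≤ exp x
  1+x≤exp {x} 0≤x =
    let A , 0≤A , _ , e = exp-series x in
    h^-≤ (ιₙ 2 * A) λ n → begin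
      1# + x                             ≤⟨ partial≥ n ⟩
      partial (term x) (2 ℕ.+ n)         ≤⟨ ≤-via (proj₁ (e (2 ℕ.+ n))) (solve 3 (λ p e a → (e :+ a) :- p := (e :- p) :- (:- a)) ≈-refl (partial (term x) (2 ℕ.+ n)) (exp x) (ιₙ 2 * A * h ^ (2 ℕ.+ n))) ⟩
      exp x + ιₙ 2 * A * h ^ (2 ℕ.+ n)   ≤⟨ +-monoʳ-≤ _ (*-monoʳ-≤ (*-nonNeg (0≤ιₙ 2) 0≤A) (h^-anti (ℕ.m≤n+m n 2))) ⟩
      exp x + ιₙ 2 * A * h ^ n           ∎
    where
    partial≥ : ∀ n → 1# + x ≤ partial (term x) (2 ℕ.+ n)
    partial≥ zero = ≈⇒≤ (≈-sym (begin-equality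
      (0# + term x 0) + term x 1    ≈⟨ +-cong (+-cong ≈-refl (term-0 x)) (≈-sym (*-identityˡ _)) ⟩
      (0# + 1#) + 1# * term x 1     ≈⟨ +-cong (+-identityˡ 1#) (≈-trans (term-suc x 0) (*-cong ≈-refl (term-0 x))) ⟩
      1# + x * 1#                   ≈⟨ solve 1 (λ x → con (+ 1) :+ x :* con (+ 1) := con (+ 1) :+ x) ≈-refl x ⟩
      1# + x                        ∎))
    partial≥ (suc n) = ≤-trans (partial≥ n) (≤-trans (≈⇒≥ (+-identityʳ _)) (+-monoʳ-≤ _ (term-nonNeg 0≤x (2 ℕ.+ n))))

  exp-0 : exp 0# ≈ 1#
  exp-0 = *-cancelˡ (<-≤-trans 0<1 (≤-trans (≈⇒≥ (+-identityʳ 1#)) (1+x≤exp ≤-refl)))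
    (≈-trans (≈-sym (exp-hom (≈-sym (+-identityˡ 0#)))) (solve 1 (λ e → e := e :* con (+ 1)) ≈-refl (exp 0#)))

  exp-cong : ∀ {x y} → x ≈ y → exp x ≈ exp y
  exp-cong {x} {y} p = ≈-trans (exp-hom (≈-trans p (≈-sym (+-identityʳ y))))
    (≈-trans (*-cong ≈-refl exp-0) (solve 1 (λ e → e :* con (+ 1) := e) ≈-refl (exp y)))

  exp-+ : ∀ x y → exp (x + y) ≈ exp x * exp y
  exp-+ x y = exp-hom ≈-refl

  exp-neg : ∀ x → exp x * exp (- x) ≈ 1#
  exp-neg x = ≈-trans (≈-sym (exp-+ x (- x))) (≈-trans (exp-cong (+-inverseʳ x)) exp-0)

  0≤⇒1≤exp : ∀ {x} → 0# ≤ x → 1# ≤ exp x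
  0≤⇒1≤exp p = ≤-trans (≤-trans (≈⇒≥ (+-identityʳ 1#)) (+-monoʳ-≤ 1# p)) (1+x≤exp p)

  exp-pos : ∀ x → 0# < exp x
  exp-pos x with ≤⊎> 0# x
  ... | inj₁ 0≤x = <-≤-trans 0<1 (0≤⇒1≤exp 0≤x)
  ... | inj₂ x<0 = ≰⇒> λ p → <⇒≱ 0<1 (begin
    1#                    ≈⟨ ≈-sym (exp-neg x) ⟩
    exp x * exp (- x)     ≤⟨ *-monoˡ-≤ (≤-trans 0≤1 (0≤⇒1≤exp 0≤-x)) p ⟩
    0# * exp (- x)        ≈⟨ solve 1 (λ e → con (+ 0) :* e := con (+ 0)) ≈-refl (exp (- x)) ⟩
    0#                    ∎)
    where
    0≤-x : 0# ≤ - x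
    0≤-x = ≤-via (<⇒≤ x<0) (solve 1 (λ x → (:- x) :- con (+ 0) := con (+ 0) :- x) ≈-refl x)

  0≤exp : ∀ x → 0# ≤ exp x
  0≤exp x = <⇒≤ (exp-pos x)

  private
    exp-shift : ∀ x y → exp y ≈ exp x * exp (y - x)
    exp-shift x y = exp-hom (solve 2 (λ x y → y := x :+ (y :- x)) ≈-refl x y)

  exp-mono : ∀ {x y} → x ≤ y → exp x ≤ exp y
  exp-mono {x} {y} p = begin
    exp x                  ≈⟨ solve 1 (λ e → e := e :* con (+ 1)) ≈-refl (exp x) ⟩
    exp x * 1#             ≤⟨ *-monoʳ-≤ (0≤exp x) (0≤⇒1≤exp (x≤y⇒0≤y-x p)) ⟩
    exp x * exp (y - x)    ≈⟨ ≈-sym (exp-shift x y) ⟩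
    exp y                  ∎

  exp-mono-< : ∀ {x y} → x < y → exp x < exp y
  exp-mono-< {x} {y} p = begin-strict
    exp x                  ≈⟨ solve 1 (λ e → e := e :* con (+ 1)) ≈-refl (exp x) ⟩
    exp x * 1#             <⟨ *-monoʳ-< (exp-pos x) (<-≤-trans (0<y-x⇒x<y (<-≤-trans (x<y⇒0<y-x p) (≈⇒≤ (solve 1 (λ d → d := (con (+ 1) :+ d) :- con (+ 1)) ≈-refl (y - x))))) (1+x≤exp (<⇒≤ (x<y⇒0<y-x p)))) ⟩
    exp x * exp (y - x)    ≈⟨ ≈-sym (exp-shift x y) ⟩
    exp y                  ∎

  exp-cancel-≤ : ∀ {x y} → exp x ≤ exp y → x ≤ y
  exp-cancel-≤ p = ≮⇒≥ λ q → <⇒≱ (exp-mono-< q) p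

  exp-cancel-< : ∀ {x y} → exp x < exp y → x < y
  exp-cancel-< p = ≰⇒> λ q → <⇒≱ p (exp-mono q)

  exp-ιₙ* : ∀ k x → exp (ιₙ k * x) ≈ exp x ^ k
  exp-ιₙ* zero    x = ≈-trans (exp-cong (solve 1 (λ x → con (+ 0) :* x := con (+ 0)) ≈-refl x)) exp-0
  exp-ιₙ* (suc k) x = ≈-trans (exp-hom (≈-trans (*-cong (ιₙ-suc k) ≈-refl) (solve 2 (λ k x → (con (+ 1) :+ k) :* x := x :+ k :* x) ≈-refl (ιₙ k) x)))
    (*-cong ≈-refl (exp-ιₙ* k x))

  bernoulli : ∀ {x} k → 1# ≤ x → 1# + ιₙ k * (x - 1#) ≤ x ^ k
  bernoulli {x} zero    p = ≈⇒≤ (solve 1 (λ x → con (+ 1) :+ con (+ 0) :* (x :- con (+ 1)) := con (+ 1)) ≈-refl x)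
  bernoulli {x} (suc k) p = begin
    1# + ιₙ (suc k) * (x - 1#)       ≈⟨ +-cong ≈-refl (*-cong (ιₙ-suc k) ≈-refl) ⟩
    1# + (1# + ιₙ k) * (x - 1#)      ≤⟨ ≤-via (*-nonNeg (0≤ιₙ k) (*-nonNeg 0≤d 0≤d)) (solve 2 (λ k x → let d = x :- con (+ 1) in
                                          x :* (con (+ 1) :+ k :* d) :- (con (+ 1) :+ (con (+ 1) :+ k) :* d) := k :* (d :* d) :- con (+ 0)) ≈-refl (ιₙ k) x) ⟩
    x * (1# + ιₙ k * (x - 1#))       ≤⟨ *-monoʳ-≤ (≤-trans 0≤1 p) (bernoulli k p) ⟩
    x * x ^ k                        ∎
    where
    0≤d = x≤y⇒0≤y-x p

  private
    r : ℕ → ℝ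
    r n = ιᵠ (reciprocal n)

    0<r : ∀ n → 0# < r n
    0<r n = 0<ιᵠ (reciprocal>0 n)

    exp-r : ∀ n → exp (r n) ≤ 1# + exp 1# * r n
    exp-r n = *-cancelˡ-≤ (ιₙ-mono-< (ℕ.s≤s (ℕ.z≤n {n}))) (begin
      ιₙ (suc n) * exp (r n)                          ≈⟨ solve 2 (λ m e → m :* e := (con (+ 1) :+ m :* (e :- con (+ 1))) :+ (m :- con (+ 1))) ≈-refl (ιₙ (suc n)) (exp (r n)) ⟩
      (1# + ιₙ (suc n) * (exp (r n) - 1#)) + (ιₙ (suc n) - 1#)   ≤⟨ +-monoˡ-≤ _ (bernoulli (suc n) (0≤⇒1≤exp (<⇒≤ (0<r n)))) ⟩
      exp (r n) ^ suc n + (ιₙ (suc n) - 1#)           ≈⟨ +-cong (≈-trans (≈-sym (exp-ιₙ* (suc n) (r n))) (exp-cong (reciprocal-inverse-ℝ n))) ≈-refl ⟩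
      exp 1# + (ιₙ (suc n) - 1#)                      ≤⟨ ≤-via 0≤1 (solve 2 (λ e m → (e :+ m) :- (e :+ (m :- con (+ 1))) := con (+ 1) :- con (+ 0)) ≈-refl (exp 1#) (ιₙ (suc n))) ⟩
      exp 1# + ιₙ (suc n)                             ≈⟨ solve 2 (λ e m → e :+ m := m :+ e :* con (+ 1)) ≈-refl (exp 1#) (ιₙ (suc n)) ⟩
      ιₙ (suc n) + exp 1# * 1#                        ≈⟨ +-cong ≈-refl (*-cong ≈-refl (≈-sym (reciprocal-inverse-ℝ n))) ⟩
      ιₙ (suc n) + exp 1# * (ιₙ (suc n) * r n)        ≈⟨ solve 3 (λ e m r → m :+ e :* (m :* r) := m :* (con (+ 1) :+ e :* r)) ≈-refl (exp 1#) (ιₙ (suc n)) (r n) ⟩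
      ιₙ (suc n) * (1# + exp 1# * r n)                ∎)

    r-≤ : ∀ C {x y} → (∀ n → x ≤ y + C * r n) → x ≤ y
    r-≤ C {x} {y} p = ≮⇒≥ λ y<x →
      let n , C+1≤nd = ≤-archimedean-ratio (C + 1#) (x<y⇒0<y-x y<x)
          d = x - y
      in <-irrefl (begin-strict
        x                       ≤⟨ p n ⟩
        y + C * r n             <⟨ 0<y-x⇒x<y (<-≤-trans (0<r n) (≈⇒≤ (solve 3 (λ y c r → r := (y :+ r :* (c :+ con (+ 1))) :- (y :+ c :* r)) ≈-refl y C (r n)))) ⟩
        y + r n * (C + 1#)      ≤⟨ +-monoʳ-≤ y (*-monoʳ-≤ (<⇒≤ (0<r n)) (≤-trans C+1≤nd (*-monoˡ-≤ (x≤y⇒0≤y-x (<⇒≤ y<x)) (ιₙ-mono (ℕ.n≤1+n n))))) ⟩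
        y + r n * (ιₙ (suc n) * d)   ≈⟨ +-cong ≈-refl (≈-trans (solve 3 (λ r m d → r :* (m :* d) := (m :* r) :* d) ≈-refl (r n) (ιₙ (suc n)) d) (*-cong (reciprocal-inverse-ℝ n) ≈-refl)) ⟩
        y + 1# * d              ≈⟨ solve 2 (λ x y → y :+ con (+ 1) :* (x :- y) := x) ≈-refl x y ⟩
        x                       ∎)

  crossing : (P : ℕ → Set) → P 0 → ∀ N → ¬ P N → ∃ λ k → P k × ¬ P (suc k)
  crossing P p zero    ¬p = ⊥-elim (¬p p)
  crossing P p (suc N) ¬p with em {P N}
  ... | yes q = N , q , ¬p
  ... | no ¬q = crossing P p N ¬q

  private
    grid : ∀ {x} → 1# ≤ x → ∀ n → ∃ λ q → exp (ιᵠ q) ≤ x × x < exp (ιᵠ q + r n)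
    grid {x} 1≤x n =
      let N , x<N = large
          k , p , ¬p = crossing (λ k → exp (ιₙ k * r n) ≤ x)
            (≤-trans (≈⇒≤ (exp-ιₙ* 0 (r n))) 1≤x) N x<N
      in (+ k ℚ./ 1) ℚ.* reciprocal n ,
         ≤-trans (≈⇒≤ (exp-cong (q≈ k))) p ,
         <-≤-trans (≰⇒> ¬p) (≈⇒≤ (exp-cong (≈-trans (≈-trans (*-cong (ιₙ-suc k) ≈-refl)
           (solve 2 (λ k r → (con (+ 1) :+ k) :* r := k :* r :+ r) ≈-refl (ιₙ k) (r n))) (+-cong (≈-sym (q≈ k)) ≈-refl))))
      where
      q≈ : ∀ k → ιᵠ ((+ k ℚ./ 1) ℚ.* reciprocal n) ≈ ιₙ k * r n
      q≈ k = ≈-trans (ιᵠ-* (+ k ℚ./ 1) (reciprocal n)) (*-cong (≈-sym (ι-ιᵠ (+ k))) ≈-refl)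
      large : ∃ λ N → ¬ exp (ιₙ N * r n) ≤ x
      large = let N , x≤Nr = ≤-archimedean-ratio x (0<r n) in N , <⇒≱ (begin-strict
        x                    ≈⟨ ≈-sym (+-identityˡ x) ⟩
        0# + x               <⟨ 0<y-x⇒x<y (<-≤-trans 0<1 (≈⇒≤ (solve 1 (λ x → con (+ 1) := (con (+ 1) :+ x) :- (con (+ 0) :+ x)) ≈-refl x))) ⟩
        1# + x               ≤⟨ +-monoʳ-≤ 1# x≤Nr ⟩
        1# + ιₙ N * r n      ≤⟨ 1+x≤exp (*-nonNeg (0≤ιₙ N) (<⇒≤ (0<r n))) ⟩
        exp (ιₙ N * r n)     ∎)

    module GridLimit (x : ℝ) (1≤x : 1# ≤ x) (q : ℕ → ℚ)
        (q≤ : ∀ n → exp (ιᵠ (q n)) ≤ x) (<q : ∀ n → x < exp (ιᵠ (q n) + r n)) where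

      q≤q+r : ∀ m n → ιᵠ (q m) ≤ ιᵠ (q n) + r n
      q≤q+r m n = <⇒≤ (exp-cancel-< (≤-<-trans (q≤ m) (<q n)))

      q≤q+r-ℚ : ∀ m n → q m ℚ.≤ q n ℚ.+ reciprocal n
      q≤q+r-ℚ m n = ιᵠ-cancel (≤-trans (q≤q+r m n) (≈⇒≥ (ιᵠ-+ (q n) (reciprocal n))))

      c : IsCauchy q
      c {δ} 0<δ = let N , small = reciprocal-archimedean 0<δ in N , λ m n N≤m N≤n →
        ≤-∣-∣ {q m} {q n} {δ} (ℚ.≤-trans (q≤q+r-ℚ m n) (ℚ.+-monoʳ-≤ (q n) (small n N≤n)))
                              (ℚ.≤-trans (q≤q+r-ℚ n m) (ℚ.+-monoʳ-≤ (q m) (small m N≤m)))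

      opaque
        y : ℝ
        y = mkℝ q c

        y≤ : ∀ n → y ≤ ιᵠ (q n) + r n
        y≤ n = lim-≤ {q} c 0 λ m _ → q≤q+r m n

        ≤y-lim : ∀ {x} N → (∀ n → N ℕ.≤ n → x ≤ ιᵠ (q n)) → x ≤ y
        ≤y-lim {x} = ≤-lim {q} c {x}

      ≤y : ∀ n → ιᵠ (q n) ≤ y
      ≤y n = ε-≤ λ {δ} 0<δ → near δ (reciprocal-archimedean 0<δ)
        where
        near : ∀ δ → (∃ λ N → ∀ n → N ℕ.≤ n → reciprocal n ℚ.≤ δ) → ιᵠ (q n) ≤ y + ιᵠ δ
        near δ (N , small) = ≤-via
          (≤y-lim {ιᵠ (q n) - ιᵠ δ} N λ m N≤m → ≤-via (≤-trans (q≤q+r n m) (+-monoʳ-≤ (ιᵠ (q m)) (ιᵠ-mono (small m N≤m))))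
            (solve 3 (λ a b d → a :- (b :- d) := (a :+ d) :- b) ≈-refl (ιᵠ (q m)) (ιᵠ (q n)) (ιᵠ δ)))
          (solve 3 (λ y q d → (y :+ d) :- q := y :- (q :- d)) ≈-refl y (ιᵠ (q n)) (ιᵠ δ))

      exp-y : exp y ≈ x
      exp-y = ≤-antisym
        (r-≤ (x * exp 1#) λ n → begin
          exp y                           ≤⟨ exp-mono (y≤ n) ⟩
          exp (ιᵠ (q n) + r n)            ≈⟨ exp-+ _ _ ⟩
          exp (ιᵠ (q n)) * exp (r n)      ≤⟨ *-mono-≤ (0≤exp _) (+-nonNeg 0≤1 (*-nonNeg (0≤exp 1#) (<⇒≤ (0<r n)))) (q≤ n) (exp-r n) ⟩
          x * (1# + exp 1# * r n)         ≈⟨ solve 3 (λ x e r → x :* (con (+ 1) :+ e :* r) := x :+ x :* e :* r) ≈-refl x (exp 1#) (r n) ⟩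
          x + x * exp 1# * r n            ∎)
        (r-≤ (exp y * exp 1#) λ n → begin
          x                               ≤⟨ <⇒≤ (<q n) ⟩
          exp (ιᵠ (q n) + r n)            ≈⟨ exp-+ _ _ ⟩
          exp (ιᵠ (q n)) * exp (r n)      ≤⟨ *-mono-≤ (0≤exp _) (+-nonNeg 0≤1 (*-nonNeg (0≤exp 1#) (<⇒≤ (0<r n)))) (exp-mono (≤y n)) (exp-r n) ⟩
          exp y * (1# + exp 1# * r n)     ≈⟨ solve 3 (λ x e r → x :* (con (+ 1) :+ e :* r) := x :+ x :* e :* r) ≈-refl (exp y) (exp 1#) (r n) ⟩
          exp y + exp y * exp 1# * r n    ∎)

    exp-surjective-≥1 : ∀ {x} → 1# ≤ x → ∃ λ y → exp y ≈ x
    exp-surjective-≥1 {x} 1≤x = G.y , G.exp-y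
      where
      module G = GridLimit x 1≤x (λ n → proj₁ (grid 1≤x n)) (λ n → proj₁ (proj₂ (grid 1≤x n))) (λ n → proj₂ (proj₂ (grid 1≤x n)))

  exp-surjective : ∀ {x} → 0# < x → ∃ λ y → exp y ≈ x
  exp-surjective {x} 0<x =
    let N , 1≤Nx = ≤-archimedean-ratio 1# 0<x
        e = exp (ιₙ N)
        1≤xe : 1# ≤ x * e
        1≤xe = begin
          1#                 ≤⟨ 1≤Nx ⟩
          ιₙ N * x           ≈⟨ *-comm _ _ ⟩
          x * ιₙ N           ≤⟨ *-monoʳ-≤ (<⇒≤ 0<x) (≤-trans (≤-trans (≈⇒≥ (+-identityˡ _)) (+-monoˡ-≤ _ 0≤1)) (1+x≤exp (0≤ιₙ N))) ⟩
          x * e              ∎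
        y , exp-y = exp-surjective-≥1 1≤xe
    in y - ιₙ N , *-cancelˡ (exp-pos (ιₙ N)) (begin-equality
      e * exp (y - ιₙ N)  ≈⟨ ≈-sym (exp-shift (ιₙ N) y) ⟩
      exp y               ≈⟨ exp-y ⟩
      x * e               ≈⟨ *-comm _ _ ⟩
      e * x               ∎)

  opaque
    log : ℝ → ℝ
    log = Classical.log em

    log-unfold : ∀ x → Classical.log em x ≡ log x
    log-unfold x = refl

  opaque
    unfolding exp log _≤_

    exp-log : ∀ {x} → 0# < x → exp (log x) ≈ x
    exp-log {x} 0<x = the-spec {d = 0ᴿ} {P = λ y → exp y ≈ᴿ x} (exp-surjective {x} 0<x)

  log-exp : ∀ x → log (exp x) ≈ x
  log-exp x = ≤-antisym (exp-cancel-≤ (≈⇒≤ (exp-log (exp-pos x)))) (exp-cancel-≤ (≈⇒≥ (exp-log (exp-pos x))))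

  log-mono : ∀ {x y} → 0# < x → x ≤ y → log x ≤ log y
  log-mono 0<x x≤y = exp-cancel-≤ (≤-trans (≈⇒≤ (exp-log 0<x)) (≤-trans x≤y (≈⇒≥ (exp-log (<-≤-trans 0<x x≤y)))))

  log-cong : ∀ {x y} → 0# < x → x ≈ y → log x ≈ log y
  log-cong 0<x e = ≤-antisym (log-mono 0<x (≈⇒≤ e)) (log-mono (<-≤-trans 0<x (≈⇒≤ e)) (≈⇒≥ e))

  log-unique : ∀ {x y} → exp y ≈ x → log x ≈ y
  log-unique {x} {y} e = ≈-trans (log-cong (<-≤-trans (exp-pos y) (≈⇒≤ e)) (≈-sym e)) (log-exp y)

  log-* : ∀ {x y} → 0# < x → 0# < y → log (x * y) ≈ log x + log y
  log-* 0<x 0<y = log-unique (≈-trans (exp-+ _ _) (*-cong (exp-log 0<x) (exp-log 0<y)))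

  log-^ : ∀ {x} k → 0# < x → log (x ^ k) ≈ ιₙ k * log x
  log-^ k 0<x = log-unique (≈-trans (exp-ιₙ* k _) (^-cong k (exp-log 0<x)))
    where
    ^-cong : ∀ {x y} n → x ≈ y → x ^ n ≈ y ^ n
    ^-cong zero    _ = ≈-refl
    ^-cong (suc n) p = *-cong p (^-cong n p)

  log-1 : log 1# ≈ 0#
  log-1 = log-unique exp-0

  ≥1⇒0≤log : ∀ {x} → 1# ≤ x → 0# ≤ log x
  ≥1⇒0≤log p = ≤-trans (≈⇒≥ log-1) (log-mono 0<1 p)

module Powers (em : ExcludedMiddle 0ℓ) where
  open Reals em
  open Exponential em
  open Logarithm em

  opaque
    unfolding _*_

    ≈-* : ∀ z y l → (∀ n → seq z n ≡ seq y n ℚ.* seq l n) → z ≈ y * l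
    ≈-* z y l p = pointwise-≈ {z} {y * l} p

  private
    raw-power : ℝ → ℝ → ℝ
    raw-power x y = Classical.exp em (y *ᴿ Classical.log em x)

    branch : ∀ x y → Dec (0ᴿ <ᴿ x) → ℝ
    branch x y (yes _) = raw-power x y
    branch x y (no _)  = 0ᴿ

    ^ᴿ-branch : ∀ x y → ∃ λ d → Classical._^ᴿ_ em x y ≡ branch x y d
    ^ᴿ-branch x y with em {0ᴿ <ᴿ x}
    ... | yes p = yes p , refl
    ... | no ¬p = no ¬p , refl

    opaque
      unfolding log

      -- The left factor is left to be inferred: Agda would compare two copies
      -- of it by unfolding their proofs of the Cauchy property.
      raw-power-exp : ∀ x y → raw-power x y ≈ exp (y * log x)
      raw-power-exp x y = ≈-trans (≈-reflexive (exp-unfold _)) (exp-cong (≈-* _ y (log x) (λ n → refl)))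

    branch-yes : ∀ {x y z} → 0ᴿ <ᴿ x → (∃ λ d → z ≡ branch x y d) → z ≈ exp (y * log x)
    branch-yes {x} {y} 0<x (yes _ , q) = ≈-trans (≈-reflexive q) (raw-power-exp x y)
    branch-yes 0<x (no ¬p , q) = ⊥-elim (¬p 0<x)

    branch-no : ∀ {x y z} → ¬ 0ᴿ <ᴿ x → (∃ λ d → z ≡ branch x y d) → z ≡ 0ᴿ
    branch-no ¬p (yes p , q) = ⊥-elim (¬p p)
    branch-no ¬p (no _ , q)  = q

  0ᴿ<⇒0< : ∀ {x} → 0ᴿ <ᴿ x → 0# < x
  0ᴿ<⇒0< {x} p = subst (_< x) (fromℕ-ιₙ 0) (<ᴿ⇒< {0ᴿ} {x} p)

  0<⇒0ᴿ< : ∀ {x} → 0# < x → 0ᴿ <ᴿ x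
  0<⇒0ᴿ< {x} p = <⇒<ᴿ {0ᴿ} {x} (subst (_< x) (sym (fromℕ-ιₙ 0)) p)

  ^ᴿ-def : ∀ {x} y → 0# < x → Classical._^ᴿ_ em x y ≈ exp (y * log x)
  ^ᴿ-def {x} y 0<x = branch-yes {x} {y} (0<⇒0ᴿ< 0<x) (^ᴿ-branch x y)

  ^ᴿ-zero : ∀ {x} y → ¬ 0# < x → Classical._^ᴿ_ em x y ≡ 0#
  ^ᴿ-zero {x} y ¬p = trans (branch-no {x} {y} (λ p → ¬p (0ᴿ<⇒0< p)) (^ᴿ-branch x y)) (fromℕ-ιₙ 0)

open import Algebra.Bundles.Raw using (RawRing)
open import Data.Integer.Base as ℤ using (0ℤ; 1ℤ)
import Data.Integer.DivMod as ℤ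
open import Data.Integer.Divisibility.Signed as ℤ∣ using (_∣_; divides)
import Data.Integer.Solver as ℤSolver
open import Data.List.Base using ([]; _∷_; map; _++_; length; upTo; filter; deduplicate; foldr)
open import Data.List.Membership.Propositional using (_∈_)
open import Data.List.Membership.Propositional.Properties using (∈-++⁺ˡ; ∈-++⁺ʳ; ∈-++⁻; ∈-∃++; ∈-map⁺; ∈-map⁻; ∈-upTo⁺; ∈-upTo⁻; ∈-filter⁺; ∈-filter⁻; ∈-deduplicate⁺)
import Data.List.Properties as List
open import Data.List.Relation.Unary.All using (All; []; _∷_)
open import Data.List.Relation.Unary.All as All using (All; []; _∷_)
import Data.List.Relation.Unary.All.Properties as All
open import Data.List.Relation.Unary.AllPairs using (AllPairs; []; _∷_)
open import Data.List.Relation.Unary.Any using (here; there)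
open import Data.List.Relation.Unary.Unique.DecPropositional.Properties using (deduplicate-!)
open import Data.List.Relation.Unary.Unique.Propositional using (Unique)
import Data.List.Relation.Unary.Unique.Propositional.Properties as Unique
open import Data.Nat.Base as ℕ using (z≤n; s≤s)
import Data.Nat.Coprimality as Coprimality
import Data.Nat.DivMod as ℕ
import Data.Nat.Divisibility as ℕ∣
open import Data.Nat.GCD using (module Bézout)
open import Data.Nat.ListAction using (product)
open import Data.Nat.Primality using (Prime; prime⇒irreducible; prime⇒nonTrivial; prime⇒nonZero; euclidsLemma; prime?)
open import Data.Nat.Solver using (module +-*-Solver)
open import Function.Base using (_∘_)
open import Function.Bundles using (_⇔_; mk⇔; Equivalence)
open import Relation.Binary.PropositionalEquality using (_≢_; module ≡-Reasoning)

module Congruence where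
  open ℤSolver.+-*-Solver

  infix 4 _≡_[_]

  record _≡_[_] (a b N : ℤ) : Set where
    constructor mod
    field
      difference : N ∣ a ℤ.- b

  open _≡_[_] public

  ∣-resp : ∀ {N a b} → a ≡ b → N ∣ a → N ∣ b
  ∣-resp refl d = d

  mod-reflexive : ∀ {N a b} → a ≡ b → a ≡ b [ N ]
  mod-reflexive {N} {a} refl = mod (divides 0ℤ (ℤ.+-inverseʳ a))

  mod-refl : ∀ {N a} → a ≡ a [ N ]
  mod-refl = mod-reflexive refl

  mod-sym : ∀ {N a b} → a ≡ b [ N ] → b ≡ a [ N ]
  mod-sym {N} {a} {b} (mod d) = mod (∣-resp (solve 2 (λ a b → :- (a :- b) := b :- a) refl a b) (ℤ∣.∣m⇒∣-m d))

  mod-trans : ∀ {N a b c} → a ≡ b [ N ] → b ≡ c [ N ] → a ≡ c [ N ]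
  mod-trans {N} {a} {b} {c} (mod d) (mod e) = mod (∣-resp
    (solve 3 (λ a b c → (a :- b) :+ (b :- c) := a :- c) refl a b c) (ℤ∣.∣m∣n⇒∣m+n d e))

  mod-weaken : ∀ {M N a b} → M ∣ N → a ≡ b [ N ] → a ≡ b [ M ]
  mod-weaken d (mod e) = mod (ℤ∣.∣-trans d e)

  mod-+ : ∀ {N a b c d} → a ≡ b [ N ] → c ≡ d [ N ] → a ℤ.+ c ≡ b ℤ.+ d [ N ]
  mod-+ {N} {a} {b} {c} {d} (mod p) (mod q) = mod (∣-resp
    (solve 4 (λ a b c d → (a :- b) :+ (c :- d) := (a :+ c) :- (b :+ d)) refl a b c d) (ℤ∣.∣m∣n⇒∣m+n p q))

  mod-- : ∀ {N a b c d} → a ≡ b [ N ] → c ≡ d [ N ] → a ℤ.- c ≡ b ℤ.- d [ N ]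
  mod-- {N} {a} {b} {c} {d} (mod p) (mod q) = mod (∣-resp
    (solve 4 (λ a b c d → (a :- b) :- (c :- d) := (a :- c) :- (b :- d)) refl a b c d) (ℤ∣.∣m∣n⇒∣m-n p q))

  mod-* : ∀ {N a b c d} → a ≡ b [ N ] → c ≡ d [ N ] → a ℤ.* c ≡ b ℤ.* d [ N ]
  mod-* {N} {a} {b} {c} {d} (mod p) (mod q) = mod (∣-resp
    (solve 4 (λ a b c d → (a :- b) :* c :+ b :* (c :- d) := a :* c :- b :* d) refl a b c d)
    (ℤ∣.∣m∣n⇒∣m+n (ℤ∣.∣m⇒∣m*n c p) (ℤ∣.∣n⇒∣m*n b q)))

  mod-∣ : ∀ {N a b} → a ≡ b [ N ] → N ∣ b → N ∣ a
  mod-∣ {N} {a} {b} (mod d) e = ∣-resp (solve 2 (λ a b → (a :- b) :+ b := a) refl a b) (ℤ∣.∣m∣n⇒∣m+n d e)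

  mod-^ : ∀ {N a b} m → a ≡ b [ N ] → a ℤ.^ m ≡ b ℤ.^ m [ N ]
  mod-^ zero    d = mod-refl
  mod-^ {N} {a} {b} (suc m) d = mod-* {a = a} {b = b} {c = a ℤ.^ m} {d = b ℤ.^ m} d (mod-^ m d)

  *-pres-∣ : ∀ {a b c d} → a ∣ b → c ∣ d → a ℤ.* c ∣ b ℤ.* d
  *-pres-∣ {a} {b} {c} {d} p q = ℤ∣.∣-trans (ℤ∣.*-monoˡ-∣ c p) (ℤ∣.*-monoʳ-∣ b q)

  ^-∣ : ∀ a {m n} → m ℕ.≤ n → a ℤ.^ m ∣ a ℤ.^ n
  ^-∣ a {m} {n} m≤n = ∣-resp (trans (sym (ℤ.^-distribˡ-+-* a m (n ℕ.∸ m))) (cong (a ℤ.^_) (ℕ.m+[n∸m]≡n m≤n)))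
    (ℤ∣.∣m⇒∣m*n (a ℤ.^ (n ℕ.∸ m)) ℤ∣.∣-refl)

  pos-^ : ∀ p k → (+ p) ℤ.^ k ≡ + (p ℕ.^ k)
  pos-^ p zero    = refl
  pos-^ p (suc k) = trans (cong (+ p ℤ.*_) (pos-^ p k)) (sym (ℤ.pos-* p (p ℕ.^ k)))

  1∣ : ∀ z → 1ℤ ∣ z
  1∣ z = divides z (sym (ℤ.*-identityʳ z))

  Comaximal : ℤ → ℤ → Set
  Comaximal m n = ∃ λ s → ∃ λ t → s ℤ.* m ℤ.+ t ℤ.* n ≡ 1ℤ

  comaximal-sym : ∀ {m n} → Comaximal m n → Comaximal n m
  comaximal-sym {m} {n} (s , t , e) = t , s , trans (ℤ.+-comm (t ℤ.* n) (s ℤ.* m)) e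

  comaximal-1 : ∀ n → Comaximal 1ℤ n
  comaximal-1 n = 1ℤ , 0ℤ , refl

  comaximal-* : ∀ {m n k} → Comaximal m n → Comaximal m k → Comaximal m (n ℤ.* k)
  comaximal-* {m} {n} {k} (s , t , e) (u , v , f) = s ℤ.* u ℤ.* m ℤ.+ s ℤ.* v ℤ.* k ℤ.+ t ℤ.* n ℤ.* u , t ℤ.* v ,
    trans (solve 7 (λ m n k s t u v → (s :* u :* m :+ s :* v :* k :+ t :* n :* u) :* m :+ (t :* v) :* (n :* k) :=
        (s :* m :+ t :* n) :* (u :* m :+ v :* k)) refl m n k s t u v) (cong₂ ℤ._*_ e f)

  comaximal-^ : ∀ {m n} k → Comaximal m n → Comaximal m (n ℤ.^ k)
  comaximal-^ {m} zero    c = comaximal-sym (comaximal-1 m)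
  comaximal-^ (suc k) c = comaximal-* c (comaximal-^ k c)

  comaximal-∣ : ∀ {m n z} → Comaximal m n → m ∣ z → n ∣ z → m ℤ.* n ∣ z
  comaximal-∣ {m} {n} {z} (s , t , e) (divides q refl) n∣z@(divides r f) = divides (s ℤ.* r ℤ.+ t ℤ.* q) (begin
    q ℤ.* m                                    ≡⟨ sym (ℤ.*-identityˡ _) ⟩
    1ℤ ℤ.* (q ℤ.* m)                           ≡⟨ cong (ℤ._* (q ℤ.* m)) (sym e) ⟩
    (s ℤ.* m ℤ.+ t ℤ.* n) ℤ.* (q ℤ.* m)        ≡⟨ solve 5 (λ m n q s t → (s :* m :+ t :* n) :* (q :* m) := s :* m :* (q :* m) :+ t :* q :* (m :* n)) refl m n q s t ⟩
    s ℤ.* m ℤ.* (q ℤ.* m) ℤ.+ t ℤ.* q ℤ.* (m ℤ.* n)  ≡⟨ cong (λ w → s ℤ.* m ℤ.* w ℤ.+ t ℤ.* q ℤ.* (m ℤ.* n)) f ⟩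
    s ℤ.* m ℤ.* (r ℤ.* n) ℤ.+ t ℤ.* q ℤ.* (m ℤ.* n)  ≡⟨ solve 6 (λ m n q r s t → s :* m :* (r :* n) :+ t :* q :* (m :* n) := (s :* r :+ t :* q) :* (m :* n)) refl m n q r s t ⟩
    (s ℤ.* r ℤ.+ t ℤ.* q) ℤ.* (m ℤ.* n)        ∎)
    where open ≡-Reasoning

  comaximal-divisor : ∀ {m n z} → Comaximal m n → m ∣ z ℤ.* n → m ∣ z
  comaximal-divisor {m} {n} {z} (s , t , e) d = ∣-resp
    (trans (solve 5 (λ m n z s t → (z :* s) :* m :+ t :* (z :* n) := z :* (s :* m :+ t :* n)) refl m n z s t)
      (trans (cong (z ℤ.*_) e) (ℤ.*-identityʳ z)))
    (ℤ∣.∣m∣n⇒∣m+n (ℤ∣.∣n⇒∣m*n (z ℤ.* s) ℤ∣.∣-refl) (ℤ∣.∣n⇒∣m*n t d))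

  chinese-remainder : ∀ {m n} → Comaximal m n → ∀ r r′ → ∃ λ x → x ≡ r [ m ] × x ≡ r′ [ n ]
  chinese-remainder {m} {n} (s , t , e) r r′ = x ,
    mod (divides (s ℤ.* (r′ ℤ.- r)) (shift r′ (solve 6 (λ m n s t r r′ → (r :* (t :* n) :+ r′ :* (s :* m)) :- r :* (s :* m :+ t :* n) := (s :* (r′ :- r)) :* m) refl m n s t r r′))) ,
    mod (divides (t ℤ.* (r ℤ.- r′)) (shift₂ (solve 6 (λ m n s t r r′ → (r :* (t :* n) :+ r′ :* (s :* m)) :- r′ :* (s :* m :+ t :* n) := (t :* (r :- r′)) :* n) refl m n s t r r′)))
    where
    x = r ℤ.* (t ℤ.* n) ℤ.+ r′ ℤ.* (s ℤ.* m)
    shift : ∀ {w} r′ → x ℤ.- r ℤ.* (s ℤ.* m ℤ.+ t ℤ.* n) ≡ w → x ℤ.- r ≡ w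
    shift _ f = trans (cong (λ y → x ℤ.- y) (sym (trans (cong (r ℤ.*_) e) (ℤ.*-identityʳ r)))) f
    shift₂ : ∀ {w} → x ℤ.- r′ ℤ.* (s ℤ.* m ℤ.+ t ℤ.* n) ≡ w → x ℤ.- r′ ≡ w
    shift₂ f = trans (cong (λ y → x ℤ.- y) (sym (trans (cong (r′ ℤ.*_) e) (ℤ.*-identityʳ r′)))) f

  coprime⇒comaximal : ∀ {m n} → Coprimality.Coprime m n → Comaximal (+ m) (+ n)
  coprime⇒comaximal {m} {n} c with Coprimality.coprime-Bézout c
  ... | Bézout.+- x y e = + x , ℤ.- + y , (begin
    + x ℤ.* + m ℤ.+ (ℤ.- + y) ℤ.* + n     ≡⟨ cong (ℤ._+ (ℤ.- + y) ℤ.* + n) (trans (sym (ℤ.pos-* x m)) (trans (cong +_ (sym e)) (cong (ℤ._+_ 1ℤ) (ℤ.pos-* y n)))) ⟩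
    (1ℤ ℤ.+ + y ℤ.* + n) ℤ.+ (ℤ.- + y) ℤ.* + n  ≡⟨ solve 2 (λ y n → (con 1ℤ :+ y :* n) :+ (:- y) :* n := con 1ℤ) refl (+ y) (+ n) ⟩
    1ℤ ∎)
    where open ≡-Reasoning
  ... | Bézout.-+ x y e = ℤ.- + x , + y , (begin
    (ℤ.- + x) ℤ.* + m ℤ.+ + y ℤ.* + n     ≡⟨ cong (ℤ._+_ ((ℤ.- + x) ℤ.* + m)) (trans (sym (ℤ.pos-* y n)) (trans (cong +_ (sym e)) (cong (ℤ._+_ 1ℤ) (ℤ.pos-* x m)))) ⟩
    (ℤ.- + x) ℤ.* + m ℤ.+ (1ℤ ℤ.+ + x ℤ.* + m)  ≡⟨ solve 2 (λ x m → (:- x) :* m :+ (con 1ℤ :+ x :* m) := con 1ℤ) refl (+ x) (+ m) ⟩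
    1ℤ ∎)
    where open ≡-Reasoning

  prime-coprime : ∀ {p n} → Prime p → ¬ p ℕ∣.∣ n → Coprimality.Coprime p n
  prime-coprime pp p∤n (d∣p , d∣n) with prime⇒irreducible pp d∣p
  ... | inj₁ d≡1 = d≡1
  ... | inj₂ refl = ⊥-elim (p∤n d∣n)

  primes-comaximal : ∀ {p q} → Prime p → Prime q → p ≢ q → Comaximal (+ p) (+ q)
  primes-comaximal {p} {q} pp qq p≢q = coprime⇒comaximal (prime-coprime pp λ p∣q → case (prime⇒irreducible qq p∣q))
    where
    case : p ≡ 1 ⊎ p ≡ q → ⊥
    case (inj₁ refl) = ℕ.<-irrefl refl (ℕ.nonTrivial⇒n>1 1 {{prime⇒nonTrivial pp}})
    case (inj₂ e) = p≢q e

  prime-comaximal : ∀ {p} u → Prime p → ¬ (+ p ∣ u) → Comaximal (+ p) u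
  prime-comaximal {p} u pp p∤u with coprime⇒comaximal (prime-coprime pp (λ d → p∤u (ℤ∣.∣ᵤ⇒∣ d)))
  ... | s , t , e with ℤ.+∣i∣≡i⊎+∣i∣≡-i u
  ...   | inj₁ f = s , t , trans (cong (λ w → s ℤ.* + p ℤ.+ t ℤ.* w) (sym f)) e
  ...   | inj₂ f = s , ℤ.- t , trans (solve 4 (λ s p t u → s :* p :+ (:- t) :* u := s :* p :+ t :* (:- u)) refl s (+ p) t u)
                       (trans (cong (λ w → s ℤ.* + p ℤ.+ t ℤ.* w) (sym f)) e)

  module _ {p} (pp : Prime p) where
    private instance
      p≢0 : ℤ.NonZero (+ p)
      p≢0 = prime⇒nonZero pp

    euclid-power : ∀ e k w u → (+ p) ℤ.^ (e ℕ.+ k) ∣ w ℤ.* u → (+ p) ℤ.^ e ∣ w ⊎ (+ p) ℤ.^ k ∣ u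
    euclid-power e zero    w u d = inj₂ (1∣ u)
    euclid-power e (suc k) w u d with + p ℤ∣.∣? u
    ... | yes (divides u′ refl) = up (euclid-power e k w u′ (ℤ∣.*-cancelʳ-∣ (+ p)
            (subst₂ _∣_ (trans (cong ((+ p) ℤ.^_) (ℕ.+-suc e k)) (ℤ.*-comm (+ p) _)) (sym (ℤ.*-assoc w u′ (+ p))) d)))
      where
      up : (+ p) ℤ.^ e ∣ w ⊎ (+ p) ℤ.^ k ∣ u′ → (+ p) ℤ.^ e ∣ w ⊎ (+ p) ℤ.^ suc k ∣ u′ ℤ.* + p
      up (inj₁ a) = inj₁ a
      up (inj₂ b) = inj₂ (subst (_∣ u′ ℤ.* + p) (ℤ.*-comm ((+ p) ℤ.^ k) (+ p)) (ℤ∣.*-monoˡ-∣ (+ p) b))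
    ... | no p∤u = inj₁ (comaximal-divisor (comaximal-sym (comaximal-^ e (comaximal-sym (prime-comaximal u pp p∤u))))
            (ℤ∣.∣-trans (^-∣ (+ p) (ℕ.m≤m+n e (suc k))) d))

    euclid-power-^ : ∀ e k m w u → (+ p) ℤ.^ (e ℕ.+ m ℕ.* k) ∣ w ℤ.* u ℤ.^ m → (+ p) ℤ.^ e ∣ w ⊎ (+ p) ℤ.^ k ∣ u
    euclid-power-^ e k zero    w u d = inj₁ (subst₂ _∣_ (cong ((+ p) ℤ.^_) (ℕ.+-identityʳ e)) (ℤ.*-identityʳ w) d)
    euclid-power-^ e k (suc m) w u d
      with euclid-power (e ℕ.+ m ℕ.* k) k (w ℤ.* u ℤ.^ m) u
        (subst₂ _∣_ (cong ((+ p) ℤ.^_) (trans (cong (e ℕ.+_) (ℕ.+-comm k (m ℕ.* k))) (sym (ℕ.+-assoc e (m ℕ.* k) k))))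
          (solve 3 (λ w u v → w :* (u :* v) := w :* v :* u) refl w u (u ℤ.^ m)) d)
    ... | inj₁ a = euclid-power-^ e k m w u a
    ... | inj₂ b = inj₂ b

module IntegerPolynomials where
  open ℤSolver.+-*-Solver
  open Congruence
  open ℤ[X] using (Poly; coeff; eval; X-_)
  open RawRing ℤ[X].rawRing using () renaming (_+_ to add; _*_ to mul)

  coeff-add : ∀ f g i → coeff (add f g) i ≡ coeff f i ℤ.+ coeff g i
  coeff-add []      g       i       = sym (ℤ.+-identityˡ _)
  coeff-add (a ∷ f) []      i       = sym (ℤ.+-identityʳ _)
  coeff-add (a ∷ f) (b ∷ g) zero    = refl
  coeff-add (a ∷ f) (b ∷ g) (suc i) = coeff-add f g i

  coeff-scale : ∀ a g i → coeff (map (a ℤ.*_) g) i ≡ a ℤ.* coeff g i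
  coeff-scale a []      i       = sym (ℤ.*-zeroʳ a)
  coeff-scale a (b ∷ g) zero    = refl
  coeff-scale a (b ∷ g) (suc i) = coeff-scale a g i

  coeff-mul : ∀ a f g i → coeff (mul (a ∷ f) g) i ≡ a ℤ.* coeff g i ℤ.+ coeff (0ℤ ∷ mul f g) i
  coeff-mul a f g i = trans (coeff-add (map (a ℤ.*_) g) (0ℤ ∷ mul f g) i) (cong (ℤ._+ coeff (0ℤ ∷ mul f g) i) (coeff-scale a g i))

  private
    shift-+ : ∀ {u v w} → (∀ i → coeff u i ≡ coeff v i ℤ.+ coeff w i) →
              ∀ i → coeff (0ℤ ∷ u) i ≡ coeff (0ℤ ∷ v) i ℤ.+ coeff (0ℤ ∷ w) i
    shift-+ h zero    = refl
    shift-+ h (suc i) = h i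

    shift-* : ∀ {u v} a → (∀ i → coeff u i ≡ a ℤ.* coeff v i) → ∀ i → coeff (0ℤ ∷ u) i ≡ a ℤ.* coeff (0ℤ ∷ v) i
    shift-* a h zero    = sym (ℤ.*-zeroʳ a)
    shift-* a h (suc i) = h i

    shift-cong : ∀ {u v} → (∀ i → coeff u i ≡ coeff v i) → ∀ i → coeff (0ℤ ∷ u) i ≡ coeff (0ℤ ∷ v) i
    shift-cong h zero    = refl
    shift-cong h (suc i) = h i

    mul-add : ∀ f g h i → coeff (mul (add f g) h) i ≡ coeff (mul f h) i ℤ.+ coeff (mul g h) i
    mul-add []      g       h i = sym (ℤ.+-identityˡ _)
    mul-add (a ∷ f) []      h i = sym (ℤ.+-identityʳ _)
    mul-add (a ∷ f) (b ∷ g) h i = begin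
      coeff (mul ((a ℤ.+ b) ∷ add f g) h) i                                        ≡⟨ coeff-mul (a ℤ.+ b) (add f g) h i ⟩
      (a ℤ.+ b) ℤ.* coeff h i ℤ.+ coeff (0ℤ ∷ mul (add f g) h) i                   ≡⟨ cong (ℤ._+_ ((a ℤ.+ b) ℤ.* coeff h i)) (shift-+ {mul (add f g) h} {mul f h} {mul g h} (mul-add f g h) i) ⟩
      (a ℤ.+ b) ℤ.* coeff h i ℤ.+ (coeff (0ℤ ∷ mul f h) i ℤ.+ coeff (0ℤ ∷ mul g h) i) ≡⟨ solve 5 (λ a b c u v → (a :+ b) :* c :+ (u :+ v) := (a :* c :+ u) :+ (b :* c :+ v)) refl a b (coeff h i) (coeff (0ℤ ∷ mul f h) i) (coeff (0ℤ ∷ mul g h) i) ⟩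
      (a ℤ.* coeff h i ℤ.+ coeff (0ℤ ∷ mul f h) i) ℤ.+ (b ℤ.* coeff h i ℤ.+ coeff (0ℤ ∷ mul g h) i) ≡⟨ sym (cong₂ ℤ._+_ (coeff-mul a f h i) (coeff-mul b g h i)) ⟩
      coeff (mul (a ∷ f) h) i ℤ.+ coeff (mul (b ∷ g) h) i                          ∎
      where open ≡-Reasoning

    mul-scale : ∀ a g h i → coeff (mul (map (a ℤ.*_) g) h) i ≡ a ℤ.* coeff (mul g h) i
    mul-scale a []      h i = sym (ℤ.*-zeroʳ a)
    mul-scale a (b ∷ g) h i = begin
      coeff (mul ((a ℤ.* b) ∷ map (a ℤ.*_) g) h) i                         ≡⟨ coeff-mul (a ℤ.* b) (map (a ℤ.*_) g) h i ⟩
      a ℤ.* b ℤ.* coeff h i ℤ.+ coeff (0ℤ ∷ mul (map (a ℤ.*_) g) h) i      ≡⟨ cong (ℤ._+_ (a ℤ.* b ℤ.* coeff h i)) (shift-* {mul (map (a ℤ.*_) g) h} {mul g h} a (mul-scale a g h) i) ⟩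
      a ℤ.* b ℤ.* coeff h i ℤ.+ a ℤ.* coeff (0ℤ ∷ mul g h) i               ≡⟨ solve 4 (λ a b c u → a :* b :* c :+ a :* u := a :* (b :* c :+ u)) refl a b (coeff h i) (coeff (0ℤ ∷ mul g h) i) ⟩
      a ℤ.* (b ℤ.* coeff h i ℤ.+ coeff (0ℤ ∷ mul g h) i)                   ≡⟨ cong (a ℤ.*_) (sym (coeff-mul b g h i)) ⟩
      a ℤ.* coeff (mul (b ∷ g) h) i                                        ∎
      where open ≡-Reasoning

  mul-assoc : ∀ f g h i → coeff (mul (mul f g) h) i ≡ coeff (mul f (mul g h)) i
  mul-assoc []      g h i = refl
  mul-assoc (a ∷ f) g h i = begin
    coeff (mul (add (map (a ℤ.*_) g) (0ℤ ∷ mul f g)) h) i                      ≡⟨ mul-add (map (a ℤ.*_) g) (0ℤ ∷ mul f g) h i ⟩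
    coeff (mul (map (a ℤ.*_) g) h) i ℤ.+ coeff (mul (0ℤ ∷ mul f g) h) i        ≡⟨ cong₂ ℤ._+_ (mul-scale a g h i) (trans (coeff-mul 0ℤ (mul f g) h i) (ℤ.+-identityˡ _)) ⟩
    a ℤ.* coeff (mul g h) i ℤ.+ coeff (0ℤ ∷ mul (mul f g) h) i                 ≡⟨ cong (ℤ._+_ (a ℤ.* coeff (mul g h) i)) (shift-cong {mul (mul f g) h} {mul f (mul g h)} (mul-assoc f g h) i) ⟩
    a ℤ.* coeff (mul g h) i ℤ.+ coeff (0ℤ ∷ mul f (mul g h)) i                 ≡⟨ sym (coeff-mul a f (mul g h) i) ⟩
    coeff (mul (a ∷ f) (mul g h)) i                                            ∎
    where open ≡-Reasoning

  mul-identityʳ : ∀ f i → coeff (mul f (1ℤ ∷ [])) i ≡ coeff f i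
  mul-identityʳ []      i = refl
  mul-identityʳ (a ∷ f) zero    = trans (coeff-mul a f (1ℤ ∷ []) 0) (solve 1 (λ a → a :* con 1ℤ :+ con 0ℤ := a) refl a)
  mul-identityʳ (a ∷ f) (suc i) = trans (coeff-mul a f (1ℤ ∷ []) (suc i))
    (trans (cong (ℤ._+ coeff (mul f (1ℤ ∷ [])) i) (ℤ.*-zeroʳ a)) (trans (ℤ.+-identityˡ _) (mul-identityʳ f i)))

  infix 4 _≐_[_]

  _≐_[_] : Poly → Poly → ℤ → Set
  f ≐ g [ N ] = ∀ i → coeff f i ≡ coeff g i [ N ]

  mul-congˡ : ∀ {N} f g h → f ≐ g [ N ] → mul f h ≐ mul g h [ N ]
  mul-congˡ {N} f g h p = go f g p
    where
    step : ∀ a f b g → a ≡ b [ N ] → mul f h ≐ mul g h [ N ] →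
           ∀ i → a ℤ.* coeff h i ℤ.+ coeff (0ℤ ∷ mul f h) i ≡ b ℤ.* coeff h i ℤ.+ coeff (0ℤ ∷ mul g h) i [ N ]
    step a f b g p q zero    = mod-+ (mod-* {c = coeff h 0} {d = coeff h 0} p mod-refl) mod-refl
    step a f b g p q (suc i) = mod-+ (mod-* {c = coeff h (suc i)} {d = coeff h (suc i)} p mod-refl) (q i)
    zero-step : ∀ i → 0ℤ ≡ 0ℤ ℤ.* coeff h i ℤ.+ coeff (0ℤ ∷ mul [] h) i
    zero-step zero    = refl
    zero-step (suc i) = refl
    go : ∀ f g → f ≐ g [ N ] → mul f h ≐ mul g h [ N ]
    go []      []      p i = mod-refl
    go []      (b ∷ g) p i = subst₂ (_≡_[ N ]) (sym (zero-step i)) (sym (coeff-mul b g h i)) (step 0ℤ [] b g (p 0) (go [] g (λ i → p (suc i))) i)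
    go (a ∷ f) []      p i = subst₂ (_≡_[ N ]) (sym (coeff-mul a f h i)) (sym (zero-step i)) (step a f 0ℤ [] (p 0) (go f [] (λ i → p (suc i))) i)
    go (a ∷ f) (b ∷ g) p i = subst₂ (_≡_[ N ]) (sym (coeff-mul a f h i)) (sym (coeff-mul b g h i)) (step a f b g (p 0) (go f g (λ i → p (suc i))) i)

  eval-add : ∀ f g x → eval (add f g) x ≡ eval f x ℤ.+ eval g x
  eval-add []      g       x = sym (ℤ.+-identityˡ _)
  eval-add (a ∷ f) []      x = sym (ℤ.+-identityʳ _)
  eval-add (a ∷ f) (b ∷ g) x = trans (cong (λ y → a ℤ.+ b ℤ.+ x ℤ.* y) (eval-add f g x))
    (solve 5 (λ a b x u v → a :+ b :+ x :* (u :+ v) := (a :+ x :* u) :+ (b :+ x :* v)) refl a b x (eval f x) (eval g x))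

  eval-scale : ∀ a g x → eval (map (a ℤ.*_) g) x ≡ a ℤ.* eval g x
  eval-scale a []      x = sym (ℤ.*-zeroʳ a)
  eval-scale a (b ∷ g) x = trans (cong (λ y → a ℤ.* b ℤ.+ x ℤ.* y) (eval-scale a g x))
    (solve 4 (λ a b x u → a :* b :+ x :* (a :* u) := a :* (b :+ x :* u)) refl a b x (eval g x))

  eval-mul : ∀ f g x → eval (mul f g) x ≡ eval f x ℤ.* eval g x
  eval-mul []      g x = refl
  eval-mul (a ∷ f) g x = begin
    eval (add (map (a ℤ.*_) g) (0ℤ ∷ mul f g)) x                 ≡⟨ eval-add (map (a ℤ.*_) g) (0ℤ ∷ mul f g) x ⟩
    eval (map (a ℤ.*_) g) x ℤ.+ (0ℤ ℤ.+ x ℤ.* eval (mul f g) x)  ≡⟨ cong₂ (λ u v → u ℤ.+ (0ℤ ℤ.+ x ℤ.* v)) (eval-scale a g x) (eval-mul f g x) ⟩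
    a ℤ.* eval g x ℤ.+ (0ℤ ℤ.+ x ℤ.* (eval f x ℤ.* eval g x))    ≡⟨ solve 4 (λ a x u v → a :* v :+ (con 0ℤ :+ x :* (u :* v)) := (a :+ x :* u) :* v) refl a x (eval f x) (eval g x) ⟩
    (a ℤ.+ x ℤ.* eval f x) ℤ.* eval g x                          ∎
    where open ≡-Reasoning

  eval-cong : ∀ {N} f g → f ≐ g [ N ] → ∀ x → eval f x ≡ eval g x [ N ]
  eval-cong []      []      p x = mod-refl
  eval-cong {N} []      (b ∷ g) p x = subst (_≡ b ℤ.+ x ℤ.* eval g x [ N ]) (trans (cong (ℤ._+_ (0ℤ)) (ℤ.*-zeroʳ x)) refl)
    (mod-+ {a = 0ℤ} (p 0) (mod-* {a = x} {b = x} mod-refl (eval-cong [] g (λ i → p (suc i)) x)))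
  eval-cong {N} (a ∷ f) []      p x = subst (a ℤ.+ x ℤ.* eval f x ≡_[ N ]) (trans (cong (ℤ._+_ (0ℤ)) (ℤ.*-zeroʳ x)) refl)
    (mod-+ {b = 0ℤ} (p 0) (mod-* {a = x} {b = x} mod-refl (eval-cong f [] (λ i → p (suc i)) x)))
  eval-cong (a ∷ f) (b ∷ g) p x = mod-+ (p 0) (mod-* {a = x} {b = x} mod-refl (eval-cong f g (λ i → p (suc i)) x))

  eval-mod : ∀ {N} f {x y} → x ≡ y [ N ] → eval f x ≡ eval f y [ N ]
  eval-mod []      p = mod-refl
  eval-mod (a ∷ f) p = mod-+ (mod-refl {a = a}) (mod-* p (eval-mod f p))

  quotient : Poly → ℤ → Poly
  quotient []      a = []
  quotient (b ∷ f) a = eval f a ∷ quotient f a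

  quotient-spec : ∀ f a i → coeff (mul (quotient f a) (X- a)) i ℤ.+ coeff (eval f a ∷ []) i ≡ coeff f i
  quotient-spec []      a zero    = refl
  quotient-spec []      a (suc i) = refl
  quotient-spec (b ∷ f) a zero    = trans (cong (ℤ._+ (b ℤ.+ a ℤ.* eval f a)) (coeff-mul (eval f a) (quotient f a) (X- a) 0))
    (solve 3 (λ a b e → (e :* (:- a) :+ con 0ℤ) :+ (b :+ a :* e) := b) refl a b (eval f a))
  quotient-spec (b ∷ f) a (suc i) = begin
    coeff (mul (eval f a ∷ quotient f a) (X- a)) (suc i) ℤ.+ 0ℤ                              ≡⟨ ℤ.+-identityʳ _ ⟩
    coeff (mul (eval f a ∷ quotient f a) (X- a)) (suc i)                                     ≡⟨ coeff-mul (eval f a) (quotient f a) (X- a) (suc i) ⟩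
    eval f a ℤ.* coeff (1ℤ ∷ []) i ℤ.+ coeff (mul (quotient f a) (X- a)) i                   ≡⟨ cong (ℤ._+ coeff (mul (quotient f a) (X- a)) i) (lead i) ⟩
    coeff (eval f a ∷ []) i ℤ.+ coeff (mul (quotient f a) (X- a)) i                          ≡⟨ ℤ.+-comm (coeff (eval f a ∷ []) i) _ ⟩
    coeff (mul (quotient f a) (X- a)) i ℤ.+ coeff (eval f a ∷ []) i                          ≡⟨ quotient-spec f a i ⟩
    coeff f i                                                                                ∎
    where
    open ≡-Reasoning
    lead : ∀ i → eval f a ℤ.* coeff (1ℤ ∷ []) i ≡ coeff (eval f a ∷ []) i
    lead zero    = ℤ.*-identityʳ _
    lead (suc i) = ℤ.*-zeroʳ (eval f a)

module Growth where
  open ℤ[X] using (Poly; coeff; eval)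
  open ℕ.≤-Reasoning

  ^-distrib-* : ∀ a b n → (a ℕ.* b) ℕ.^ n ≡ a ℕ.^ n ℕ.* b ℕ.^ n
  ^-distrib-* a b zero    = refl
  ^-distrib-* a b (suc n) = trans (cong (a ℕ.* b ℕ.*_) (^-distrib-* a b n)) (ℕ.[m*n]*[o*p]≡[m*o]*[n*p] a b (a ℕ.^ n) (b ℕ.^ n))

  private
    1≤^ : ∀ {x} n → 1 ℕ.≤ x → 1 ℕ.≤ x ℕ.^ n
    1≤^ {suc x} n _ = ℕ.m^n>0 (suc x) n

    eval-zero : ∀ f x → (∀ i → coeff f i ≡ 0ℤ) → eval f x ≡ 0ℤ
    eval-zero []      x h = refl
    eval-zero (a ∷ f) x h = trans (cong₂ (λ a y → a ℤ.+ x ℤ.* y) (h 0) (eval-zero f x (λ i → h (suc i)))) (trans (ℤ.+-identityˡ _) (ℤ.*-zeroʳ x))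

    eval-const : ∀ a f x → (∀ i → coeff f i ≡ 0ℤ) → eval (a ∷ f) x ≡ a
    eval-const a f x h = trans (cong (λ y → a ℤ.+ x ℤ.* y) (eval-zero f x h)) (trans (cong (ℤ._+_ a) (ℤ.*-zeroʳ x)) (ℤ.+-identityʳ a))

  eval-upper : ∀ f n → (∀ i → n ℕ.< i → coeff f i ≡ 0ℤ) → ∃ λ C → ∀ x → 1 ℕ.≤ ℤ.∣ x ∣ → ℤ.∣ eval f x ∣ ℕ.≤ C ℕ.* ℤ.∣ x ∣ ℕ.^ n
  eval-upper []      n       h = 0 , λ x _ → z≤n
  eval-upper (a ∷ f) zero    h = ℤ.∣ a ∣ , λ x _ → ℕ.≤-reflexive (trans (cong ℤ.∣_∣ (eval-const a f x (λ i → h (suc i) (s≤s z≤n)))) (sym (ℕ.*-identityʳ _)))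
  eval-upper (a ∷ f) (suc n) h = let C , bound = eval-upper f n (λ i n<i → h (suc i) (s≤s n<i)) in
    ℤ.∣ a ∣ ℕ.+ C , λ x 1≤x → begin
      ℤ.∣ a ℤ.+ x ℤ.* eval f x ∣                                      ≤⟨ ℤ.∣i+j∣≤∣i∣+∣j∣ a (x ℤ.* eval f x) ⟩
      ℤ.∣ a ∣ ℕ.+ ℤ.∣ x ℤ.* eval f x ∣                                ≡⟨ cong (ℤ.∣ a ∣ ℕ.+_) (ℤ.∣i*j∣≡∣i∣*∣j∣ x (eval f x)) ⟩
      ℤ.∣ a ∣ ℕ.+ ℤ.∣ x ∣ ℕ.* ℤ.∣ eval f x ∣                          ≤⟨ ℕ.+-mono-≤ (ℕ.≤-trans (ℕ.≤-reflexive (sym (ℕ.*-identityʳ _))) (ℕ.*-monoʳ-≤ ℤ.∣ a ∣ (1≤^ (suc n) 1≤x))) (ℕ.*-monoʳ-≤ ℤ.∣ x ∣ (bound x 1≤x)) ⟩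
      ℤ.∣ a ∣ ℕ.* ℤ.∣ x ∣ ℕ.^ suc n ℕ.+ ℤ.∣ x ∣ ℕ.* (C ℕ.* ℤ.∣ x ∣ ℕ.^ n)  ≡⟨ cong (ℤ.∣ a ∣ ℕ.* ℤ.∣ x ∣ ℕ.^ suc n ℕ.+_) (trans (sym (ℕ.*-assoc ℤ.∣ x ∣ C _)) (trans (cong (ℕ._* ℤ.∣ x ∣ ℕ.^ n) (ℕ.*-comm ℤ.∣ x ∣ C)) (ℕ.*-assoc C ℤ.∣ x ∣ _))) ⟩
      ℤ.∣ a ∣ ℕ.* ℤ.∣ x ∣ ℕ.^ suc n ℕ.+ C ℕ.* ℤ.∣ x ∣ ℕ.^ suc n        ≡⟨ sym (ℕ.*-distribʳ-+ (ℤ.∣ x ∣ ℕ.^ suc n) ℤ.∣ a ∣ C) ⟩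
      (ℤ.∣ a ∣ ℕ.+ C) ℕ.* ℤ.∣ x ∣ ℕ.^ suc n                           ∎

  eval-lower : ∀ f n → ℤ[X].HasDegree f n → ∃ λ c → ∃ λ X₀ → ∀ x → X₀ ℕ.≤ ℤ.∣ x ∣ → 1 ℕ.≤ ℤ.∣ x ∣ → ℤ.∣ x ∣ ℕ.^ n ℕ.≤ c ℕ.* ℤ.∣ eval f x ∣
  eval-lower []      n       (an≢0 , _) = ⊥-elim (an≢0 refl)
  eval-lower (a ∷ f) zero    (a≢0 , h) = 1 , 0 , λ x _ _ → subst (λ y → 1 ℕ.≤ 1 ℕ.* ℤ.∣ y ∣) (sym (eval-const a f x (λ i → h (suc i) (s≤s z≤n))))
    (subst (1 ℕ.≤_) (sym (ℕ.*-identityˡ _)) (ℕ.n≢0⇒n>0 (λ e → a≢0 (ℤ.∣i∣≡0⇒i≡0 e))))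
  eval-lower (a ∷ f) (suc n) (an≢0 , h) =
    let c , X₀ , bound = eval-lower f n (an≢0 , λ i n<i → h (suc i) (s≤s n<i))
    in 2 ℕ.* c , X₀ ℕ.+ 2 ℕ.* c ℕ.* ℤ.∣ a ∣ , λ x X≤x 1≤x → lower c x (bound x (ℕ.m+n≤o⇒m≤o X₀ X≤x) 1≤x) (ℕ.m+n≤o⇒n≤o X₀ X≤x) 1≤x
    where
    lower : ∀ c x → ℤ.∣ x ∣ ℕ.^ n ℕ.≤ c ℕ.* ℤ.∣ eval f x ∣ → 2 ℕ.* c ℕ.* ℤ.∣ a ∣ ℕ.≤ ℤ.∣ x ∣ → 1 ℕ.≤ ℤ.∣ x ∣ →
            ℤ.∣ x ∣ ℕ.^ suc n ℕ.≤ 2 ℕ.* c ℕ.* ℤ.∣ eval (a ∷ f) x ∣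
    lower c x b l 1≤x = ℕ.+-cancelʳ-≤ Z Z (2 ℕ.* c ℕ.* Y) (begin
      Z ℕ.+ Z                                    ≡⟨ sym (trans (cong (Z ℕ.+_) (ℕ.+-identityʳ Z)) refl) ⟩
      2 ℕ.* Z                                    ≤⟨ ℕ.*-monoʳ-≤ 2 step ⟩
      2 ℕ.* (c ℕ.* (Y ℕ.+ ℤ.∣ a ∣))              ≡⟨ sym (ℕ.*-assoc 2 c _) ⟩
      2 ℕ.* c ℕ.* (Y ℕ.+ ℤ.∣ a ∣)                ≡⟨ ℕ.*-distribˡ-+ (2 ℕ.* c) Y ℤ.∣ a ∣ ⟩
      2 ℕ.* c ℕ.* Y ℕ.+ 2 ℕ.* c ℕ.* ℤ.∣ a ∣      ≤⟨ ℕ.+-monoʳ-≤ (2 ℕ.* c ℕ.* Y) (ℕ.≤-trans l x≤Z) ⟩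
      2 ℕ.* c ℕ.* Y ℕ.+ Z                        ∎)
      where
      T = ℤ.∣ eval f x ∣
      Y = ℤ.∣ eval (a ∷ f) x ∣
      Z = ℤ.∣ x ∣ ℕ.^ suc n
      x≤Z : ℤ.∣ x ∣ ℕ.≤ Z
      x≤Z = subst (ℕ._≤ Z) (ℕ.*-identityʳ _) (ℕ.*-monoʳ-≤ ℤ.∣ x ∣ (1≤^ n 1≤x))
      xT≤ : ℤ.∣ x ∣ ℕ.* T ℕ.≤ Y ℕ.+ ℤ.∣ a ∣
      xT≤ = begin
        ℤ.∣ x ∣ ℕ.* T                       ≡⟨ sym (ℤ.∣i*j∣≡∣i∣*∣j∣ x (eval f x)) ⟩
        ℤ.∣ x ℤ.* eval f x ∣                ≡⟨ cong ℤ.∣_∣ (solve 2 (λ a y → y := (a :+ y) :- a) refl a (x ℤ.* eval f x)) ⟩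
        ℤ.∣ eval (a ∷ f) x ℤ.- a ∣          ≤⟨ ℤ.∣i-j∣≤∣i∣+∣j∣ (eval (a ∷ f) x) a ⟩
        Y ℕ.+ ℤ.∣ a ∣                       ∎
        where open ℤSolver.+-*-Solver
      step : Z ℕ.≤ c ℕ.* (Y ℕ.+ ℤ.∣ a ∣)
      step = begin
        ℤ.∣ x ∣ ℕ.* ℤ.∣ x ∣ ℕ.^ n           ≤⟨ ℕ.*-monoʳ-≤ ℤ.∣ x ∣ b ⟩
        ℤ.∣ x ∣ ℕ.* (c ℕ.* T)               ≡⟨ trans (sym (ℕ.*-assoc ℤ.∣ x ∣ c T)) (trans (cong (ℕ._* T) (ℕ.*-comm ℤ.∣ x ∣ c)) (ℕ.*-assoc c ℤ.∣ x ∣ T)) ⟩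
        c ℕ.* (ℤ.∣ x ∣ ℕ.* T)               ≤⟨ ℕ.*-monoʳ-≤ c xT≤ ⟩
        c ℕ.* (Y ℕ.+ ℤ.∣ a ∣)               ∎

module ClassicalChoice (em : ExcludedMiddle 0ℓ) where

  the-spec : ∀ {A : Set} {d : A} {P : A → Set} → ∃ P → P (Classical.the em d P)
  the-spec {P = P} p with em {∃ P}
  ... | yes (_ , q) = q
  ... | no ¬p       = ⊥-elim (¬p p)

  maximum : ∀ (P : ℕ → Set) {k} → P k → ∀ N → (∀ m → P m → m ℕ.≤ N) → ∃ λ m → P m × (∀ j → P j → j ℕ.≤ m)
  maximum P {k} pk zero    h = k , pk , λ j pj → ℕ.≤-trans (h j pj) z≤n
  maximum P {k} pk (suc N) h with em {P (suc N)}
  ... | yes p = suc N , p , h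
  ... | no ¬p = maximum P pk N λ m pm → ℕ.s≤s⁻¹ (ℕ.≤∧≢⇒< (h m pm) λ { refl → ¬p pm })

  minimum : ∀ (P : ℕ → Set) N → P N → ∃ λ m → P m × (∀ j → P j → m ℕ.≤ j)
  minimum P N p with em {∃ λ j → P j × j ℕ.< N}
  minimum P zero    p | yes (j , _ , ())
  minimum P (suc N) p | yes (j , q , j<N) = go N (j , q , ℕ.s≤s⁻¹ j<N)
    where
    go : ∀ N → (∃ λ j → P j × j ℕ.≤ N) → ∃ λ m → P m × (∀ j → P j → m ℕ.≤ j)
    go zero    (zero , q , _) = 0 , q , λ _ _ → z≤n
    go (suc N) (j , q , j≤) with em {∃ λ i → P i × i ℕ.≤ N}
    ... | yes r = go N r
    ... | no ¬r = j , q , λ i pi → ℕ.≤-trans j≤ (ℕ.≰⇒> λ i≤N → ¬r (i , pi , i≤N))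
  minimum P N p | no ¬q = N , p , λ j pj → ℕ.≮⇒≥ λ j<N → ¬q (j , pj , j<N)

  largest-spec : ∀ (P : ℕ → Set) {k} → P k → ∀ N → (∀ m → P m → m ℕ.≤ N) →
                 P (Classical.largest em P) × (∀ j → P j → j ℕ.≤ Classical.largest em P)
  largest-spec P pk N h = the-spec {d = 0} {P = λ m → P m × (∀ j → P j → j ℕ.≤ m)} (maximum P pk N h)

  by-contradiction : ∀ {P : Set} → ¬ ¬ P → P
  by-contradiction {P} h with em {P}
  ... | yes p = p
  ... | no ¬p = ⊥-elim (h ¬p)

  ¬∀⇒∃¬ : ∀ {P : ℕ → Set} → ¬ (∀ k → P k) → ∃ λ k → ¬ P k
  ¬∀⇒∃¬ {P} h with em {∃ λ k → ¬ P k}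
  ... | yes p = p
  ... | no ¬p = ⊥-elim (h λ k → decide k em)
    where
    decide : ∀ k → Dec (P k) → P k
    decide k (yes q) = q
    decide k (no ¬q) = ⊥-elim (¬p (k , ¬q))

module PadicRoots (em : ExcludedMiddle 0ℓ) {p : ℕ} (pp : Prime p) where
  open import Algebra.Definitions.RawMagma using (_,_)
  open ClassicalChoice em
  open Congruence
  open IntegerPolynomials
  open Padic p using (ℤₚ; mkℤₚ; approx; coherent; fromℤ)
  open ℤ[X] using (Poly; coeff; eval)
  module ℤₚX = ℤₚ[X] p
  open RawRing ℤ[X].rawRing using () renaming (_+_ to add; _*_ to mul; -_ to neg)
  open RawRing ℤₚX.rawRing using () renaming (_+_ to addₚ; _*_ to mulₚ)

  private instance
    p≢0 : ℕ.NonZero p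
    p≢0 = prime⇒nonZero pp

  P : ℕ → ℤ
  P k = (+ p) ℤ.^ k

  approx-mod : ∀ a {i k} → i ℕ.≤ k → approx a k ≡ approx a i [ P i ]
  approx-mod a {i} {zero}  z≤n = mod-refl
  approx-mod a {i} {suc k} i≤k with ℕ.m≤n⇒m<n∨m≡n i≤k
  ... | inj₁ (s≤s i≤k′) = mod-trans (mod-weaken (^-∣ (+ p) i≤k′) (mod (coherent a k))) (approx-mod a i≤k′)
  ... | inj₂ refl = mod-refl

  at : ℕ → List ℤₚ → Poly
  at k = map (λ a → approx a k)

  eval-at : ∀ k g a → approx (ℤₚX.eval g a) k ≡ eval (at k g) (approx a k)
  eval-at k []      a = refl
  eval-at k (b ∷ g) a = cong (λ y → approx b k ℤ.+ approx a k ℤ.* y) (eval-at k g a)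

  coeff-at : ∀ k g i → approx (ℤₚX.coeff g i) k ≡ coeff (at k g) i
  coeff-at k []      i       = refl
  coeff-at k (b ∷ g) zero    = refl
  coeff-at k (b ∷ g) (suc i) = coeff-at k g i

  add-at : ∀ k g h → at k (addₚ g h) ≡ add (at k g) (at k h)
  add-at k []      h       = refl
  add-at k (a ∷ g) []      = refl
  add-at k (a ∷ g) (b ∷ h) = cong (_ ∷_) (add-at k g h)

  scale-at : ∀ k a g → at k (map (RawRing._*_ (Padic.rawRing p) a) g) ≡ map (approx a k ℤ.*_) (at k g)
  scale-at k a []      = refl
  scale-at k a (b ∷ g) = cong (_ ∷_) (scale-at k a g)

  mul-at : ∀ k g h → at k (mulₚ g h) ≡ mul (at k g) (at k h)
  mul-at k []      h = refl
  mul-at k (a ∷ g) h = trans (add-at k (map (RawRing._*_ (Padic.rawRing p) a) h) (fromℤ 0ℤ ∷ mulₚ g h))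
    (cong₂ add (scale-at k a h) (cong (0ℤ ∷_) (mul-at k g h)))

  pow-at : ∀ k a m → at k ((ℤₚX.X- a) ℤₚX.^ m) ≡ (ℤ[X].X- approx a k) ℤ[X].^ m
  pow-at k a zero    = refl
  pow-at k a (suc m) = trans (mul-at k (ℤₚX.X- a) ((ℤₚX.X- a) ℤₚX.^ m)) (cong (mul (ℤ[X].X- approx a k)) (pow-at k a m))

  fromℤ-at : ∀ k g → at k (map fromℤ g) ≡ g
  fromℤ-at k []      = refl
  fromℤ-at k (b ∷ g) = cong (b ∷_) (fromℤ-at k g)

  at-mod : ∀ g {i k} → i ℕ.≤ k → at k g ≐ at i g [ P i ]
  at-mod g {i} {k} i≤k j = subst₂ (_≡_[ P i ]) (coeff-at k g j) (coeff-at i g j) (approx-mod (ℤₚX.coeff g j) i≤k)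

  eval-pow : ∀ c m x → eval ((ℤ[X].X- c) ℤ[X].^ m) x ≡ (x ℤ.- c) ℤ.^ m
  eval-pow c zero    x = trans (cong (ℤ._+_ 1ℤ) (ℤ.*-zeroʳ x)) refl
  eval-pow c (suc m) x = trans (eval-mul (ℤ[X].X- c) ((ℤ[X].X- c) ℤ[X].^ m) x)
    (cong₂ ℤ._*_ (solve 2 (λ c x → (:- c) :+ x :* (con 1ℤ :+ x :* con 0ℤ) := x :- c) refl c x) (eval-pow c m x))
    where open ℤSolver.+-*-Solver

  quotientₚ : List ℤₚ → ℤₚ → List ℤₚ
  quotientₚ []      a = []
  quotientₚ (b ∷ g) a = ℤₚX.eval g a ∷ quotientₚ g a

  quotient-at : ∀ k g a → at k (quotientₚ g a) ≡ quotient (at k g) (approx a k)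
  quotient-at k []      a = refl
  quotient-at k (b ∷ g) a = cong₂ _∷_ (eval-at k g a) (quotient-at k g a)

  divide-root : ∀ g a → ℤₚX.IsRoot g a → ∀ k → mul (at k (quotientₚ g a)) (ℤ[X].X- approx a k) ≐ at k g [ P k ]
  divide-root g a root k i = subst₂ (_≡_[ P k ])
    (cong (λ h → coeff (mul h (ℤ[X].X- approx a k)) i) (sym (quotient-at k g a)))
    (trans (ℤ.+-identityʳ _) refl)
    (subst (_≡ coeff (at k g) i ℤ.+ 0ℤ [ P k ])
      (trans (cong (λ w → w ℤ.- coeff (eval (at k g) (approx a k) ∷ []) i) (sym (quotient-spec (at k g) (approx a k) i)))
        (solve 2 (λ u v → (u :+ v) :- v := u) refl (coeff (mul (quotient (at k g) (approx a k)) (ℤ[X].X- approx a k)) i) (coeff (eval (at k g) (approx a k) ∷ []) i)))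
      (mod-+ (mod-refl {a = coeff (at k g) i}) (small i)))
    where
    open ℤSolver.+-*-Solver
    e≡0 : eval (at k g) (approx a k) ≡ 0ℤ [ P k ]
    e≡0 = subst (_≡ 0ℤ [ P k ]) (eval-at k g a) (mod (root k))
    small : ∀ i → ℤ.- coeff (eval (at k g) (approx a k) ∷ []) i ≡ 0ℤ [ P k ]
    small zero    = subst (_≡ 0ℤ [ P k ]) (ℤ.+-identityˡ _) (mod-- (mod-refl {a = 0ℤ}) e≡0)
    small (suc i) = mod-refl

  module _ (f : Poly) (n : ℕ) (deg : ℤ[X].HasDegree f n) where

    fₚ : List ℤₚ
    fₚ = map fromℤ f

    eval-f : ∀ a k → approx (ℤₚX.eval fₚ a) k ≡ eval f (approx a k)
    eval-f a k = trans (eval-at k fₚ a) (cong (λ g → eval g (approx a k)) (fromℤ-at k f))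

    record Factors (a : ℤₚ) (m : ℕ) (q : List ℤₚ) : Set where
      constructor factors
      field
        expand : ∀ k → mul (at k q) ((ℤ[X].X- approx a k) ℤ[X].^ m) ≐ f [ P k ]

    open Factors public

    ∣⇒factors : ∀ {a m} → (ℤₚX.X- a) ℤₚX.^ m ℤₚX.∣ fₚ → ∃ (Factors a m)
    ∣⇒factors {a} {m} (q , e) = q , factors λ k i → subst₂ (_≡_[ P k ])
      (trans (coeff-at k (mulₚ q ((ℤₚX.X- a) ℤₚX.^ m)) i)
        (cong (λ h → coeff h i) (trans (mul-at k q ((ℤₚX.X- a) ℤₚX.^ m)) (cong (mul (at k q)) (pow-at k a m)))))
      (trans (coeff-at k fₚ i) (cong (λ h → coeff h i) (fromℤ-at k f)))
      (mod (e i k))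

    factors⇒∣ : ∀ {a m q} → Factors a m q → (ℤₚX.X- a) ℤₚX.^ m ℤₚX.∣ fₚ
    factors⇒∣ {a} {m} {q} e = q , λ i k → difference (subst₂ (_≡_[ P k ])
      (sym (trans (coeff-at k (mulₚ q ((ℤₚX.X- a) ℤₚX.^ m)) i)
        (cong (λ h → coeff h i) (trans (mul-at k q ((ℤₚX.X- a) ℤₚX.^ m)) (cong (mul (at k q)) (pow-at k a m))))))
      (sym (trans (coeff-at k fₚ i) (cong (λ h → coeff h i) (fromℤ-at k f))))
      (expand e k i))

    factors-0 : ∀ a → Factors a 0 fₚ
    factors-0 a = factors λ k i → mod-reflexive (trans (mul-identityʳ (at k fₚ) i) (cong (λ h → coeff h i) (fromℤ-at k f)))

    factors-suc : ∀ {a m q} → Factors a m q → ℤₚX.IsRoot q a → Factors a (suc m) (quotientₚ q a)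
    factors-suc {a} {m} {q} e root = factors λ k i →
      let Xm = (ℤ[X].X- approx a k) ℤ[X].^ m in mod-trans
      (subst (_≡ coeff (mul (at k q) Xm) i [ P k ]) (mul-assoc (at k (quotientₚ q a)) (ℤ[X].X- approx a k) Xm i)
        (mul-congˡ (mul (at k (quotientₚ q a)) (ℤ[X].X- approx a k)) (at k q) Xm (divide-root q a root k) i))
      (expand e k i)

    factors-eval : ∀ {a m q} → Factors a m q → ∀ k x → eval f x ≡ eval (at k q) x ℤ.* (x ℤ.- approx a k) ℤ.^ m [ P k ]
    factors-eval {a} {m} {q} e k x = mod-sym (subst (_≡ eval f x [ P k ])
      (trans (eval-mul (at k q) ((ℤ[X].X- approx a k) ℤ[X].^ m) x) (cong (eval (at k q) x ℤ.*_) (eval-pow (approx a k) m x)))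
      (eval-cong (mul (at k q) ((ℤ[X].X- approx a k) ℤ[X].^ m)) f (expand e k) x))

    factors-∣ : ∀ {a m q} → Factors a m q → ∀ j x → x ≡ approx a j [ P j ] → P (j ℕ.* m) ∣ eval f x
    factors-∣ {a} {zero}  e j x h = subst (λ i → P i ∣ eval f x) (sym (ℕ.*-zeroʳ j)) (1∣ _)
    factors-∣ {a} {suc m} {q} e j x h = mod-∣ (factors-eval e (j ℕ.* suc m) x)
      (ℤ∣.∣n⇒∣m*n (eval (at (j ℕ.* suc m) q) x) (subst (_∣ (x ℤ.- approx a (j ℕ.* suc m)) ℤ.^ suc m) (ℤ.^-*-assoc (+ p) j (suc m))
        (^-pres-∣ (suc m) (difference (mod-trans h (mod-sym (approx-mod a (ℕ.m≤m*n j (suc m)))))))))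
      where
      ^-pres-∣ : ∀ {a b} m → a ∣ b → a ℤ.^ m ∣ b ℤ.^ m
      ^-pres-∣ zero    d = ℤ∣.∣-refl
      ^-pres-∣ {a} {b} (suc m) d = *-pres-∣ d (^-pres-∣ {a} {b} m d)

    -- An integer x ≡ a (mod p ^ j) of size about p ^ j has p ^ (j m) ∣ f(x),
    -- while f(x) is nonzero of size at most C x ^ n.
    multiplicity≤degree : ∀ {a m q} → Factors a m q → m ℕ.≤ n
    multiplicity≤degree {a} {m} e = ℕ.≮⇒≥ λ n<m → ℕ.<⇒≱ (small n<m) (ℕ∣.∣⇒≤ {{ℕ.>-nonZero f≢0}} (subst (ℕ∣._∣ ℤ.∣ eval f x ∣) abs-P (ℤ∣.∣⇒∣ᵤ (factors-∣ e j x x≡a))))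
      where
      C = proj₁ (Growth.eval-upper f n (proj₂ deg))
      upper = proj₂ (Growth.eval-upper f n (proj₂ deg))
      lower = Growth.eval-lower f n deg
      c = proj₁ lower
      X₀ = proj₁ (proj₂ lower)
      j = suc (X₀ ℕ.+ C ℕ.* 2 ℕ.^ n)
      2≤p : 2 ℕ.≤ p
      2≤p = ℕ.nonTrivial⇒n>1 p {{prime⇒nonTrivial pp}}
      q = p ℕ.^ j
      instance
        q≢0 : ℕ.NonZero q
        q≢0 = ℕ.m^n≢0 p j
      n<2^n : ∀ n → n ℕ.< 2 ℕ.^ n
      n<2^n zero    = s≤s z≤n
      n<2^n (suc n) = ℕ.≤-trans (ℕ.+-mono-≤ {1} (ℕ.≤-trans (s≤s z≤n) (n<2^n n)) (n<2^n n)) (ℕ.+-monoʳ-≤ (2 ℕ.^ n) (ℕ.m≤m+n (2 ℕ.^ n) 0))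
      j<q : j ℕ.< q
      j<q = ℕ.<-≤-trans (n<2^n j) (ℕ.^-monoˡ-≤ j 2≤p)
      r = approx a j ℤ.% (+ q)
      x = + (q ℕ.+ r)
      x≡a : x ≡ approx a j [ P j ]
      x≡a = mod (subst (_∣ x ℤ.- approx a j) (sym (pos-^ p j)) (divides (1ℤ ℤ.- t)
        (trans (cong (λ w → x ℤ.- w) (ℤ.a≡a%n+[a/n]*n (approx a j) (+ q)))
          (trans (cong (λ w → w ℤ.- (+ r ℤ.+ t ℤ.* + q)) (ℤ.pos-+ q r))
            (solve 3 (λ q r t → (q :+ r) :- (r :+ t :* q) := (con 1ℤ :- t) :* q) refl (+ q) (+ r) t)))))
        where
        t = approx a j ℤ./ (+ q)
        open ℤSolver.+-*-Solver
      q≤x : q ℕ.≤ ℤ.∣ x ∣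
      q≤x = ℕ.m≤m+n q r
      x<2q : ℤ.∣ x ∣ ℕ.≤ 2 ℕ.* q
      x<2q = ℕ.+-monoʳ-≤ q (ℕ.≤-trans (ℕ.<⇒≤ (ℤ.n%d<d (approx a j) (+ q))) (ℕ.m≤m+n q 0))
      1≤x : 1 ℕ.≤ ℤ.∣ x ∣
      1≤x = ℕ.≤-trans (s≤s z≤n) (ℕ.≤-trans (ℕ.<⇒≤ j<q) q≤x)
      X₀≤x : X₀ ℕ.≤ ℤ.∣ x ∣
      X₀≤x = ℕ.≤-trans (ℕ.≤-trans (ℕ.m≤m+n X₀ _) (ℕ.n≤1+n _)) (ℕ.≤-trans (ℕ.<⇒≤ j<q) q≤x)
      f≢0 : 0 ℕ.< ℤ.∣ eval f x ∣
      f≢0 = ℕ.n≢0⇒n>0 λ e → ℕ.<⇒≱ (ℕ.<-≤-trans (ℕ.m^n>0 ℤ.∣ x ∣ {{ℕ.>-nonZero 1≤x}} n) (proj₂ (proj₂ lower) x X₀≤x 1≤x))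
        (ℕ.≤-reflexive (trans (cong (c ℕ.*_) e) (ℕ.*-zeroʳ c)))
      abs-P : ℤ.∣ P (j ℕ.* m) ∣ ≡ q ℕ.^ m
      abs-P = trans (cong ℤ.∣_∣ (pos-^ p (j ℕ.* m))) (sym (ℕ.^-*-assoc p j m))
      small : n ℕ.< m → ℤ.∣ eval f x ∣ ℕ.< q ℕ.^ m
      small n<m = begin-strict
        ℤ.∣ eval f x ∣                    ≤⟨ upper x 1≤x ⟩
        C ℕ.* ℤ.∣ x ∣ ℕ.^ n               ≤⟨ ℕ.*-monoʳ-≤ C (ℕ.^-monoˡ-≤ n x<2q) ⟩
        C ℕ.* (2 ℕ.* q) ℕ.^ n             ≡⟨ trans (cong (C ℕ.*_) (Growth.^-distrib-* 2 q n)) (sym (ℕ.*-assoc C _ _)) ⟩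
        C ℕ.* 2 ℕ.^ n ℕ.* q ℕ.^ n         <⟨ ℕ.*-monoˡ-< (q ℕ.^ n) {{ℕ.m^n≢0 q n}} (ℕ.≤-<-trans (ℕ.≤-trans (ℕ.m≤n+m _ X₀) (ℕ.n≤1+n _)) j<q) ⟩
        q ℕ.* q ℕ.^ n                     ≤⟨ ℕ.^-monoʳ-≤ q n<m ⟩
        q ℕ.^ m                           ∎
        where open ℕ.≤-Reasoning

    -- The factor q left after removing the maximal power of X - a does not vanish at a.
    multiplicity : ∀ a → ∃ λ m → ℤₚX.HasMultiplicity fₚ a m × ∃ λ q → Factors a m q × ¬ ℤₚX.IsRoot q a
    multiplicity a =
      let m , (q , e) , max = maximum (λ m → ∃ (Factors a m)) (fₚ , factors-0 a) n (λ m (q , e) → multiplicity≤degree e)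
      in m , (factors⇒∣ e , λ d → ℕ.<-irrefl refl (max (suc m) (∣⇒factors d))) , q , e ,
         λ root → ℕ.<-irrefl refl (max (suc m) (quotientₚ q a , factors-suc e root))

    MultiplicityOfRoot : ℕ → Set
    MultiplicityOfRoot m = ∃ λ a → ℤₚX.IsRoot fₚ a × ℤₚX.HasMultiplicity fₚ a m

    R : ℕ
    R = Classical.largest em MultiplicityOfRoot

    root⇒R : ∀ {a} → ℤₚX.IsRoot fₚ a → MultiplicityOfRoot R × (∀ j → MultiplicityOfRoot j → j ℕ.≤ R)
    root⇒R {a} root = let m , hm , _ = multiplicity a in
      largest-spec MultiplicityOfRoot {m} (a , root , hm) n λ { m (a , _ , d , _) → multiplicity≤degree (proj₂ (∣⇒factors {a} {m} d)) }

    root⇒multiplicity≥1 : ∀ {a m q} → ℤₚX.IsRoot fₚ a → Factors a m q → ¬ ℤₚX.IsRoot q a → 1 ℕ.≤ m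
    root⇒multiplicity≥1 {m = suc m} _ _ _ = s≤s z≤n
    root⇒multiplicity≥1 {a} {zero} {q} root e ¬root = ⊥-elim (¬root λ k → difference (subst (_≡ 0ℤ [ P k ]) (sym (eval-at k q a))
      (mod-trans (mod-sym (subst (eval f (approx a k) ≡_[ P k ]) (ℤ.*-identityʳ _) (factors-eval e k (approx a k))))
        (subst (_≡ 0ℤ [ P k ]) (eval-f a k) (mod (root k))))))

    R≥1 : ∀ {a} → ℤₚX.IsRoot fₚ a → 1 ℕ.≤ R
    R≥1 {a} root = let m , hm , q , e , ¬root = multiplicity a in
      ℕ.≤-trans (root⇒multiplicity≥1 root e ¬root) (proj₂ (root⇒R root) m (a , root , hm))

    Near : ℕ → ℤ → Set
    Near k x = ∃ λ a → ℤₚX.IsRoot fₚ a × x ≡ approx a k [ P k ]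

    max-root : (∃ (ℤₚX.IsRoot fₚ)) → ∃ λ a → ∀ k x → x ≡ approx a k [ P k ] → P (k ℕ.* R) ∣ eval f x
    max-root (a₀ , root₀) = let a , root , d , _ = proj₁ (root⇒R root₀) in
      a , λ k x h → factors-∣ (proj₂ (∣⇒factors {a} {R} d)) k x h

    local : ∀ a → ∃ λ N → ∀ x → x ≡ approx a N [ P N ] → ∀ k → P (R ℕ.* k ℕ.+ N) ∣ eval f x →
            ℤₚX.IsRoot fₚ a × x ≡ approx a k [ P k ]
    local a = decide em
      where
      Local : Set
      Local = ∃ λ N → ∀ x → x ≡ approx a N [ P N ] → ∀ k → P (R ℕ.* k ℕ.+ N) ∣ eval f x → ℤₚX.IsRoot fₚ a × x ≡ approx a k [ P k ]
      near : ∀ m q → Factors a m q → ∀ N → ¬ (P N ∣ approx (ℤₚX.eval q a) N ℤ.- 0ℤ) → 1 ℕ.≤ m → m ℕ.≤ R →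
             ∀ x → x ≡ approx a N [ P N ] → ∀ k → P (R ℕ.* k ℕ.+ N) ∣ eval f x → x ≡ approx a k [ P k ]
      near m q e N h 1≤m m≤R x x≡a k d = conclude (euclid-power-^ pp N k m (eval (at K q) x) (x ℤ.- approx a K)
        (ℤ∣.∣-trans (^-∣ (+ p) (ℕ.≤-trans (ℕ.≤-reflexive (ℕ.+-comm N (m ℕ.* k))) (ℕ.+-monoˡ-≤ N (ℕ.*-monoˡ-≤ k m≤R))))
          (mod-∣ (mod-sym (factors-eval e K x)) d)))
        where
        K = R ℕ.* k ℕ.+ N
        N≤K = ℕ.m≤n+m N (R ℕ.* k)
        k≤K : k ℕ.≤ K
        k≤K = ℕ.≤-trans (ℕ.≤-trans (ℕ.≤-reflexive (sym (ℕ.*-identityˡ k))) (ℕ.*-monoˡ-≤ k (ℕ.≤-trans 1≤m m≤R))) (ℕ.m≤m+n _ N)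
        conclude : P N ∣ eval (at K q) x ⊎ P k ∣ x ℤ.- approx a K → x ≡ approx a k [ P k ]
        conclude (inj₁ b) = ⊥-elim (h (∣-resp (sym (ℤ.+-identityʳ _)) (subst (P N ∣_) (sym (eval-at N q a))
          (mod-∣ (mod-trans (mod-sym (eval-mod (at N q) x≡a)) (mod-sym (eval-cong (at K q) (at N q) (at-mod q N≤K) x))) b))))
        conclude (inj₂ b) = mod-trans (mod b) (approx-mod a k≤K)
      decide : Dec (ℤₚX.IsRoot fₚ a) → Local
      decide (no ¬root) = let N , h = ¬∀⇒∃¬ ¬root in N , λ x x≡a k d →
        ⊥-elim (h (difference (subst (_≡ 0ℤ [ P N ]) (sym (eval-f a N)) (mod-trans (mod-sym (eval-mod f x≡a))
          (mod (∣-resp (sym (ℤ.+-identityʳ _)) (ℤ∣.∣-trans (^-∣ (+ p) (ℕ.m≤n+m N (R ℕ.* k))) d)))))))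
      decide (yes root) =
        let m , hm , q , e , ¬root = multiplicity a
            N , h = ¬∀⇒∃¬ ¬root
            1≤m = root⇒multiplicity≥1 root e ¬root
            m≤R = proj₂ (root⇒R root) m (a , root , hm)
        in N , λ x x≡a k d → root , near m q e N h 1≤m m≤R x x≡a k d

    Good : ℤ → ℕ → Set
    Good c j = ∃ λ (A : List ℤₚ) → ∃ λ N → All (ℤₚX.IsRoot fₚ) A ×
      (∀ x → x ≡ c [ P j ] → ∀ k → P (R ℕ.* k ℕ.+ N) ∣ eval f x → ∃ λ a → a ∈ A × x ≡ approx a k [ P k ])

    private
      good-local : ∀ a → ∃ λ N → Good (approx a N) N
      good-local a = let N , h = local a in N , decide N h em
        where
        decide : ∀ N → (∀ x → x ≡ approx a N [ P N ] → ∀ k → P (R ℕ.* k ℕ.+ N) ∣ eval f x → ℤₚX.IsRoot fₚ a × x ≡ approx a k [ P k ]) →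
                 Dec (ℤₚX.IsRoot fₚ a) → Good (approx a N) N
        decide N h (yes root) = a ∷ [] , N , root ∷ [] , λ x x≡a k d → a , here refl , proj₂ (h x x≡a k d)
        decide N h (no ¬root) = [] , N , [] , λ x x≡a k d → ⊥-elim (¬root (proj₁ (h x x≡a k d)))

      child : ℤ → ℕ → ℕ → ℤ
      child c j d = c ℤ.+ + d ℤ.* P j

      good-children : ∀ c j D → (∀ d → d ℕ.< D → Good (child c j d) (suc j)) →
        ∃ λ (A : List ℤₚ) → ∃ λ N → All (ℤₚX.IsRoot fₚ) A ×
        (∀ d → d ℕ.< D → ∀ x → x ≡ child c j d [ P (suc j) ] → ∀ k → P (R ℕ.* k ℕ.+ N) ∣ eval f x → ∃ λ a → a ∈ A × x ≡ approx a k [ P k ])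
      good-children c j zero    h = [] , 0 , [] , λ d ()
      good-children c j (suc D) h =
        let A , N , rA , g = h D ℕ.≤-refl
            A′ , N′ , rA′ , g′ = good-children c j D (λ d d<D → h d (ℕ.m≤n⇒m≤1+n d<D))
        in A ++ A′ , N ℕ.+ N′ , All.++⁺ rA rA′ , λ d d<D x x≡ k dv → both A N g A′ N′ g′ d x x≡ k dv (ℕ.m≤n⇒m<n∨m≡n (ℕ.s≤s⁻¹ d<D))
        where
        both : ∀ A N → (∀ x → x ≡ child c j D [ P (suc j) ] → ∀ k → P (R ℕ.* k ℕ.+ N) ∣ eval f x → ∃ λ a → a ∈ A × x ≡ approx a k [ P k ]) →
               ∀ A′ N′ → (∀ d → d ℕ.< D → ∀ x → x ≡ child c j d [ P (suc j) ] → ∀ k → P (R ℕ.* k ℕ.+ N′) ∣ eval f x → ∃ λ a → a ∈ A′ × x ≡ approx a k [ P k ]) →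
               ∀ d x → x ≡ child c j d [ P (suc j) ] → ∀ k → P (R ℕ.* k ℕ.+ (N ℕ.+ N′)) ∣ eval f x → d ℕ.< D ⊎ d ≡ D →
               ∃ λ a → a ∈ A ++ A′ × x ≡ approx a k [ P k ]
        both A N g A′ N′ g′ d x x≡ k dv (inj₂ refl) = let a , m , e = g x x≡ k (ℤ∣.∣-trans (^-∣ (+ p) (ℕ.+-monoʳ-≤ (R ℕ.* k) (ℕ.m≤m+n N N′))) dv) in a , ∈-++⁺ˡ m , e
        both A N g A′ N′ g′ d x x≡ k dv (inj₁ d<D′) = let a , m , e = g′ d d<D′ x x≡ k (ℤ∣.∣-trans (^-∣ (+ p) (ℕ.+-monoʳ-≤ (R ℕ.* k) (ℕ.m≤n+m N′ N))) dv) in a , ∈-++⁺ʳ A m , e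

      good-parent : ∀ c j → (∀ d → d ℕ.< p → Good (child c j d) (suc j)) → Good c j
      good-parent c j h = let A , N , rA , g = good-children c j p h in A , N , rA , λ x x≡c → split A N g x x≡c
        where
        split : ∀ A N → (∀ d → d ℕ.< p → ∀ x → x ≡ child c j d [ P (suc j) ] → ∀ k → P (R ℕ.* k ℕ.+ N) ∣ eval f x → ∃ λ a → a ∈ A × x ≡ approx a k [ P k ]) →
                ∀ x → x ≡ c [ P j ] → ∀ k → P (R ℕ.* k ℕ.+ N) ∣ eval f x → ∃ λ a → a ∈ A × x ≡ approx a k [ P k ]
        split A N g x (mod (divides t e)) = g (t ℤ.% + p) (ℤ.n%d<d t (+ p)) x (mod (divides (t ℤ./ + p) (begin
          x ℤ.- (c ℤ.+ + r ℤ.* P j)           ≡⟨ solve 3 (λ x c w → x :- (c :+ w) := (x :- c) :- w) refl x c (+ r ℤ.* P j) ⟩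
          (x ℤ.- c) ℤ.- + r ℤ.* P j           ≡⟨ cong (λ w → w ℤ.- + r ℤ.* P j) (trans e (cong (ℤ._* P j) (ℤ.a≡a%n+[a/n]*n t (+ p)))) ⟩
          (+ r ℤ.+ s ℤ.* + p) ℤ.* P j ℤ.- + r ℤ.* P j  ≡⟨ solve 4 (λ r s p w → (r :+ s :* p) :* w :- r :* w := s :* (p :* w)) refl (+ r) s (+ p) (P j) ⟩
          s ℤ.* (+ p ℤ.* P j)                 ∎)))
          where
          open ≡-Reasoning
          open ℤSolver.+-*-Solver
          r = t ℤ.% + p
          s = t ℤ./ + p

      bad-child : ∀ c j → ¬ Good c j → ∃ λ d → ¬ Good (child c j d) (suc j)
      bad-child c j bad = ¬∀⇒∃¬ λ all → bad (good-parent c j (λ d _ → all d))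

      bad-branch : ¬ Good 0ℤ 0 → ∀ j → ∃ λ c → ¬ Good c j
      bad-branch bad zero    = 0ℤ , bad
      bad-branch bad (suc j) = let c , b = bad-branch bad j ; d , b′ = bad-child c j b in child c j d , b′

    -- König's lemma on the tree of residue classes modulo powers of p.
    good : Good 0ℤ 0
    good = by-contradiction λ bad → let N , g = good-local (branch bad) in proj₂ (bad-branch bad N) g
      where
      open ℤSolver.+-*-Solver
      branch : ¬ Good 0ℤ 0 → ℤₚ
      branch bad = mkℤₚ (λ j → proj₁ (bad-branch bad j)) λ j → divides (+ proj₁ (bad-child _ j (proj₂ (bad-branch bad j))))
        (solve 2 (λ c w → (c :+ w) :- c := w) refl (proj₁ (bad-branch bad j)) (+ proj₁ (bad-child _ j (proj₂ (bad-branch bad j))) ℤ.* P j))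

    near-root : ∃ λ (A : List ℤₚ) → ∃ λ N → All (ℤₚX.IsRoot fₚ) A ×
      (∀ x k → P (R ℕ.* k ℕ.+ N) ∣ eval f x → ∃ λ a → a ∈ A × x ≡ approx a k [ P k ])
    near-root = let A , N , rA , g = good in A , N , rA , λ x k → g x (mod (1∣ _)) k

module Counting (em : ExcludedMiddle 0ℓ) where
  open ClassicalChoice em
  open Congruence

  Cover : (ℤ → Set) → ℕ → Set
  Cover P w = ∃ λ zs → length zs ℕ.≤ w × (∀ x → P x → x ∈ zs)

  Many : (ℤ → Set) → ℕ → Set
  Many P w = ∃ λ zs → Unique zs × w ℕ.≤ length zs × (∀ x → x ∈ zs → P x)

  unique-⊆⇒length≤ : ∀ {A : Set} (xs zs : List A) → Unique xs → (∀ x → x ∈ xs → x ∈ zs) → length xs ℕ.≤ length zs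
  unique-⊆⇒length≤ []       zs u s = z≤n
  unique-⊆⇒length≤ (x ∷ xs) zs (x∉ ∷ u) s with ∈-∃++ (s x (here refl))
  ... | as , bs , refl = subst (suc (length xs) ℕ.≤_) (trans (cong suc (List.length-++ as)) (trans (sym (ℕ.+-suc (length as) (length bs))) (sym (List.length-++ as))))
    (s≤s (unique-⊆⇒length≤ xs (as ++ bs) u λ y y∈ → drop y y∈ (∈-++⁻ as (s y (there y∈)))))
    where
    drop : ∀ y → y ∈ xs → y ∈ as ⊎ y ∈ x ∷ bs → y ∈ as ++ bs
    drop y y∈ (inj₁ i) = ∈-++⁺ˡ i
    drop y y∈ (inj₂ (here refl)) = ⊥-elim (All.lookup x∉ y∈ refl)
    drop y y∈ (inj₂ (there i)) = ∈-++⁺ʳ as i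

  module _ {P : ℤ → Set} where
    private
      Enumerates : ℕ → Set
      Enumerates k = Σ (List ℤ) λ xs → Unique xs × length xs ≡ k × (∀ x → x ∈ xs ⇔ P x)

      enumerate : ∀ {w} → Cover P w → ∃ Enumerates
      enumerate (zs , _ , c) = _ , xs , Unique.filter⁺ P? (deduplicate-! ℤ._≟_ zs) , refl , λ x → mk⇔
        (λ x∈ → proj₂ (∈-filter⁻ P? {xs = deduplicate ℤ._≟_ zs} x∈))
        (λ px → ∈-filter⁺ P? (∈-deduplicate⁺ ℤ._≟_ (c x px)) px)
        where
        P? : ∀ x → Dec (P x)
        P? x = em
        xs = filter P? (deduplicate ℤ._≟_ zs)

      #-enumerates : ∀ {w} → Cover P w → Enumerates (Classical.# em P)
      #-enumerates c = the-spec {d = 0} {P = Enumerates} (enumerate c)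

    #-≤ : ∀ {w} → Cover P w → Classical.# em P ℕ.≤ w
    #-≤ c@(zs , l , covers) = let xs , u , e , h = #-enumerates c in
      ℕ.≤-trans (ℕ.≤-reflexive (sym e)) (ℕ.≤-trans (unique-⊆⇒length≤ xs zs u (λ x x∈ → covers x (Equivalence.to (h x) x∈))) l)

    #-≥ : ∀ {w u} → Cover P w → Many P u → u ℕ.≤ Classical.# em P
    #-≥ c (zs , uz , l , all) = let xs , u , e , h = #-enumerates c in
      ℕ.≤-trans l (ℕ.≤-trans (unique-⊆⇒length≤ zs xs uz (λ x x∈ → Equivalence.from (h x) (all x x∈))) (ℕ.≤-reflexive e))

  cover-⊆ : ∀ {P Q w} → (∀ x → P x → Q x) → Cover Q w → Cover P w
  cover-⊆ s (zs , l , c) = zs , l , λ x → c x ∘ s x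

  cover-∪ : ∀ {A : Set} (ks : List A) (P : A → ℤ → Set) w → (∀ k → k ∈ ks → Cover (P k) w) →
            Cover (λ x → ∃ λ k → k ∈ ks × P k x) (length ks ℕ.* w)
  cover-∪ []       P w h = [] , z≤n , λ { x (k , () , _) }
  cover-∪ (k ∷ ks) P w h =
    let zs , l , c = h k (here refl)
        zs′ , l′ , c′ = cover-∪ ks P w (λ k k∈ → h k (there k∈))
    in zs ++ zs′ , subst (ℕ._≤ w ℕ.+ length ks ℕ.* w) (sym (List.length-++ zs)) (ℕ.+-mono-≤ l l′) , λ where
      x (_ , here refl , p) → ∈-++⁺ˡ (c x p)
      x (k , there k∈ , p)  → ∈-++⁺ʳ zs (c′ x (k , k∈ , p))

  many-⊆ : ∀ {P Q w} → (∀ x → P x → Q x) → Many P w → Many Q w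
  many-⊆ s (zs , u , l , c) = zs , u , l , λ x → s x ∘ c x

  many-∪ : ∀ L (P : ℕ → ℤ → Set) w → (∀ k → k ℕ.< L → Many (P k) w) → (∀ {k l x} → k ℕ.< l → P k x → ¬ P l x) →
           Many (λ x → ∃ λ k → k ℕ.< L × P k x) (L ℕ.* w)
  many-∪ zero    P w h disjoint = [] , [] , z≤n , λ x ()
  many-∪ (suc L) P w h disjoint =
    let zs , u , l , c = h L ℕ.≤-refl
        zs′ , u′ , l′ , c′ = many-∪ L P w (λ k k<L → h k (ℕ.m≤n⇒m≤1+n k<L)) disjoint
    in zs ++ zs′ , Unique.++⁺ u u′ (λ { {x} (x∈ , x∈′) → let k , k<L , p = c′ x x∈′ in disjoint k<L p (c x x∈) }) ,
       subst (w ℕ.+ L ℕ.* w ℕ.≤_) (sym (List.length-++ zs)) (ℕ.+-mono-≤ l l′) ,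
       λ x x∈ → pick zs c c′ x (∈-++⁻ zs x∈)
    where
    pick : ∀ zs {zs′} → (∀ x → x ∈ zs → P L x) → (∀ x → x ∈ zs′ → ∃ λ k → k ℕ.< L × P k x) →
           ∀ x → x ∈ zs ⊎ x ∈ zs′ → ∃ λ k → k ℕ.< suc L × P k x
    pick zs c c′ x (inj₁ i) = L , ℕ.≤-refl , c x i
    pick zs c c′ x (inj₂ i) = let k , k<L , p = c′ x i in k , ℕ.m≤n⇒m≤1+n k<L , p

  pos-*^ : ∀ m p k → + (m ℕ.* p ℕ.^ k) ≡ + m ℤ.* (+ p) ℤ.^ k
  pos-*^ m p k = trans (ℤ.pos-* m (p ℕ.^ k)) (cong (+ m ℤ.*_) (sym (pos-^ p k)))

  data Tuple (N : ℕ → ℕ → ℤ → Set) (x : ℤ) : List ℕ → ℕ → Set where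
    []  : Tuple N x [] 1
    _∷_ : ∀ {p k P D} → N p k x → Tuple N x P D → Tuple N x (p ∷ P) (p ℕ.^ k ℕ.* D)

  tuple≥1 : ∀ {N x P D} → All (2 ℕ.≤_) P → Tuple N x P D → 1 ℕ.≤ D
  tuple≥1 _ [] = ℕ.≤-refl
  tuple≥1 (2≤p ∷ h) (_∷_ {p} {k} _ t) = ℕ.*-mono-≤ (ℕ.m^n>0 p {{ℕ.>-nonZero (ℕ.≤-trans (s≤s z≤n) 2≤p)}} k) (tuple≥1 h t)

  module Spaced (B M : ℕ) .{{_ : ℕ.NonZero M}} where

    h : ℕ
    h = (2 ℕ.* B) ℕ./ M

    W : ℕ
    W = suc h ℕ.+ suc h

    spaced-cover : ∀ (Q : ℤ → Set) {m} → M ℕ.≤ m → (∀ x → Q x → ℤ.∣ x ∣ ℕ.≤ B) → (∀ x y → Q x → Q y → x ≡ y [ + m ]) → Cover Q W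
    spaced-cover Q {m} M≤m bound spaced with em {∃ Q}
    ... | no ¬q = [] , z≤n , λ x qx → ⊥-elim (¬q (x , qx))
    ... | yes (y , qy) = up ++ down , ℕ.≤-reflexive len , covers
      where
      up = map (λ i → y ℤ.+ + i ℤ.* + m) (upTo (suc h))
      down = map (λ i → y ℤ.+ (ℤ.- + i) ℤ.* + m) (upTo (suc h))
      len : length (up ++ down) ≡ W
      len = trans (List.length-++ up) (cong₂ ℕ._+_ (trans (List.length-map _ (upTo (suc h))) (List.length-upTo (suc h))) (trans (List.length-map _ (upTo (suc h))) (List.length-upTo (suc h))))
      size : ∀ x t → Q x → x ℤ.- y ≡ t ℤ.* + m → ℤ.∣ t ∣ ℕ.< suc h
      size x t qx e = s≤s (subst (ℕ._≤ h) (ℕ.m*n/n≡m ℤ.∣ t ∣ M) (ℕ./-monoˡ-≤ M (begin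
        ℤ.∣ t ∣ ℕ.* M           ≤⟨ ℕ.*-monoʳ-≤ ℤ.∣ t ∣ M≤m ⟩
        ℤ.∣ t ∣ ℕ.* m           ≡⟨ sym (ℤ.∣i*j∣≡∣i∣*∣j∣ t (+ m)) ⟩
        ℤ.∣ t ℤ.* + m ∣         ≡⟨ cong ℤ.∣_∣ (sym e) ⟩
        ℤ.∣ x ℤ.- y ∣           ≤⟨ ℤ.∣i-j∣≤∣i∣+∣j∣ x y ⟩
        ℤ.∣ x ∣ ℕ.+ ℤ.∣ y ∣     ≤⟨ ℕ.+-mono-≤ (bound x qx) (ℕ.≤-trans (bound y qy) (ℕ.≤-reflexive (sym (ℕ.+-identityʳ B)))) ⟩
        2 ℕ.* B                 ∎)))
        where open ℕ.≤-Reasoning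
      back : ∀ x t → x ℤ.- y ≡ t ℤ.* + m → y ℤ.+ t ℤ.* + m ≡ x
      back x t e = trans (cong (ℤ._+_ y) (sym e)) (solve 2 (λ x y → y :+ (x :- y) := x) refl x y)
        where open ℤSolver.+-*-Solver
      locate : ∀ x t → x ℤ.- y ≡ t ℤ.* + m → ℤ.∣ t ∣ ℕ.< suc h → x ∈ up ++ down
      locate x (+ i) e i<h = ∈-++⁺ˡ (subst (_∈ up) (back x (+ i) e) (∈-map⁺ _ (∈-upTo⁺ i<h)))
      locate x -[1+ i ] e i<h = ∈-++⁺ʳ up (subst (_∈ down) (back x -[1+ i ] e) (∈-map⁺ (λ i → y ℤ.+ (ℤ.- + i) ℤ.* + m) (∈-upTo⁺ i<h)))
      covers : ∀ x → Q x → x ∈ up ++ down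
      covers x qx with spaced x y qx qy
      ... | mod (divides t e) = locate x t e (size x t qx e)

  module Upper (A : ℕ → List (ℕ → ℤ)) (coherent : ∀ {p a i k} → a ∈ A p → i ℕ.≤ k → a k ≡ a i [ (+ p) ℤ.^ i ])
               (B M L : ℕ) .{{_ : ℕ.NonZero M}} (M≤2^L : M ℕ.≤ 2 ℕ.^ L) (p₀ : ℕ) (2≤p₀ : 2 ℕ.≤ p₀) where
    open Spaced B M

    Near : ℕ → ℕ → ℤ → Set
    Near p k x = ∃ λ a → a ∈ A p × x ≡ a k [ (+ p) ℤ.^ k ]

    near-≤ : ∀ {p i k x} → i ℕ.≤ k → Near p k x → Near p i x
    near-≤ {p} i≤k (a , a∈ , e) = a , a∈ , mod-trans (mod-weaken (^-∣ (+ p) i≤k) e) (coherent a∈ i≤k)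

    capacity : List ℕ → ℕ
    capacity []      = length (A p₀) ℕ.* W
    capacity (p ∷ P) = suc L ℕ.* (length (A p) ℕ.* capacity P)

    private
      M≤*^ : ∀ {p m} → 2 ℕ.≤ p → 1 ℕ.≤ m → M ℕ.≤ m ℕ.* p ℕ.^ L
      M≤*^ {p} {m} 2≤p 1≤m = ℕ.≤-trans M≤2^L (ℕ.≤-trans (ℕ.^-monoˡ-≤ L 2≤p) (ℕ.m≤n*m (p ℕ.^ L) m {{ℕ.>-nonZero 1≤m}}))

      refine : ∀ {Q : ℤ → Set} {m p k} a → Comaximal (+ m) (+ p) → (∀ x y → Q x → Q y → x ≡ y [ + m ]) →
               ∀ x y → Q x × x ≡ a [ (+ p) ℤ.^ k ] → Q y × y ≡ a [ (+ p) ℤ.^ k ] → x ≡ y [ + (m ℕ.* p ℕ.^ k) ]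
      refine {m = m} {p} {k} a c spaced x y (qx , ex) (qy , ey) = mod (subst (_∣ x ℤ.- y) (sym (pos-*^ m p k))
        (comaximal-∣ (comaximal-^ k c) (difference (spaced x y qx qy)) (difference (mod-trans ex (mod-sym ey)))))

    Large : ℕ → List ℕ → (ℤ → Set) → ℤ → Set
    Large m P Q x = Q x × ∃ λ k₀ → ∃ λ D → Near p₀ k₀ x × Tuple Near x P D × M ℕ.≤ m ℕ.* p₀ ℕ.^ k₀ ℕ.* D

    -- Once the exponents of the primes in P are fixed, that of p₀ may be taken minimal.
    upper : ∀ P m Q → 1 ℕ.≤ m → Comaximal (+ m) (+ p₀) → All (λ p → 2 ℕ.≤ p × Comaximal (+ m) (+ p) × Comaximal (+ p₀) (+ p)) P →
            AllPairs (λ p q → Comaximal (+ p) (+ q)) P →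
            (∀ x → Q x → ℤ.∣ x ∣ ℕ.≤ B) → (∀ x y → Q x → Q y → x ≡ y [ + m ]) → Cover (Large m P Q) (capacity P)
    upper [] m Q 1≤m c _ _ bound spaced =
      let κ , M≤ , least = minimum (λ κ → M ℕ.≤ m ℕ.* p₀ ℕ.^ κ) L (M≤*^ 2≤p₀ 1≤m)
      in cover-⊆ (λ { x (qx , k₀ , _ , near , [] , M≤mk) →
            let a , a∈ , e = near-≤ (least k₀ (subst (M ℕ.≤_) (ℕ.*-identityʳ _) M≤mk)) near in a , a∈ , qx , e })
          (cover-∪ (A p₀) (λ a x → Q x × x ≡ a κ [ (+ p₀) ℤ.^ κ ]) W λ a a∈ →
            spaced-cover _ M≤ (λ x q → bound x (proj₁ q)) (refine {Q} {m} {p₀} {κ} (a κ) c spaced))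
    upper (p ∷ P) m Q 1≤m c ((2≤p , cmp , cp₀p) ∷ cs) (ps ∷ pps) bound spaced =
      cover-⊆ reduce (subst (Cover _) (cong (ℕ._* (length (A p) ℕ.* capacity P)) (List.length-upTo (suc L)))
        (cover-∪ (upTo (suc L)) (λ k x → ∃ λ a → a ∈ A p × Large (m ℕ.* p ℕ.^ k) P (Q′ k a) x) (length (A p) ℕ.* capacity P) λ k _ →
          cover-∪ (A p) (λ a → Large (m ℕ.* p ℕ.^ k) P (Q′ k a)) (capacity P) λ a a∈ →
            upper P (m ℕ.* p ℕ.^ k) (Q′ k a) (ℕ.*-mono-≤ 1≤m (1≤p^ k)) (extend k c (comaximal-sym cp₀p))
              (All.zipWith (λ { ((2≤q , cmq , cp₀q) , cpq) → 2≤q , extend k cmq cpq , cp₀q }) (cs , ps)) pps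
              (λ x q → bound x (proj₁ q)) (refine {Q} {m} {p} {k} (a k) cmp spaced)))
      where
      Q′ : ℕ → (ℕ → ℤ) → ℤ → Set
      Q′ k a x = Q x × x ≡ a k [ (+ p) ℤ.^ k ]
      1≤p^ : ∀ k → 1 ℕ.≤ p ℕ.^ k
      1≤p^ k = ℕ.m^n>0 p {{ℕ.>-nonZero (ℕ.≤-trans (s≤s z≤n) 2≤p)}} k
      extend : ∀ {q} k → Comaximal (+ m) (+ q) → Comaximal (+ p) (+ q) → Comaximal (+ (m ℕ.* p ℕ.^ k)) (+ q)
      extend {q} k cm cp = subst (λ z → Comaximal z (+ q)) (sym (pos-*^ m p k))
        (comaximal-sym (comaximal-* (comaximal-sym cm) (comaximal-^ k (comaximal-sym cp))))
      reduce : ∀ x → Large m (p ∷ P) Q x → ∃ λ k → k ∈ upTo (suc L) × ∃ λ a → a ∈ A p × Large (m ℕ.* p ℕ.^ k) P (Q′ k a) x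
      reduce x (qx , k₀ , _ , near₀ , _∷_ {k = k} {D = D} near t , M≤) with k ℕ.≤? L
      ... | yes k≤L = let a , a∈ , e = near in k , ∈-upTo⁺ (s≤s k≤L) , a , a∈ , (qx , e) , k₀ , D , near₀ , t ,
              subst (M ℕ.≤_) (solve 4 (λ m u v d → m :* u :* (v :* d) := m :* v :* u :* d) refl m (p₀ ℕ.^ k₀) (p ℕ.^ k) D) M≤
        where open +-*-Solver
      ... | no k≰L = let a , a∈ , e = near-≤ (ℕ.<⇒≤ (ℕ.≰⇒> k≰L)) near in L , ∈-upTo⁺ ℕ.≤-refl , a , a∈ , (qx , e) , k₀ , D , near₀ , t ,
              ℕ.≤-trans (M≤*^ 2≤p 1≤m) (ℕ.≤-trans (ℕ.m≤m*n _ (p₀ ℕ.^ k₀) {{ℕ.>-nonZero (ℕ.m^n>0 p₀ {{ℕ.>-nonZero (ℕ.≤-trans (s≤s z≤n) 2≤p₀)}} k₀)}})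
                (ℕ.m≤m*n _ D {{ℕ.>-nonZero (tuple≥1 (All.map proj₁ cs) t)}}))

    capacity-≡ : ∀ P → capacity P ≡ suc L ℕ.^ length P ℕ.* (product (map (λ p → length (A p)) (p₀ ∷ P)) ℕ.* W)
    capacity-≡ []      = solve 2 (λ a w → a :* w := con 1 :* ((a :* con 1) :* w)) refl (length (A p₀)) W
      where open +-*-Solver
    capacity-≡ (p ∷ P) = trans (cong (λ c → suc L ℕ.* (length (A p) ℕ.* c)) (capacity-≡ P))
      (solve 6 (λ l a e a₀ r w → l :* (a :* (e :* ((a₀ :* r) :* w))) := (l :* e) :* ((a₀ :* (a :* r)) :* w)) refl
        (suc L) (length (A p)) (suc L ℕ.^ length P) (length (A p₀)) (product (map (λ p → length (A p)) P)) W)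
      where open +-*-Solver

  module Lower (a : ℕ → ℕ → ℤ) (B M L J X₀ : ℕ) (p₀ : ℕ) (2≤p₀ : 2 ℕ.≤ p₀) where

    Near : ℕ → ℕ → ℤ → Set
    Near p k x = x ≡ a p k [ (+ p) ℤ.^ k ]

    Large : ℕ → ℕ → ℤ → List ℕ → ℤ → Set
    Large m D r P x = x ≡ r [ + m ] × X₀ ℕ.< ℤ.∣ x ∣ × ℤ.∣ x ∣ ℕ.≤ B ×
      ∃ λ k₀ → ∃ λ D′ → Near p₀ k₀ x × Tuple Near x P D′ × M ℕ.≤ D ℕ.* p₀ ℕ.^ k₀ ℕ.* D′

    progression : ∀ m r .{{_ : ℕ.NonZero m}} → X₀ ℕ.+ J ℕ.* m ℕ.≤ B → Many (λ x → x ≡ r [ + m ] × X₀ ℕ.< ℤ.∣ x ∣ × ℤ.∣ x ∣ ℕ.≤ B) J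
    progression m@(suc _) r bound = map y (upTo J) , Unique.map⁺ y-injective (Unique.upTo⁺ J) ,
      ℕ.≤-reflexive (sym (trans (List.length-map y (upTo J)) (List.length-upTo J))) , λ x x∈ →
      let j , j∈ , e = ∈-map⁻ y x∈ in subst (λ x → x ≡ r [ + m ] × X₀ ℕ.< ℤ.∣ x ∣ × ℤ.∣ x ∣ ℕ.≤ B) (sym e) (good j (∈-upTo⁻ j∈))
      where
      s = r ℤ.- + suc X₀
      ρ = s ℤ.% + m
      t = s ℤ./ + m
      y : ℕ → ℤ
      y j = + (suc X₀ ℕ.+ ρ ℕ.+ j ℕ.* m)
      y-injective : ∀ {i j} → y i ≡ y j → i ≡ j
      y-injective {i} {j} e = ℕ.*-cancelʳ-≡ i j m (ℕ.+-cancelˡ-≡ (suc X₀ ℕ.+ ρ) (i ℕ.* m) (j ℕ.* m) (ℤ.+-injective e))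
      good : ∀ j → j ℕ.< J → y j ≡ r [ + m ] × X₀ ℕ.< ℤ.∣ y j ∣ × ℤ.∣ y j ∣ ℕ.≤ B
      good j j<J = mod (divides (+ j ℤ.- t) (begin
          y j ℤ.- r                                            ≡⟨ cong (λ w → y j ℤ.- w) (solve 2 (λ r x → r := (r :- x) :+ x) refl r (+ suc X₀)) ⟩
          y j ℤ.- (s ℤ.+ + suc X₀)                             ≡⟨ cong₂ (λ u w → u ℤ.- (w ℤ.+ + suc X₀)) yj (ℤ.a≡a%n+[a/n]*n s (+ m)) ⟩
          (+ suc X₀ ℤ.+ + ρ ℤ.+ + j ℤ.* + m) ℤ.- ((+ ρ ℤ.+ t ℤ.* + m) ℤ.+ + suc X₀)  ≡⟨ solve 5 (λ x ρ j m t → (x :+ ρ :+ j :* m) :- ((ρ :+ t :* m) :+ x) := (j :- t) :* m) refl (+ suc X₀) (+ ρ) (+ j) (+ m) t ⟩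
          (+ j ℤ.- t) ℤ.* + m                                  ∎)) ,
        ℕ.≤-trans (ℕ.m≤m+n (suc X₀) ρ) (ℕ.m≤m+n _ (j ℕ.* m)) ,
        ℕ.≤-trans (ℕ.≤-trans (ℕ.≤-reflexive (trans (cong (ℕ._+ j ℕ.* m) (sym (ℕ.+-suc X₀ ρ))) (ℕ.+-assoc X₀ (suc ρ) (j ℕ.* m))))
          (ℕ.+-monoʳ-≤ X₀ (ℕ.≤-trans (ℕ.+-monoˡ-≤ (j ℕ.* m) (ℤ.n%d<d s (+ m))) (ℕ.*-monoˡ-≤ m j<J)))) bound
        where
        open ≡-Reasoning
        open ℤSolver.+-*-Solver
        yj : y j ≡ + suc X₀ ℤ.+ + ρ ℤ.+ + j ℤ.* + m
        yj = trans (ℤ.pos-+ (suc X₀ ℕ.+ ρ) (j ℕ.* m)) (cong₂ ℤ._+_ (ℤ.pos-+ (suc X₀) ρ) (ℤ.pos-* j m))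

    -- The residue a p (k + 1) + p ^ k modulo p ^ (k + 1) makes x agree with a p
    -- to precision exactly k, so that different k give disjoint sets.
    lower : ∀ P m D E r → m ≡ D ℕ.* E → 1 ℕ.≤ D → 1 ℕ.≤ E → Comaximal (+ m) (+ p₀) →
            All (λ p → 2 ℕ.≤ p × Comaximal (+ m) (+ p) × Comaximal (+ p₀) (+ p)) P →
            AllPairs (λ p q → Comaximal (+ p) (+ q)) P →
            (∀ p → p ∈ P → ∀ {i k} → i ℕ.≤ k → a p k ≡ a p i [ (+ p) ℤ.^ i ]) →
            D ℕ.* product P ℕ.^ L ℕ.≤ M → X₀ ℕ.+ J ℕ.* (p₀ ℕ.* M ℕ.* (E ℕ.* product P)) ℕ.≤ B →
            Many (Large m D r P) (L ℕ.^ length P ℕ.* J)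
    lower [] m D E r refl 1≤D 1≤E c _ _ _ D≤M bound =
      let κ , M≤ , least = minimum (λ κ → M ℕ.≤ D ℕ.* p₀ ℕ.^ κ) M large
          x₀ , x₀≡r , x₀≡a = chinese-remainder (comaximal-^ κ c) r (a p₀ κ)
      in subst (Many (Large (D ℕ.* E) D r [])) (sym (ℕ.*-identityˡ J)) (base κ x₀ M≤ least x₀≡r x₀≡a)
      where
      1≤p₀^ : ∀ k → 1 ℕ.≤ p₀ ℕ.^ k
      1≤p₀^ k = ℕ.m^n>0 p₀ {{ℕ.>-nonZero (ℕ.≤-trans (s≤s z≤n) 2≤p₀)}} k
      D≤M′ : D ℕ.≤ M
      D≤M′ = ℕ.≤-trans (ℕ.≤-reflexive (trans (sym (ℕ.*-identityʳ D)) (cong (D ℕ.*_) (sym (ℕ.^-zeroˡ L))))) D≤M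
      n≤p₀^n : ∀ n → n ℕ.≤ p₀ ℕ.^ n
      n≤p₀^n zero    = z≤n
      n≤p₀^n (suc n) = ℕ.≤-trans (ℕ.+-mono-≤ (1≤p₀^ n) (ℕ.≤-trans (n≤p₀^n n) (ℕ.≤-reflexive (sym (ℕ.+-identityʳ _))))) (ℕ.*-monoˡ-≤ (p₀ ℕ.^ n) 2≤p₀)
      large : M ℕ.≤ D ℕ.* p₀ ℕ.^ M
      large = ℕ.≤-trans (n≤p₀^n M) (ℕ.m≤n*m (p₀ ℕ.^ M) D {{ℕ.>-nonZero 1≤D}})
      small′ : ∀ κ → (∀ j → M ℕ.≤ D ℕ.* p₀ ℕ.^ j → κ ℕ.≤ j) → D ℕ.* p₀ ℕ.^ κ ℕ.≤ p₀ ℕ.* M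
      small′ zero    least = ℕ.≤-trans (ℕ.≤-reflexive (ℕ.*-identityʳ D)) (ℕ.≤-trans D≤M′ (ℕ.m≤n*m M p₀ {{ℕ.>-nonZero (ℕ.≤-trans (s≤s z≤n) 2≤p₀)}}))
      small′ (suc κ) least = ℕ.≤-trans (ℕ.≤-reflexive (solve 3 (λ d p q → d :* (p :* q) := p :* (d :* q)) refl D p₀ (p₀ ℕ.^ κ)))
        (ℕ.*-monoʳ-≤ p₀ (ℕ.<⇒≤ (ℕ.≰⇒> λ M≤ → ℕ.<-irrefl refl (least κ M≤))))
        where open +-*-Solver
      small : ∀ κ → (∀ j → M ℕ.≤ D ℕ.* p₀ ℕ.^ j → κ ℕ.≤ j) → D ℕ.* E ℕ.* p₀ ℕ.^ κ ℕ.≤ p₀ ℕ.* M ℕ.* (E ℕ.* 1)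
      small κ least = ℕ.≤-trans (ℕ.≤-reflexive (solve 3 (λ d e q → d :* e :* q := (d :* q) :* (e :* con 1)) refl D E (p₀ ℕ.^ κ)))
        (ℕ.*-monoˡ-≤ (E ℕ.* 1) (small′ κ least))
        where open +-*-Solver
      base : ∀ κ x₀ → M ℕ.≤ D ℕ.* p₀ ℕ.^ κ → (∀ j → M ℕ.≤ D ℕ.* p₀ ℕ.^ j → κ ℕ.≤ j) →
             x₀ ≡ r [ + (D ℕ.* E) ] → x₀ ≡ a p₀ κ [ (+ p₀) ℤ.^ κ ] → Many (Large (D ℕ.* E) D r []) J
      base κ x₀ M≤ least x₀≡r x₀≡a = many-⊆
        (λ { x (e , X₀<x , x≤B) →
          mod-trans (mod-weaken (subst (+ (D ℕ.* E) ∣_) (sym modulus) (ℤ∣.∣m⇒∣m*n ((+ p₀) ℤ.^ κ) ℤ∣.∣-refl)) e) x₀≡r , X₀<x , x≤B , κ , 1 ,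
          mod-trans (mod-weaken (subst ((+ p₀) ℤ.^ κ ∣_) (sym modulus) (ℤ∣.∣n⇒∣m*n (+ (D ℕ.* E)) ℤ∣.∣-refl)) e) x₀≡a , [] ,
          subst (M ℕ.≤_) (sym (ℕ.*-identityʳ _)) M≤ })
        (progression (D ℕ.* E ℕ.* p₀ ℕ.^ κ) x₀ {{ℕ.>-nonZero (ℕ.*-mono-≤ (ℕ.*-mono-≤ 1≤D 1≤E) (1≤p₀^ κ))}}
          (ℕ.≤-trans (ℕ.+-monoʳ-≤ X₀ (ℕ.*-monoʳ-≤ J (small κ least))) bound))
        where
        modulus = pos-*^ (D ℕ.* E) p₀ κ
    lower (p ∷ P) m D E r refl 1≤D 1≤E c ((2≤p , cmp , cp₀p) ∷ cs) (ps ∷ pps) coherent D≤M bound =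
      Step.many (λ k → proj₁ (class k)) (λ k → proj₁ (proj₂ (class k))) (λ k → proj₂ (proj₂ (class k)))
      where
      open +-*-Solver
      class : ∀ k → ∃ λ x → x ≡ r [ + (D ℕ.* E) ] × x ≡ a p (suc k) ℤ.+ (+ p) ℤ.^ k [ (+ p) ℤ.^ suc k ]
      class k = chinese-remainder (comaximal-^ (suc k) cmp) r (a p (suc k) ℤ.+ (+ p) ℤ.^ k)
      1≤p^ : ∀ k → 1 ℕ.≤ p ℕ.^ k
      1≤p^ k = ℕ.m^n>0 p {{ℕ.>-nonZero (ℕ.≤-trans (s≤s z≤n) 2≤p)}} k
      module Step (ρ : ℕ → ℤ) (ρ≡r : ∀ k → ρ k ≡ r [ + (D ℕ.* E) ]) (ρ≡a : ∀ k → ρ k ≡ a p (suc k) ℤ.+ (+ p) ℤ.^ k [ (+ p) ℤ.^ suc k ]) where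
        m∣ : ∀ k → + (D ℕ.* E) ∣ + (D ℕ.* E ℕ.* p ℕ.^ suc k)
        m∣ k = subst (+ (D ℕ.* E) ∣_) (sym (pos-*^ (D ℕ.* E) p (suc k))) (ℤ∣.∣m⇒∣m*n ((+ p) ℤ.^ suc k) ℤ∣.∣-refl)
        p^∣ : ∀ k → (+ p) ℤ.^ suc k ∣ + (D ℕ.* E ℕ.* p ℕ.^ suc k)
        p^∣ k = subst ((+ p) ℤ.^ suc k ∣_) (sym (pos-*^ (D ℕ.* E) p (suc k))) (ℤ∣.∣n⇒∣m*n (+ (D ℕ.* E)) ℤ∣.∣-refl)
        agree : ∀ k {x} → x ≡ ρ k [ + (D ℕ.* E ℕ.* p ℕ.^ suc k) ] → x ≡ a p (suc k) ℤ.+ (+ p) ℤ.^ k [ (+ p) ℤ.^ suc k ]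
        agree k e = mod-trans (mod-weaken (p^∣ k) e) (ρ≡a k)
        add-multiple : ∀ {N u v} → N ∣ v → u ℤ.+ v ≡ u [ N ]
        add-multiple {N} {u} {v} d = mod (∣-resp (S.solve 2 (λ u v → v S.:= (u S.:+ v) S.:- u) refl u v) d)
          where module S = ℤSolver.+-*-Solver
        exact : ∀ k → a p (suc k) ℤ.+ (+ p) ℤ.^ k ≡ a p k [ (+ p) ℤ.^ k ]
        exact k = mod-trans (add-multiple ℤ∣.∣-refl) (coherent p (here refl) (ℕ.n≤1+n k))
        extend : ∀ {q} k → Comaximal (+ (D ℕ.* E)) (+ q) → Comaximal (+ p) (+ q) → Comaximal (+ (D ℕ.* E ℕ.* p ℕ.^ suc k)) (+ q)
        extend {q} k cm cp = subst (λ z → Comaximal z (+ q)) (sym (pos-*^ (D ℕ.* E) p (suc k)))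
          (comaximal-sym (comaximal-* (comaximal-sym cm) (comaximal-^ (suc k) (comaximal-sym cp))))
        shrink : ∀ k → k ℕ.< L → D ℕ.* p ℕ.^ k ℕ.* product P ℕ.^ L ℕ.≤ D ℕ.* (p ℕ.* product P) ℕ.^ L
        shrink k k<L = ℕ.≤-trans (ℕ.*-monoˡ-≤ (product P ℕ.^ L) (ℕ.*-monoʳ-≤ D (ℕ.^-monoʳ-≤ p {{ℕ.>-nonZero (ℕ.≤-trans (s≤s z≤n) 2≤p)}} (ℕ.<⇒≤ k<L))))
          (ℕ.≤-reflexive (trans (ℕ.*-assoc D _ _) (cong (D ℕ.*_) (sym (Growth.^-distrib-* p (product P) L)))))
        disjoint : ∀ {k l x} → k ℕ.< l → Large (D ℕ.* E ℕ.* p ℕ.^ suc k) (D ℕ.* p ℕ.^ k) (ρ k) P x →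
                   ¬ Large (D ℕ.* E ℕ.* p ℕ.^ suc l) (D ℕ.* p ℕ.^ l) (ρ l) P x
        disjoint {k} {l} {x} k<l (e , _) (e′ , _) = ℕ.<⇒≱ p^k<p^1+k (ℕ∣.∣⇒≤ {{ℕ.>-nonZero (1≤p^ k)}}
          (subst₂ ℕ∣._∣_ (cong ℤ.∣_∣ (pos-^ p (suc k))) (cong ℤ.∣_∣ (pos-^ p k)) (ℤ∣.∣⇒∣ᵤ p^1+k∣p^k)))
          where
          import Data.Nat.Divisibility as ℕ∣
          p^k<p^1+k : p ℕ.^ k ℕ.< p ℕ.^ suc k
          p^k<p^1+k = ℕ.<-≤-trans (ℕ.m<m+n (p ℕ.^ k) (1≤p^ k)) (ℕ.≤-trans (ℕ.≤-reflexive (cong (p ℕ.^ k ℕ.+_) (sym (ℕ.+-identityʳ _)))) (ℕ.*-monoˡ-≤ (p ℕ.^ k) 2≤p))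
          x≡a : x ≡ a p (suc k) [ (+ p) ℤ.^ suc k ]
          x≡a = mod-trans (mod-weaken (^-∣ (+ p) k<l) (mod-trans (mod-weaken (^-∣ (+ p) (ℕ.n≤1+n l)) (agree l e′)) (exact l))) (coherent p (here refl) k<l)
          p^1+k∣p^k : (+ p) ℤ.^ suc k ∣ (+ p) ℤ.^ k
          p^1+k∣p^k = ∣-resp (S.solve 2 (λ u v → (u S.:+ v) S.:- u S.:= v) refl (a p (suc k)) ((+ p) ℤ.^ k))
            (difference (mod-trans (mod-sym (agree k e)) x≡a))
            where module S = ℤSolver.+-*-Solver
        Piece : ℕ → ℤ → Set
        Piece k = Large (D ℕ.* E ℕ.* p ℕ.^ suc k) (D ℕ.* p ℕ.^ k) (ρ k) P
        combine : ∀ x → (∃ λ k → k ℕ.< L × Piece k x) → Large (D ℕ.* E) D r (p ∷ P) x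
        combine x (k , k<L , (e , X₀<x , x≤B , k₀ , D′ , n₀ , t , M≤)) =
          mod-trans (mod-weaken (m∣ k) e) (ρ≡r k) , X₀<x , x≤B , k₀ , p ℕ.^ k ℕ.* D′ , n₀ ,
          mod-trans (mod-weaken (^-∣ (+ p) (ℕ.n≤1+n k)) (agree k e)) (exact k) ∷ t ,
          subst (M ℕ.≤_) (solve 4 (λ d v u d′ → d :* v :* u :* d′ := d :* u :* (v :* d′)) refl D (p ℕ.^ k) (p₀ ℕ.^ k₀) D′) M≤
        piece : ∀ k → k ℕ.< L → Many (Piece k) (L ℕ.^ length P ℕ.* J)
        piece k k<L = lower P (D ℕ.* E ℕ.* p ℕ.^ suc k) (D ℕ.* p ℕ.^ k) (E ℕ.* p) (ρ k)
          (solve 4 (λ d e p q → d :* e :* (p :* q) := d :* q :* (e :* p)) refl D E p (p ℕ.^ k))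
          (ℕ.*-mono-≤ 1≤D (1≤p^ k)) (ℕ.*-mono-≤ 1≤E (ℕ.≤-trans (s≤s z≤n) 2≤p))
          (extend k c (comaximal-sym cp₀p))
          (All.zipWith (λ { ((2≤q , cmq , cp₀q) , cpq) → 2≤q , extend k cmq cpq , cp₀q }) (cs , ps)) pps
          (λ q q∈ → coherent q (there q∈))
          (ℕ.≤-trans (shrink k k<L) D≤M)
          (subst (λ w → X₀ ℕ.+ J ℕ.* (p₀ ℕ.* M ℕ.* w) ℕ.≤ B) (sym (ℕ.*-assoc E p (product P))) bound)
        many : Many (Large (D ℕ.* E) D r (p ∷ P)) (L ℕ.^ length (p ∷ P) ℕ.* J)
        many = subst (Many (Large (D ℕ.* E) D r (p ∷ P))) (sym (ℕ.*-assoc L (L ℕ.^ length P) J))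
          (many-⊆ combine (many-∪ L Piece (L ℕ.^ length P ℕ.* J) piece disjoint))

module NormalizedPart (em : ExcludedMiddle 0ℓ) where
  open Reals em
  open Exponential em
  open Logarithm em
  open Powers em
  open RatioCases em
  open Solver

  opaque
    unfolding _≤_

    ≤ᴿ⇒≤′ : ∀ {X Z X′ Z′} → X ≈ X′ → Z ≈ Z′ → X ≤ᴿ Z → X′ ≤ Z′
    ≤ᴿ⇒≤′ {X} {Z} {X′} {Z′} p q l = ≤-trans {X′} {X} {Z′} (≈⇒≥ {X} {X′} p) (≤-trans {X} {Z} {Z′} l (≈⇒≤ {Z} {Z′} q))

    ≤⇒≤ᴿ′ : ∀ {X Z X′ Z′} → X ≈ X′ → Z ≈ Z′ → X′ ≤ Z′ → X ≤ᴿ Z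
    ≤⇒≤ᴿ′ {X} {Z} {X′} {Z′} p q l = ≤-trans {X} {X′} {Z} (≈⇒≤ {X} {X′} p) (≤-trans {X′} {Z′} {Z} l (≈⇒≥ {Z} {Z′} q))

    *ᴿ-cong : ∀ {x y x′ y′} → x ≈ x′ → y ≈ y′ → x *ᴿ y ≈ x′ * y′
    *ᴿ-cong {x} {y} {x′} {y′} p q = *-cong {x} {x′} {y} {y′} p q

  log-sum : (ℕ → ℕ) → (ℕ → ℝ) → List ℕ → ℝ
  log-sum v r []      = 0#
  log-sum v r (p ∷ S) = ιₙ (v p) * r p * log (ιₙ p) + log-sum v r S

  fromℕ-≈ : ∀ n → fromℕ n ≈ ιₙ n
  fromℕ-≈ n = ≈-reflexive (fromℕ-ιₙ n)

  private
    ÷-≈ : ∀ X d → 1 ℕ.≤ d → ιₙ d * (fromℕ X ÷ d) ≈ ιₙ X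
    ÷-≈ X d 1≤d = ≈-trans (*-cong ≈-refl (≈-reflexive (÷-/ (fromℕ X) d))) (≈-trans (/-inverse (fromℕ X) d {{ℕ.>-nonZero 1≤d}}) (fromℕ-≈ X))

    value-root : ∀ {f S p z} → RatioValue f S p z → Classical.HasRootIn-ℤₚ em f p → 1 ℕ.≤ Classical.R em f p →
                 ιₙ (Classical.R em f p) * z ≈ ιₙ (Classical.Rmax em f S)
    value-root (at-root _)    _ 1≤d = ÷-≈ _ _ 1≤d
    value-root (off-root ¬a) a _  = ⊥-elim (¬a a)

    value-no-root : ∀ {f S p z} → RatioValue f S p z → ¬ Classical.HasRootIn-ℤₚ em f p → z ≈ 1#
    value-no-root (at-root a)    ¬a = ⊥-elim (¬a a)
    value-no-root (off-root _) _  = fromℕ-≈ 1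

  ratio : ℤ[X].Poly → List ℕ → ℕ → ℝ
  ratio f S p = Classical.r em f S p

  ratio-root : ∀ f S p → Classical.HasRootIn-ℤₚ em f p → 1 ℕ.≤ Classical.R em f p →
               ιₙ (Classical.R em f p) * ratio f S p ≈ ιₙ (Classical.Rmax em f S)
  ratio-root f S p root 1≤R = value-root {f} {S} {p} (ratio-value f S p) root 1≤R

  ratio-no-root : ∀ f S p → ¬ Classical.HasRootIn-ℤₚ em f p → ratio f S p ≈ 1#
  ratio-no-root f S p ¬root = value-no-root {f} {S} {p} (ratio-value f S p) ¬root

  valuation : ℤ → ℕ → ℕ
  valuation y p = Classical.v em p y

  -- g and Y are left to be inferred: see raw-power-exp.
  foldr-powers-exp : ∀ {g : ℕ → ℝ → ℝ} {Y : ℕ → ℝ} (v : ℕ → ℕ) (r : ℕ → ℝ) →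
    (∀ p z n → seq (g p z) n ≡ seq (Classical._^ᴿ_ em (fromℕ p) (Y p)) n ℚ.* seq z n) →
    (∀ p n → seq (Y p) n ≡ seq (fromℕ (v p)) n ℚ.* seq (r p) n) →
    ∀ S → All (1 ℕ.≤_) S → foldr g 1ᴿ S ≈ exp (log-sum v r S)
  foldr-powers-exp v r G H [] [] = ≈-trans (fromℕ-≈ 1) (≈-sym exp-0)
  foldr-powers-exp {g} {Y} v r G H (p ∷ S) (1≤p ∷ 1≤S) = ≈-trans (≈-* (g p (foldr g 1ᴿ S)) (Classical._^ᴿ_ em (fromℕ p) (Y p)) (foldr g 1ᴿ S) (G p (foldr g 1ᴿ S)))
    (≈-trans (*-cong (≈-trans (^ᴿ-def (Y p) 0<p′) (exp-cong (*-cong Y≈ (log-cong 0<p′ (fromℕ-≈ p))))) (foldr-powers-exp {g} {Y} v r G H S 1≤S))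
      (≈-sym (exp-+ _ _)))
    where
    0<p′ : 0# < fromℕ p
    0<p′ = <-≤-trans (ιₙ-mono-< 1≤p) (≈⇒≥ (fromℕ-≈ p))
    Y≈ : Y p ≈ ιₙ (v p) * r p
    Y≈ = ≈-trans (≈-* (Y p) (fromℕ (v p)) (r p) (H p)) (*-cong (fromℕ-≈ (v p)) ≈-refl)

  normalizedPart-exp : ∀ f S y → All (1 ℕ.≤_) S → Classical.normalizedPart em f S y ≈ exp (log-sum (valuation y) (ratio f S) S)
  normalizedPart-exp f S y 1≤S = foldr-powers-exp (valuation y) (ratio f S) (λ p z n → refl) (λ p n → refl) S 1≤S

prime≥2 : ∀ {p} → Prime p → 2 ℕ.≤ p
prime≥2 {p} pp = ℕ.nonTrivial⇒n>1 p {{prime⇒nonTrivial pp}}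

module Valuations (em : ExcludedMiddle 0ℓ) where
  open ClassicalChoice em
  open Congruence
  open NormalizedPart em using (valuation)

  private
    k<p^k : ∀ {p} → 2 ℕ.≤ p → ∀ k → k ℕ.< p ℕ.^ k
    k<p^k {p} 2≤p zero    = s≤s z≤n
    k<p^k {p} 2≤p (suc k) = ℕ.≤-trans (ℕ.+-mono-≤ {1} (ℕ.≤-trans (s≤s z≤n) (k<p^k 2≤p k)) (k<p^k 2≤p k))
      (ℕ.≤-trans (ℕ.≤-reflexive (cong (p ℕ.^ k ℕ.+_) (sym (ℕ.+-identityʳ _)))) (ℕ.*-monoˡ-≤ (p ℕ.^ k) 2≤p))

    spec : ∀ {p y} → 2 ℕ.≤ p → 1 ℕ.≤ ℤ.∣ y ∣ → p ℕ.^ valuation y p ℕ∣.∣ ℤ.∣ y ∣ × (∀ k → p ℕ.^ k ℕ∣.∣ ℤ.∣ y ∣ → k ℕ.≤ valuation y p)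
    spec {p} {y} 2≤p 1≤y = largest-spec (λ k → p ℕ.^ k ℕ∣.∣ ℤ.∣ y ∣) {0} (ℕ∣.1∣ ℤ.∣ y ∣) ℤ.∣ y ∣
      λ k d → ℕ.≤-trans (ℕ.<⇒≤ (k<p^k 2≤p k)) (ℕ∣.∣⇒≤ {{ℕ.>-nonZero 1≤y}} d)

  valuation-maximal : ∀ {p y k} → 2 ℕ.≤ p → 1 ℕ.≤ ℤ.∣ y ∣ → (+ p) ℤ.^ k ∣ y → k ℕ.≤ valuation y p
  valuation-maximal {p} {y} {k} 2≤p 1≤y d = proj₂ (spec {p} {y} 2≤p 1≤y) k (subst (ℕ∣._∣ ℤ.∣ y ∣) (cong ℤ.∣_∣ (pos-^ p k)) (ℤ∣.∣⇒∣ᵤ d))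

  valuation-divides : ∀ {p y k} → 2 ℕ.≤ p → 1 ℕ.≤ ℤ.∣ y ∣ → k ℕ.≤ valuation y p → (+ p) ℤ.^ k ∣ y
  valuation-divides {p} {y} {k} 2≤p 1≤y k≤v = ℤ∣.∣-trans (^-∣ (+ p) k≤v)
    (ℤ∣.∣ᵤ⇒∣ (subst (ℕ∣._∣ ℤ.∣ y ∣) (sym (cong ℤ.∣_∣ (pos-^ p (valuation y p)))) (proj₁ (spec {p} {y} 2≤p 1≤y))))

record RootNeighbourhood (Root : Set) (R : ℕ) (y : ℤ → ℤ) (p : ℕ) : Set where
  open Congruence
  field
    roots     : List (ℕ → ℤ)
    N         : ℕ
    coherent  : ∀ {a i k} → a ∈ roots → i ℕ.≤ k → a k ≡ a i [ (+ p) ℤ.^ i ]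
    inhabited : Root → ∃ λ a → a ∈ roots
    close     : ∀ x k → (+ p) ℤ.^ (R ℕ.* k ℕ.+ N) ∣ y x → ∃ λ a → a ∈ roots × x ≡ a k [ (+ p) ℤ.^ k ]
    rootless  : ¬ Root → ∀ x → ¬ (+ p) ℤ.^ N ∣ y x
    center    : ℕ → ℤ
    center-coherent : ∀ {i k} → i ℕ.≤ k → center k ≡ center i [ (+ p) ℤ.^ i ]
    center-deep     : Root → ∀ k x → x ≡ center k [ (+ p) ℤ.^ k ] → (+ p) ℤ.^ (k ℕ.* R) ∣ y x
    R≥1       : Root → 1 ℕ.≤ R

module RootData (em : ExcludedMiddle 0ℓ) (f : ℤ[X].Poly) (n : ℕ) (deg : ℤ[X].HasDegree f n) where
  open Congruence
  open ℤ[X] using (eval)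

  HasRoot : ℕ → Set
  HasRoot p = Classical.HasRootIn-ℤₚ em f p

  R : ℕ → ℕ
  R p = Classical.R em f p

  Neighbourhood : ℕ → Set
  Neighbourhood p = RootNeighbourhood (HasRoot p) (R p) (eval f) p

  neighbourhood : ∀ {p} → Prime p → Neighbourhood p
  neighbourhood {p} pp = build em
    where
    module PR = PadicRoots em pp
    open Padic p using (ℤₚ; approx; fromℤ)
    A = proj₁ (PR.near-root f n deg)
    Nₚ = proj₁ (proj₂ (PR.near-root f n deg))
    all-roots = proj₁ (proj₂ (proj₂ (PR.near-root f n deg)))
    near = proj₂ (proj₂ (proj₂ (PR.near-root f n deg)))
    coh : ∀ (B : List ℤₚ) {a i k} → a ∈ map approx B → i ℕ.≤ k → a k ≡ a i [ (+ p) ℤ.^ i ]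
    coh B a∈ i≤k with ∈-map⁻ approx a∈
    ... | b , _ , refl = PR.approx-mod b i≤k
    R≡ : R p ≡ PR.R f n deg
    R≡ = refl
    near′ : ∀ x k → (+ p) ℤ.^ (R p ℕ.* k ℕ.+ Nₚ) ∣ eval f x → ∃ λ a → a ∈ map approx A × x ≡ a k [ (+ p) ℤ.^ k ]
    near′ x k d = let a , a∈ , e = near x k d in approx a , ∈-map⁺ approx a∈ , e
    build : Dec (HasRoot p) → Neighbourhood p
    build (yes root) = record
      { roots = approx (proj₁ root) ∷ map approx A ; N = Nₚ ; coherent = coh (proj₁ root ∷ A) ; inhabited = λ _ → _ , here refl
      ; close = λ x k d → let a , a∈ , e = near′ x k d in a , there a∈ , e
      ; rootless = λ ¬root → ⊥-elim (¬root root)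
      ; center = approx (proj₁ (PR.max-root f n deg root)) ; center-coherent = PR.approx-mod (proj₁ (PR.max-root f n deg root))
      ; center-deep = λ _ → proj₂ (PR.max-root f n deg root)
      ; R≥1 = λ _ → PR.R≥1 f n deg (proj₂ root) }
    build (no ¬root) = record
      { roots = map approx A ; N = Nₚ ; coherent = coh A ; inhabited = λ root → ⊥-elim (¬root root)
      ; close = near′
      ; rootless = λ _ x d → let a , a∈ , _ = near x 0 (subst (λ i → (+ p) ℤ.^ (i ℕ.+ Nₚ) ∣ eval f x) (sym (ℕ.*-zeroʳ (R p))) d)
                             in ¬root (a , All.lookup all-roots a∈)
      ; center = λ _ → 0ℤ ; center-coherent = λ _ → mod-refl
      ; center-deep = λ root → ⊥-elim (¬root root) ; R≥1 = λ root → ⊥-elim (¬root root) }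

  open RootNeighbourhood

  private
    roots-of : ∀ {p} → Dec (Prime p) → List (ℕ → ℤ)
    roots-of (yes pp) = roots (neighbourhood pp)
    roots-of (no _)   = []

    center-of : ∀ {p} → Dec (Prime p) → ℕ → ℤ
    center-of (yes pp) = center (neighbourhood pp)
    center-of (no _)   = λ _ → 0ℤ

  root-list : ℕ → List (ℕ → ℤ)
  root-list p = roots-of (prime? p)

  root-center : ℕ → ℕ → ℤ
  root-center p = center-of (prime? p)

  root-list-coherent : ∀ {p a i k} → a ∈ root-list p → i ℕ.≤ k → a k ≡ a i [ (+ p) ℤ.^ i ]
  root-list-coherent {p} = go (prime? p)
    where
    go : ∀ (d : Dec (Prime p)) {a i k} → a ∈ roots-of d → i ℕ.≤ k → a k ≡ a i [ (+ p) ℤ.^ i ]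
    go (yes pp) = coherent (neighbourhood pp)
    go (no _) ()

  root-center-coherent : ∀ p {i k} → i ℕ.≤ k → root-center p k ≡ root-center p i [ (+ p) ℤ.^ i ]
  root-center-coherent p = go (prime? p)
    where
    go : ∀ (d : Dec (Prime p)) {i k} → i ℕ.≤ k → center-of d k ≡ center-of d i [ (+ p) ℤ.^ i ]
    go (yes pp) = center-coherent (neighbourhood pp)
    go (no _) _ = mod-refl

  root-list-spec : ∀ {p} → Prime p → ∃ λ N → (HasRoot p → ∃ λ a → a ∈ root-list p) ×
    (∀ x k → (+ p) ℤ.^ (R p ℕ.* k ℕ.+ N) ∣ eval f x → ∃ λ a → a ∈ root-list p × x ≡ a k [ (+ p) ℤ.^ k ]) ×
    (¬ HasRoot p → ∀ x → ¬ (+ p) ℤ.^ N ∣ eval f x)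
  root-list-spec {p} pp = go (prime? p)
    where
    go : ∀ (d : Dec (Prime p)) → ∃ λ N → (HasRoot p → ∃ λ a → a ∈ roots-of d) ×
      (∀ x k → (+ p) ℤ.^ (R p ℕ.* k ℕ.+ N) ∣ eval f x → ∃ λ a → a ∈ roots-of d × x ≡ a k [ (+ p) ℤ.^ k ]) ×
      (¬ HasRoot p → ∀ x → ¬ (+ p) ℤ.^ N ∣ eval f x)
    go (yes qq) = let nb = neighbourhood qq in N nb , inhabited nb , close nb , rootless nb
    go (no ¬pp) = ⊥-elim (¬pp pp)

  root-center-deep : ∀ {p} → Prime p → HasRoot p → ∀ k x → x ≡ root-center p k [ (+ p) ℤ.^ k ] → (+ p) ℤ.^ (k ℕ.* R p) ∣ eval f x
  root-center-deep {p} pp = go (prime? p)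
    where
    go : ∀ (d : Dec (Prime p)) → HasRoot p → ∀ k x → x ≡ center-of d k [ (+ p) ℤ.^ k ] → (+ p) ℤ.^ (k ℕ.* R p) ∣ eval f x
    go (yes qq) = center-deep (neighbourhood qq)
    go (no ¬pp) = ⊥-elim (¬pp pp)

  R-positive : ∀ {p} → Prime p → HasRoot p → 1 ℕ.≤ R p
  R-positive pp = R≥1 (neighbourhood pp)

module LogSumBounds (em : ExcludedMiddle 0ℓ) (f : ℤ[X].Poly) (n : ℕ) (deg : ℤ[X].HasDegree f n) (S : List ℕ) where
  open Congruence
  open ℤ[X] using (eval)
  open RootData em f n deg
  open Valuations em
  open NormalizedPart em
  open Counting em using (Tuple; []; _∷_; tuple≥1)
  open Reals em
  open Logarithm em
  open Solver
  open ≤-Reasoning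

  Rₘ : ℕ
  Rₘ = Classical.Rmax em f S

  with-root : List ℕ → List ℕ
  with-root T = Classical.primesWithRoot em f T

  NearRoot NearCenter : ℕ → ℕ → ℤ → Set
  NearRoot p k x = ∃ λ a → a ∈ root-list p × x ≡ a k [ (+ p) ℤ.^ k ]
  NearCenter p k x = x ≡ root-center p k [ (+ p) ℤ.^ k ]

  with-root-accept : ∀ {p T} → HasRoot p → with-root (p ∷ T) ≡ p ∷ with-root T
  with-root-accept root = List.filter-accept (λ p → em) root

  with-root-reject : ∀ {p T} → ¬ HasRoot p → with-root (p ∷ T) ≡ with-root T
  with-root-reject ¬root = List.filter-reject (λ p → em) ¬root

  0≤log : ∀ {p} → 1 ℕ.≤ p → 0# ≤ log (ιₙ p)
  0≤log 1≤p = ≥1⇒0≤log (ιₙ-mono 1≤p)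

  log-^* : ∀ {p D} k → 1 ℕ.≤ p → 1 ℕ.≤ D → log (ιₙ (p ℕ.^ k ℕ.* D)) ≈ ιₙ k * log (ιₙ p) + log (ιₙ D)
  log-^* {p} {D} k 1≤p 1≤D = ≈-trans (log-cong 0<pD (≈-trans (ιₙ-* (p ℕ.^ k) D) (*-cong (ιₙ-^ p k) ≈-refl)))
    (≈-trans (log-* (^-pos k 0<p) (ιₙ-mono-< 1≤D)) (+-cong (log-^ k 0<p) ≈-refl))
    where
    0<p = ιₙ-mono-< 1≤p
    0<pD : 0# < ιₙ (p ℕ.^ k ℕ.* D)
    0<pD = ιₙ-mono-< (ℕ.*-mono-≤ (ℕ.m^n>0 p {{ℕ.>-nonZero 1≤p}} k) 1≤D)

  private
    module Ratio {R X : ℕ} {r l : ℝ} (Rr≈X : ιₙ R * r ≈ ιₙ X) (1≤R : 1 ℕ.≤ R) (0≤l : 0# ≤ l) where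
      0≤r : 0# ≤ r
      0≤r = *-cancelˡ-≤ (ιₙ-mono-< 1≤R) (≤-trans (≈⇒≤ (solve 1 (λ a → a :* con (+ 0) := con (+ 0)) ≈-refl (ιₙ R))) (≤-trans (0≤ιₙ X) (≈⇒≥ Rr≈X)))

      upper : ∀ {v k N} → v ℕ.≤ R ℕ.* suc k ℕ.+ N → ιₙ v * r * l ≤ ιₙ X * (ιₙ k * l) + (ιₙ X + ιₙ N * r) * l
      upper {v} {k} {N} v≤ = begin
        ιₙ v * r * l                                       ≤⟨ *-monoˡ-≤ 0≤l (*-monoˡ-≤ 0≤r (ιₙ-mono v≤)) ⟩
        ιₙ (R ℕ.* suc k ℕ.+ N) * r * l                     ≈⟨ *-cong (*-cong (≈-trans (ιₙ-+ _ N) (+-cong (≈-trans (ιₙ-* R (suc k)) (*-cong ≈-refl (ιₙ-suc k))) ≈-refl)) ≈-refl) ≈-refl ⟩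
        (ιₙ R * (1# + ιₙ k) + ιₙ N) * r * l                ≈⟨ solve 5 (λ R k N r l → (R :* (con (+ 1) :+ k) :+ N) :* r :* l := (R :* r) :* (k :* l) :+ ((R :* r) :+ N :* r) :* l) ≈-refl (ιₙ R) (ιₙ k) (ιₙ N) r l ⟩
        (ιₙ R * r) * (ιₙ k * l) + ((ιₙ R * r) + ιₙ N * r) * l  ≈⟨ +-cong (*-cong Rr≈X ≈-refl) (*-cong (+-cong Rr≈X ≈-refl) ≈-refl) ⟩
        ιₙ X * (ιₙ k * l) + (ιₙ X + ιₙ N * r) * l          ∎

      lower : ∀ {v k} → k ℕ.* R ℕ.≤ v → ιₙ X * (ιₙ k * l) ≤ ιₙ v * r * l
      lower {v} {k} kR≤v = begin
        ιₙ X * (ιₙ k * l)               ≈⟨ *-cong (≈-sym Rr≈X) ≈-refl ⟩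
        (ιₙ R * r) * (ιₙ k * l)         ≈⟨ solve 4 (λ R r k l → (R :* r) :* (k :* l) := (k :* R) :* r :* l) ≈-refl (ιₙ R) r (ιₙ k) l ⟩
        (ιₙ k * ιₙ R) * r * l           ≈⟨ *-cong (*-cong (≈-sym (ιₙ-* k R)) ≈-refl) ≈-refl ⟩
        ιₙ (k ℕ.* R) * r * l            ≤⟨ *-monoˡ-≤ 0≤l (*-monoˡ-≤ 0≤r (ιₙ-mono kR≤v)) ⟩
        ιₙ v * r * l                    ∎

  Σlog : ℤ → List ℕ → ℝ
  Σlog x T = log-sum (valuation (eval f x)) (ratio f S) T

  UpperBound : List ℕ → List ℕ → ℕ → Set
  UpperBound T P C = ∀ x → 1 ℕ.≤ ℤ.∣ eval f x ∣ → ∃ λ D → 1 ℕ.≤ D × Tuple NearRoot x P D × Σlog x T ≤ ιₙ Rₘ * log (ιₙ D) + ιₙ C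

  private
    exponent : ∀ {p} → Prime p → HasRoot p → ∃ λ N → ∀ x → 1 ℕ.≤ ℤ.∣ eval f x ∣ → ∃ λ k → NearRoot p k x × valuation (eval f x) p ℕ.≤ R p ℕ.* suc k ℕ.+ N
    exponent {p} pp root =
      let N , inh , close , _ = root-list-spec pp in N , λ x 1≤y → choose N (inh root) close x 1≤y (N ℕ.≤? valuation (eval f x) p)
      where
      instance
        R≢0 : ℕ.NonZero (R p)
        R≢0 = ℕ.>-nonZero (R-positive pp root)
      choose : ∀ N → (∃ λ a → a ∈ root-list p) → (∀ x k → (+ p) ℤ.^ (R p ℕ.* k ℕ.+ N) ∣ eval f x → NearRoot p k x) →
               ∀ x → 1 ℕ.≤ ℤ.∣ eval f x ∣ → Dec (N ℕ.≤ valuation (eval f x) p) → ∃ λ k → NearRoot p k x × valuation (eval f x) p ℕ.≤ R p ℕ.* suc k ℕ.+ N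
      choose N (a , a∈) close x 1≤y (no N≰v) = 0 , (a , a∈ , mod (1∣ _)) , ℕ.≤-trans (ℕ.<⇒≤ (ℕ.≰⇒> N≰v)) (ℕ.m≤n+m N _)
      choose N _ close x 1≤y (yes N≤v) = k , close x k (valuation-divides (prime≥2 pp) 1≤y low) , high
        where
        v = valuation (eval f x) p
        k = (v ℕ.∸ N) ℕ./ R p
        v≡ : v ≡ (v ℕ.∸ N) ℕ.% R p ℕ.+ k ℕ.* R p ℕ.+ N
        v≡ = trans (sym (ℕ.m∸n+n≡m N≤v)) (cong (ℕ._+ N) (ℕ.m≡m%n+[m/n]*n (v ℕ.∸ N) (R p)))
        low : R p ℕ.* k ℕ.+ N ℕ.≤ v
        low = subst (R p ℕ.* k ℕ.+ N ℕ.≤_) (sym v≡) (ℕ.+-monoˡ-≤ N (ℕ.≤-trans (ℕ.≤-reflexive (ℕ.*-comm (R p) k)) (ℕ.m≤n+m _ _)))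
        high : v ℕ.≤ R p ℕ.* suc k ℕ.+ N
        high = subst (ℕ._≤ R p ℕ.* suc k ℕ.+ N) (sym v≡) (ℕ.+-monoˡ-≤ N
          (ℕ.≤-trans (ℕ.+-monoˡ-≤ (k ℕ.* R p) (ℕ.<⇒≤ (ℕ.m%n<n (v ℕ.∸ N) (R p)))) (ℕ.≤-reflexive (ℕ.*-comm (suc k) (R p)))))

  Σlog-upper : ∀ T → All Prime T → ∃ (UpperBound T (with-root T))
  Σlog-upper [] [] = 0 , λ x _ → 1 , ℕ.≤-refl , [] , ≤-trans (≈⇒≥ (+-identityʳ 0#)) (+-mono-≤ (*-nonNeg (0≤ιₙ Rₘ) (0≤log ℕ.≤-refl)) ≤-refl)
  Σlog-upper (p ∷ T) (pp ∷ pT) = go (Σlog-upper T pT) em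
    where
    1≤p = ℕ.≤-trans (s≤s z≤n) (prime≥2 pp)
    go : ∃ (UpperBound T (with-root T)) → Dec (HasRoot p) → ∃ (UpperBound (p ∷ T) (with-root (p ∷ T)))
    go (C , ih) (yes root) =
      let N , expo = exponent pp root
          c , c≥ = ≤-archimedean-ℝ ((ιₙ Rₘ + ιₙ N * ratio f S p) * log (ιₙ p))
      in c ℕ.+ C , subst (λ P → UpperBound (p ∷ T) P (c ℕ.+ C)) (sym (with-root-accept {p} {T} root)) λ x 1≤y →
        let k , near , v≤ = expo x 1≤y
            D , 1≤D , t , b = ih x 1≤y
        in p ℕ.^ k ℕ.* D , ℕ.*-mono-≤ (ℕ.m^n>0 p {{ℕ.>-nonZero 1≤p}} k) 1≤D , near ∷ t , (begin
          ιₙ (valuation (eval f x) p) * ratio f S p * log (ιₙ p) + Σlog x T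
            ≤⟨ +-mono-≤ (Ratio.upper (ratio-root f S p root (R-positive pp root)) (R-positive pp root) (0≤log 1≤p) v≤) b ⟩
          (ιₙ Rₘ * (ιₙ k * log (ιₙ p)) + (ιₙ Rₘ + ιₙ N * ratio f S p) * log (ιₙ p)) + (ιₙ Rₘ * log (ιₙ D) + ιₙ C)
            ≤⟨ +-monoˡ-≤ _ (+-monoʳ-≤ _ c≥) ⟩
          (ιₙ Rₘ * (ιₙ k * log (ιₙ p)) + ιₙ c) + (ιₙ Rₘ * log (ιₙ D) + ιₙ C)
            ≈⟨ solve 5 (λ X a c d C → (X :* a :+ c) :+ (X :* d :+ C) := X :* (a :+ d) :+ (c :+ C)) ≈-refl (ιₙ Rₘ) (ιₙ k * log (ιₙ p)) (ιₙ c) (log (ιₙ D)) (ιₙ C) ⟩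
          ιₙ Rₘ * (ιₙ k * log (ιₙ p) + log (ιₙ D)) + (ιₙ c + ιₙ C)
            ≈⟨ +-cong (*-cong ≈-refl (≈-sym (log-^* k 1≤p 1≤D))) (≈-sym (ιₙ-+ c C)) ⟩
          ιₙ Rₘ * log (ιₙ (p ℕ.^ k ℕ.* D)) + ιₙ (c ℕ.+ C) ∎)
    go (C , ih) (no ¬root) =
      let N , _ , _ , rootless = root-list-spec pp
          c , c≥ = ≤-archimedean-ℝ (ιₙ N * log (ιₙ p))
      in c ℕ.+ C , subst (λ P → UpperBound (p ∷ T) P (c ℕ.+ C)) (sym (with-root-reject {p} {T} ¬root)) λ x 1≤y →
        let D , 1≤D , t , b = ih x 1≤y
            v≤N = ℕ.<⇒≤ (ℕ.≰⇒> λ N≤v → rootless ¬root x (valuation-divides (prime≥2 pp) 1≤y N≤v))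
        in D , 1≤D , t , (begin
          ιₙ (valuation (eval f x) p) * ratio f S p * log (ιₙ p) + Σlog x T
            ≈⟨ +-cong (*-cong (≈-trans (*-cong ≈-refl (ratio-no-root f S p ¬root)) (solve 1 (λ v → v :* con (+ 1) := v) ≈-refl _)) ≈-refl) ≈-refl ⟩
          ιₙ (valuation (eval f x) p) * log (ιₙ p) + Σlog x T
            ≤⟨ +-mono-≤ (≤-trans (*-monoˡ-≤ (0≤log 1≤p) (ιₙ-mono v≤N)) c≥) b ⟩
          ιₙ c + (ιₙ Rₘ * log (ιₙ D) + ιₙ C)
            ≈⟨ solve 3 (λ c d C → c :+ (d :+ C) := d :+ (c :+ C)) ≈-refl (ιₙ c) (ιₙ Rₘ * log (ιₙ D)) (ιₙ C) ⟩
          ιₙ Rₘ * log (ιₙ D) + (ιₙ c + ιₙ C)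
            ≈⟨ +-cong ≈-refl (≈-sym (ιₙ-+ c C)) ⟩
          ιₙ Rₘ * log (ιₙ D) + ιₙ (c ℕ.+ C) ∎)

  LowerBound : List ℕ → List ℕ → Set
  LowerBound T P = ∀ x D → 1 ℕ.≤ ℤ.∣ eval f x ∣ → Tuple NearCenter x P D → 1 ℕ.≤ D × ιₙ Rₘ * log (ιₙ D) ≤ Σlog x T

  Σlog-lower : ∀ T → All Prime T → LowerBound T (with-root T)
  Σlog-lower [] [] x .1 1≤y [] = ℕ.≤-refl , ≈⇒≤ (≈-trans (*-cong ≈-refl log-1) (solve 1 (λ a → a :* con (+ 0) := con (+ 0)) ≈-refl (ιₙ Rₘ)))
  Σlog-lower (p ∷ T) (pp ∷ pT) = go (Σlog-lower T pT) em
    where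
    1≤p = ℕ.≤-trans (s≤s z≤n) (prime≥2 pp)
    go : LowerBound T (with-root T) → Dec (HasRoot p) → LowerBound (p ∷ T) (with-root (p ∷ T))
    go ih (yes root) = subst (LowerBound (p ∷ T)) (sym (with-root-accept {p} {T} root)) step
      where
      step : LowerBound (p ∷ T) (p ∷ with-root T)
      step x _ 1≤y (_∷_ {k = k} {D = D} near t) = let 1≤D , b = ih x D 1≤y t in
        ℕ.*-mono-≤ (ℕ.m^n>0 p {{ℕ.>-nonZero 1≤p}} k) 1≤D , (begin
          ιₙ Rₘ * log (ιₙ (p ℕ.^ k ℕ.* D))                          ≈⟨ *-cong ≈-refl (log-^* k 1≤p 1≤D) ⟩
          ιₙ Rₘ * (ιₙ k * log (ιₙ p) + log (ιₙ D))                  ≈⟨ distribˡ _ _ _ ⟩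
          ιₙ Rₘ * (ιₙ k * log (ιₙ p)) + ιₙ Rₘ * log (ιₙ D)          ≤⟨ +-mono-≤ (Ratio.lower (ratio-root f S p root (R-positive pp root)) (R-positive pp root) (0≤log 1≤p)
                                                                         (valuation-maximal (prime≥2 pp) 1≤y (root-center-deep pp root k x near))) b ⟩
          ιₙ (valuation (eval f x) p) * ratio f S p * log (ιₙ p) + Σlog x T  ∎)
    go ih (no ¬root) = subst (LowerBound (p ∷ T)) (sym (with-root-reject {p} {T} ¬root)) λ x D 1≤y t → let 1≤D , b = ih x D 1≤y t in
      1≤D , ≤-trans b (≤-trans (≈⇒≥ (+-identityˡ _)) (+-monoˡ-≤ _ (*-nonNeg (*-nonNeg (0≤ιₙ _)
        (≤-trans 0≤1 (≈⇒≥ (ratio-no-root f S p ¬root)))) (0≤log 1≤p))))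

module Estimates (em : ExcludedMiddle 0ℓ) (f : ℤ[X].Poly) (n : ℕ) (deg : ℤ[X].HasDegree f n) (1≤n : 1 ℕ.≤ n)
  (S : List ℕ) (primes : All Prime S) (p₀ : ℕ) (P : List ℕ)
  (with-root≡ : LogSumBounds.with-root em f n deg S S ≡ p₀ ∷ P) (2≤p₀ : 2 ℕ.≤ p₀)
  (coprime : All (λ p → 2 ℕ.≤ p × Congruence.Comaximal (+ 1) (+ p) × Congruence.Comaximal (+ p₀) (+ p)) P)
  (coprimes : AllPairs (λ p q → Congruence.Comaximal (+ p) (+ q)) P)
  (ε α : ℝ) where

  open ClassicalChoice em
  open Congruence
  open ℤ[X] using (eval)
  open RootData em f n deg
  open LogSumBounds em f n deg S
  open Counting em
  open Reals em
  open Exponential em using (exp)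
  open Logarithm em
  open Solver
  open ≤-Reasoning

  s : ℕ
  s = length P

  β : ℝ
  β = 1# - α

  Counted : ℤ → Set
  Counted x = 1 ℕ.≤ ℤ.∣ eval f x ∣ × ε * log (ιₙ ℤ.∣ eval f x ∣) ≤ Σlog x S

  ^-cong : ∀ {x y} k → x ≈ y → x ^ k ≈ y ^ k
  ^-cong zero    _ = ≈-refl
  ^-cong (suc k) e = *-cong e (^-cong k e)

  ≥1⇒1≤^ : ∀ {x} k → 1# ≤ x → 1# ≤ x ^ k
  ≥1⇒1≤^ zero    _ = ≤-refl
  ≥1⇒1≤^ (suc k) p = ≤-trans (≈⇒≥ (*-identityˡ 1#)) (*-mono-≤ 0≤1 (≤-trans 0≤1 (≥1⇒1≤^ k p)) p (≥1⇒1≤^ k p))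

  x≤ιₙa*x : ∀ {a x} → 1 ℕ.≤ a → 0# ≤ x → x ≤ ιₙ a * x
  x≤ιₙa*x {a} {x} 1≤a 0≤x = ≤-trans (≈⇒≥ (*-identityˡ x)) (*-monoˡ-≤ 0≤x (ιₙ-mono 1≤a))

  module _ (0≤ε : 0# ≤ ε) (0<α : 0# < α) (0<β : 0# < β) (1≤Rₘ : 1 ℕ.≤ Rₘ) (Rα≈nε : ιₙ Rₘ * α ≈ ιₙ n * ε) where

    private
      lg2 : ℝ
      lg2 = log (ιₙ 2)

      0<lg2 : 0# < lg2
      0<lg2 = exp-cancel-< (≤-<-trans (≈⇒≤ exp-0) (<-≤-trans (ιₙ-mono-< {1} {2} ℕ.≤-refl) (≈⇒≥ (exp-log (ιₙ-mono-< {0} {2} (s≤s z≤n))))))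

      exp-lg2 : exp lg2 ≈ ιₙ 2
      exp-lg2 = exp-log (ιₙ-mono-< {0} {2} (s≤s z≤n))

      f-lower : ∃ λ c → 1 ℕ.≤ c × (∀ x → 1 ℕ.≤ ℤ.∣ x ∣ → 1 ℕ.≤ ℤ.∣ eval f x ∣ → ℤ.∣ x ∣ ℕ.^ n ℕ.≤ c ℕ.* ℤ.∣ eval f x ∣)
      f-lower = let c , X₀ , h = Growth.eval-lower f n deg in
        suc (c ℕ.+ X₀ ℕ.^ n) , s≤s z≤n , λ x 1≤x 1≤y → choose c X₀ h x 1≤x 1≤y (X₀ ℕ.≤? ℤ.∣ x ∣)
        where
        choose : ∀ c X₀ → (∀ x → X₀ ℕ.≤ ℤ.∣ x ∣ → 1 ℕ.≤ ℤ.∣ x ∣ → ℤ.∣ x ∣ ℕ.^ n ℕ.≤ c ℕ.* ℤ.∣ eval f x ∣) →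
                 ∀ x → 1 ℕ.≤ ℤ.∣ x ∣ → 1 ℕ.≤ ℤ.∣ eval f x ∣ → Dec (X₀ ℕ.≤ ℤ.∣ x ∣) → ℤ.∣ x ∣ ℕ.^ n ℕ.≤ suc (c ℕ.+ X₀ ℕ.^ n) ℕ.* ℤ.∣ eval f x ∣
        choose c X₀ h x 1≤x 1≤y (yes p) = ℕ.≤-trans (h x p 1≤x) (ℕ.*-monoˡ-≤ ℤ.∣ eval f x ∣ (ℕ.≤-trans (ℕ.m≤m+n c _) (ℕ.n≤1+n _)))
        choose c X₀ h x 1≤x 1≤y (no ¬p) = ℕ.≤-trans (ℕ.^-monoˡ-≤ n (ℕ.<⇒≤ (ℕ.≰⇒> ¬p)))
          (ℕ.≤-trans (ℕ.≤-trans (ℕ.m≤n+m _ c) (ℕ.n≤1+n _)) (ℕ.m≤m*n _ ℤ.∣ eval f x ∣ {{ℕ.>-nonZero 1≤y}}))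

      log-ιₙ-* : ∀ {a b} → 1 ℕ.≤ a → 1 ℕ.≤ b → log (ιₙ (a ℕ.* b)) ≈ log (ιₙ a) + log (ιₙ b)
      log-ιₙ-* {a} {b} 1≤a 1≤b = ≈-trans (log-cong (ιₙ-mono-< (ℕ.*-mono-≤ 1≤a 1≤b)) (ιₙ-* a b)) (log-* (ιₙ-mono-< 1≤a) (ιₙ-mono-< 1≤b))

      log-ιₙ-^ : ∀ {a} k → 1 ℕ.≤ a → log (ιₙ (a ℕ.^ k)) ≈ ιₙ k * log (ιₙ a)
      log-ιₙ-^ {a} k 1≤a = ≈-trans (log-cong (ιₙ-mono-< (ℕ.m^n>0 a {{ℕ.>-nonZero 1≤a}} k)) (ιₙ-^ a k)) (log-^ k (ιₙ-mono-< 1≤a))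

      cancel-Rₘ : ∀ {a d c} → 0# ≤ c → ιₙ Rₘ * a ≤ ιₙ Rₘ * d + c → a ≤ d + c
      cancel-Rₘ {a} {d} {c} 0≤c p = *-cancelˡ-≤ (ιₙ-mono-< 1≤Rₘ) (≤-trans p (≤-trans (+-monoʳ-≤ _ (x≤ιₙa*x 1≤Rₘ 0≤c)) (≈⇒≥ (distribˡ _ _ _))))

      large-tuple : ∃ λ K → 1 ℕ.≤ K × (∀ x → 1 ℕ.≤ ℤ.∣ x ∣ → Counted x →
        ∃ λ D → Tuple NearRoot x (p₀ ∷ P) D × exp (α * log (ιₙ ℤ.∣ x ∣)) ≤ ιₙ K * ιₙ D)
      large-tuple =
        let c , 1≤c , fl = f-lower
            C , up = Σlog-upper S primes
            C₂ , C₂≥ = ≤-archimedean-ℝ (ε * log (ιₙ c) + ιₙ C)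
            K , K≥ = ≤-archimedean-ℝ (exp (ιₙ C₂))
        in suc K , s≤s z≤n , λ x 1≤x (1≤y , counted) →
          let D , 1≤D , t , b = up x 1≤y
              y = ℤ.∣ eval f x ∣
              step : ιₙ n * log (ιₙ ℤ.∣ x ∣) ≤ log (ιₙ c) + log (ιₙ y)
              step = begin
                ιₙ n * log (ιₙ ℤ.∣ x ∣)        ≈⟨ ≈-sym (log-ιₙ-^ n 1≤x) ⟩
                log (ιₙ (ℤ.∣ x ∣ ℕ.^ n))       ≤⟨ log-mono (ιₙ-mono-< (ℕ.m^n>0 ℤ.∣ x ∣ {{ℕ.>-nonZero 1≤x}} n)) (ιₙ-mono (fl x 1≤x 1≤y)) ⟩
                log (ιₙ (c ℕ.* y))             ≈⟨ log-ιₙ-* 1≤c 1≤y ⟩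
                log (ιₙ c) + log (ιₙ y)        ∎
              main : α * log (ιₙ ℤ.∣ x ∣) ≤ log (ιₙ D) + ιₙ C₂
              main = cancel-Rₘ (0≤ιₙ C₂) (begin
                ιₙ Rₘ * (α * log (ιₙ ℤ.∣ x ∣))              ≈⟨ ≈-trans (≈-sym (*-assoc _ _ _)) (≈-trans (*-cong Rα≈nε ≈-refl) (solve 3 (λ n e l → n :* e :* l := e :* (n :* l)) ≈-refl (ιₙ n) ε (log (ιₙ ℤ.∣ x ∣)))) ⟩
                ε * (ιₙ n * log (ιₙ ℤ.∣ x ∣))               ≤⟨ *-monoʳ-≤ 0≤ε step ⟩
                ε * (log (ιₙ c) + log (ιₙ y))               ≈⟨ distribˡ _ _ _ ⟩
                ε * log (ιₙ c) + ε * log (ιₙ y)             ≤⟨ +-monoʳ-≤ _ (≤-trans counted b) ⟩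
                ε * log (ιₙ c) + (ιₙ Rₘ * log (ιₙ D) + ιₙ C) ≈⟨ solve 3 (λ a d c → a :+ (d :+ c) := d :+ (a :+ c)) ≈-refl (ε * log (ιₙ c)) (ιₙ Rₘ * log (ιₙ D)) (ιₙ C) ⟩
                ιₙ Rₘ * log (ιₙ D) + (ε * log (ιₙ c) + ιₙ C) ≤⟨ +-monoʳ-≤ _ C₂≥ ⟩
                ιₙ Rₘ * log (ιₙ D) + ιₙ C₂                  ∎)
          in D , subst (λ P → Tuple NearRoot x P D) with-root≡ t , (begin
            exp (α * log (ιₙ ℤ.∣ x ∣))          ≤⟨ exp-mono main ⟩
            exp (log (ιₙ D) + ιₙ C₂)            ≈⟨ exp-+ _ _ ⟩
            exp (log (ιₙ D)) * exp (ιₙ C₂)      ≤⟨ *-mono-≤ (0≤exp _) (0≤ιₙ (suc K)) (≈⇒≤ (exp-log (ιₙ-mono-< 1≤D))) (≤-trans K≥ (ιₙ-mono (ℕ.n≤1+n K))) ⟩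
            ιₙ D * ιₙ (suc K)                   ≈⟨ *-comm _ _ ⟩
            ιₙ (suc K) * ιₙ D                   ∎)

      K : ℕ
      K = proj₁ large-tuple

      φ θ : ℝ
      φ = exp (α * lg2)
      θ = exp (β * lg2)

      φθ : ∀ j → φ ^ j * θ ^ j ≈ ιₙ (2 ℕ.^ j)
      φθ j = begin-equality
        φ ^ j * θ ^ j              ≈⟨ ≈-sym (*-^ φ θ j) ⟩
        (φ * θ) ^ j                ≈⟨ ^-cong j (≈-trans (≈-sym (exp-+ _ _)) (≈-trans (exp-cong (solve 2 (λ a l → a :* l :+ (con (+ 1) :- a) :* l := l) ≈-refl α lg2)) exp-lg2)) ⟩
        ιₙ 2 ^ j                   ≈⟨ ≈-sym (ιₙ-^ 2 j) ⟩
        ιₙ (2 ℕ.^ j)               ∎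

      0<φ^ : ∀ j → 0# < φ ^ j
      0<φ^ j = ^-pos j (exp-pos _)

      1≤θ : 1# ≤ θ
      1≤θ = 0≤⇒1≤exp (*-nonNeg (<⇒≤ 0<β) (<⇒≤ 0<lg2))

      1≤θ^ : ∀ j → 1# ≤ θ ^ j
      1≤θ^ j = ≥1⇒1≤^ j 1≤θ

      0≤θ^ : ∀ j → 0# ≤ θ ^ j
      0≤θ^ j = ≤-trans 0≤1 (1≤θ^ j)

      threshold : ∀ j → ∃ λ M → φ ^ j ≤ ιₙ K * ιₙ M × (∀ m → φ ^ j ≤ ιₙ K * ιₙ m → M ℕ.≤ m)
      threshold j = minimum (λ M → φ ^ j ≤ ιₙ K * ιₙ M) (2 ℕ.^ j) (begin
        φ ^ j                      ≈⟨ solve 1 (λ a → a := a :* con (+ 1)) ≈-refl (φ ^ j) ⟩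
        φ ^ j * 1#                 ≤⟨ *-monoʳ-≤ (<⇒≤ (0<φ^ j)) (1≤θ^ j) ⟩
        φ ^ j * θ ^ j              ≈⟨ φθ j ⟩
        ιₙ (2 ℕ.^ j)               ≤⟨ x≤ιₙa*x (proj₁ (proj₂ large-tuple)) (0≤ιₙ _) ⟩
        ιₙ K * ιₙ (2 ℕ.^ j)        ∎)

      CA : ℕ
      CA = product (map (λ p → length (root-list p)) (p₀ ∷ P))

      Shell : ℕ → ℤ → Set
      Shell j x = Counted x × 2 ℕ.^ j ℕ.< ℤ.∣ x ∣ × ℤ.∣ x ∣ ℕ.≤ 2 ℕ.^ suc j

      size : ℕ → ℕ → ℕ
      size j h = suc j ℕ.^ s ℕ.* (CA ℕ.* (suc h ℕ.+ suc h))

      shell-cover : ∀ j → ∃ λ h → Cover (Shell j) (size j h) × ιₙ h ≤ ιₙ (4 ℕ.* K) * θ ^ j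
      shell-cover j = build (threshold j)
        where
        build : (∃ λ M → φ ^ j ≤ ιₙ K * ιₙ M × (∀ m → φ ^ j ≤ ιₙ K * ιₙ m → M ℕ.≤ m)) → ∃ λ h → Cover (Shell j) (size j h) × ιₙ h ≤ ιₙ (4 ℕ.* K) * θ ^ j
        build (zero , large , _) = ⊥-elim (<⇒≱ (0<φ^ j) (≤-trans large (≈⇒≤ (solve 1 (λ a → a :* con (+ 0) := con (+ 0)) ≈-refl (ιₙ K)))))
        build (M@(suc _) , large , least) = h , cover-⊆ shell⇒large (subst (Cover _) (U.capacity-≡ P) (U.upper P 1 (λ x → ℤ.∣ x ∣ ℕ.≤ 2 ℕ.^ suc j) ℕ.≤-refl
            (comaximal-1 _) coprime coprimes (λ _ b → b) (λ x y _ _ → mod (1∣ _)))) , small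
          where
          M≤2^j : M ℕ.≤ 2 ℕ.^ j
          M≤2^j = least (2 ℕ.^ j) (begin
            φ ^ j                      ≈⟨ solve 1 (λ a → a := a :* con (+ 1)) ≈-refl (φ ^ j) ⟩
            φ ^ j * 1#                 ≤⟨ *-monoʳ-≤ (<⇒≤ (0<φ^ j)) (1≤θ^ j) ⟩
            φ ^ j * θ ^ j              ≈⟨ φθ j ⟩
            ιₙ (2 ℕ.^ j)               ≤⟨ x≤ιₙa*x (proj₁ (proj₂ large-tuple)) (0≤ιₙ _) ⟩
            ιₙ K * ιₙ (2 ℕ.^ j)        ∎)
          module U = Upper root-list root-list-coherent (2 ℕ.^ suc j) M j M≤2^j p₀ 2≤p₀
          h = (2 ℕ.* 2 ℕ.^ suc j) ℕ./ M
          shell⇒large : ∀ x → Shell j x → U.Large 1 P (λ x → ℤ.∣ x ∣ ℕ.≤ 2 ℕ.^ suc j) x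
          shell⇒large x (cx , 2^j<x , x≤) = open-tuple (proj₂ (proj₂ large-tuple) x 1≤x cx)
            where
            1≤x : 1 ℕ.≤ ℤ.∣ x ∣
            1≤x = ℕ.≤-trans (s≤s z≤n) 2^j<x
            φ^j≤ : φ ^ j ≤ exp (α * log (ιₙ ℤ.∣ x ∣))
            φ^j≤ = begin
              φ ^ j                              ≈⟨ ≈-sym (exp-ιₙ* j (α * lg2)) ⟩
              exp (ιₙ j * (α * lg2))             ≈⟨ exp-cong (solve 3 (λ j a l → j :* (a :* l) := a :* (j :* l)) ≈-refl (ιₙ j) α lg2) ⟩
              exp (α * (ιₙ j * lg2))             ≤⟨ exp-mono (*-monoʳ-≤ (<⇒≤ 0<α) (≤-trans (≈⇒≥ (log-ιₙ-^ j (s≤s z≤n))) (log-mono (ιₙ-mono-< (ℕ.m^n>0 2 j)) (ιₙ-mono (ℕ.<⇒≤ 2^j<x))))) ⟩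
              exp (α * log (ιₙ ℤ.∣ x ∣))         ∎
            open-tuple : (∃ λ D → Tuple NearRoot x (p₀ ∷ P) D × exp (α * log (ιₙ ℤ.∣ x ∣)) ≤ ιₙ K * ιₙ D) → U.Large 1 P (λ x → ℤ.∣ x ∣ ℕ.≤ 2 ℕ.^ suc j) x
            open-tuple (_ , _∷_ {k = k} {D = D} near t , b) = x≤ , k , D , near , t ,
              ℕ.≤-trans (least (p₀ ℕ.^ k ℕ.* D) (≤-trans φ^j≤ b)) (ℕ.≤-reflexive (cong (ℕ._* D) (sym (ℕ.*-identityˡ (p₀ ℕ.^ k)))))
          small : ιₙ h ≤ ιₙ (4 ℕ.* K) * θ ^ j
          small = *-cancelˡ-≤ (0<φ^ j) (begin
            φ ^ j * ιₙ h                          ≤⟨ *-monoˡ-≤ (0≤ιₙ h) large ⟩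
            ιₙ K * ιₙ M * ιₙ h                    ≈⟨ ≈-trans (*-assoc _ _ _) (*-cong ≈-refl (≈-trans (*-comm _ _) (≈-sym (ιₙ-* h M)))) ⟩
            ιₙ K * ιₙ (h ℕ.* M)                   ≤⟨ *-monoʳ-≤ (0≤ιₙ K) (ιₙ-mono (ℕ.m/n*n≤m (2 ℕ.* 2 ℕ.^ suc j) M)) ⟩
            ιₙ K * ιₙ (2 ℕ.* (2 ℕ.* 2 ℕ.^ j))     ≈⟨ *-cong ≈-refl (≈-trans (ιₙ-* 2 _) (*-cong ≈-refl (≈-trans (ιₙ-* 2 _) (*-cong ≈-refl (≈-sym (φθ j)))))) ⟩
            ιₙ K * (ιₙ 2 * (ιₙ 2 * (φ ^ j * θ ^ j)))  ≈⟨ solve 3 (λ k a b → k :* (con (+ 2) :* (con (+ 2) :* (a :* b))) := a :* ((con (+ 4) :* k) :* b)) ≈-refl (ιₙ K) (φ ^ j) (θ ^ j) ⟩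
            φ ^ j * (ιₙ 4 * ιₙ K * θ ^ j)         ≈⟨ *-cong ≈-refl (*-cong (≈-sym (ιₙ-* 4 K)) ≈-refl) ⟩
            φ ^ j * (ιₙ (4 ℕ.* K) * θ ^ j)        ∎)

      cover-⊎ : ∀ {P Q R : ℤ → Set} {a b} → (∀ x → R x → P x ⊎ Q x) → Cover P a → Cover Q b → Cover R (a ℕ.+ b)
      cover-⊎ split (zs , l , c) (zs′ , l′ , c′) = zs ++ zs′ , ℕ.≤-trans (ℕ.≤-reflexive (List.length-++ zs)) (ℕ.+-mono-≤ l l′) ,
        λ x r → pick x (split x r)
        where
        pick : ∀ x → _ ⊎ _ → x ∈ zs ++ zs′
        pick x (inj₁ p) = ∈-++⁺ˡ (c x p)
        pick x (inj₂ q) = ∈-++⁺ʳ zs (c′ x q)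

      Ball : ℕ → ℤ → Set
      Ball J x = Counted x × ℤ.∣ x ∣ ℕ.≤ 2 ℕ.^ J

      unit-ball : Cover (Ball 0) 3
      unit-ball = + 0 ∷ + 1 ∷ -[1+ 0 ] ∷ [] , ℕ.≤-refl , λ where
        (+ 0) _ → here refl
        (+ 1) _ → there (here refl)
        (+ suc (suc _)) (_ , s≤s ())
        -[1+ 0 ] _ → there (there (here refl))
        -[1+ suc _ ] (_ , s≤s ())

      gap : ∃ λ κ → 1# ≤ ιₙ κ * (θ - 1#)
      gap = ≤-archimedean-ratio 1# (x<y⇒0<y-x (≤-<-trans (≈⇒≥ exp-0) (exp-mono-< (*-pos 0<β 0<lg2))))

      κ : ℕ
      κ = proj₁ gap

      Γ : ℕ → ℕ
      Γ J = suc J ℕ.^ s ℕ.* (CA ℕ.* (8 ℕ.* K ℕ.+ 2))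

      shell-size : ∀ {J j h} → j ℕ.≤ J → ιₙ h ≤ ιₙ (4 ℕ.* K) * θ ^ j → ιₙ (size j h) ≤ ιₙ (Γ J) * θ ^ j
      shell-size {J} {j} {h} j≤J h≤ = begin
        ιₙ (size j h)                                              ≤⟨ ιₙ-mono (ℕ.*-monoˡ-≤ (CA ℕ.* (suc h ℕ.+ suc h)) (ℕ.^-monoˡ-≤ s (s≤s j≤J))) ⟩
        ιₙ (suc J ℕ.^ s ℕ.* (CA ℕ.* (suc h ℕ.+ suc h)))            ≈⟨ ≈-trans (ιₙ-* _ _) (*-cong ≈-refl (≈-trans (ιₙ-* CA _) (*-cong ≈-refl (≈-trans (ιₙ-+ (suc h) (suc h)) (+-cong (ιₙ-suc h) (ιₙ-suc h)))))) ⟩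
        A * (ιₙ CA * ((1# + ιₙ h) + (1# + ιₙ h)))                  ≤⟨ *-monoʳ-≤ (0≤ιₙ _) (*-monoʳ-≤ (0≤ιₙ CA) (+-mono-≤ (+-mono-≤ (1≤θ^ j) h≤) (+-mono-≤ (1≤θ^ j) h≤))) ⟩
        A * (ιₙ CA * ((θ ^ j + ιₙ (4 ℕ.* K) * θ ^ j) + (θ ^ j + ιₙ (4 ℕ.* K) * θ ^ j)))
          ≈⟨ *-cong ≈-refl (*-cong ≈-refl (+-cong (+-cong ≈-refl (*-cong (ιₙ-* 4 K) ≈-refl)) (+-cong ≈-refl (*-cong (ιₙ-* 4 K) ≈-refl)))) ⟩
        A * (ιₙ CA * ((θ ^ j + ιₙ 4 * ιₙ K * θ ^ j) + (θ ^ j + ιₙ 4 * ιₙ K * θ ^ j)))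
          ≈⟨ solve 4 (λ a c k t → a :* (c :* ((t :+ con (+ 4) :* k :* t) :+ (t :+ con (+ 4) :* k :* t))) := (a :* (c :* (con (+ 8) :* k :+ con (+ 2)))) :* t) ≈-refl A (ιₙ CA) (ιₙ K) (θ ^ j) ⟩
        A * (ιₙ CA * (ιₙ 8 * ιₙ K + ιₙ 2)) * θ ^ j                 ≈⟨ *-cong (≈-sym (≈-trans (ιₙ-* _ _) (*-cong ≈-refl (≈-trans (ιₙ-* CA _) (*-cong ≈-refl (≈-trans (ιₙ-+ (8 ℕ.* K) 2) (+-cong (ιₙ-* 8 K) ≈-refl))))))) ≈-refl ⟩
        ιₙ (Γ J) * θ ^ j                                           ∎
        where A = ιₙ (suc J ℕ.^ s)

      ball-cover : ∀ J j → j ℕ.≤ J → ∃ λ w → Cover (Ball j) w × ιₙ w ≤ ιₙ 3 + ιₙ (Γ J) * (ιₙ κ * θ ^ j)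
      ball-cover J zero    _ = 3 , unit-ball , ≤-trans (≈⇒≥ (+-identityʳ _)) (+-monoʳ-≤ _ (*-nonNeg (0≤ιₙ _) (*-nonNeg (0≤ιₙ κ) 0≤1)))
      ball-cover J (suc j) j<J =
        let w , cov , b = ball-cover J j (ℕ.<⇒≤ j<J)
            h , shell , h≤ = shell-cover j
        in w ℕ.+ size j h , cover-⊎ split cov shell , (begin
          ιₙ (w ℕ.+ size j h)                                                        ≈⟨ ιₙ-+ w _ ⟩
          ιₙ w + ιₙ (size j h)                                                       ≤⟨ +-mono-≤ b (shell-size (ℕ.<⇒≤ j<J) h≤) ⟩
          (ιₙ 3 + ιₙ (Γ J) * (ιₙ κ * θ ^ j)) + ιₙ (Γ J) * θ ^ j                      ≤⟨ ≤-via (*-nonNeg (*-nonNeg (0≤ιₙ (Γ J)) (0≤θ^ j)) (x≤y⇒0≤y-x (proj₂ gap)))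
            (solve 4 (λ g k t u → (con (+ 3) :+ g :* (k :* (u :* t))) :- ((con (+ 3) :+ g :* (k :* t)) :+ g :* t) := g :* t :* (k :* (u :- con (+ 1)) :- con (+ 1)) :- con (+ 0)) ≈-refl (ιₙ (Γ J)) (ιₙ κ) (θ ^ j) θ) ⟩
          ιₙ 3 + ιₙ (Γ J) * (ιₙ κ * θ ^ suc j)                                       ∎)
        where
        split : ∀ x → Ball (suc j) x → Ball j x ⊎ Shell j x
        split x (cx , x≤) = decide (ℤ.∣ x ∣ ℕ.≤? 2 ℕ.^ j)
          where
          decide : Dec (ℤ.∣ x ∣ ℕ.≤ 2 ℕ.^ j) → Ball j x ⊎ Shell j x
          decide (yes p) = inj₁ (cx , p)
          decide (no ¬p) = inj₂ (cx , ℕ.≰⇒> ¬p , x≤)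

      n<2^n : ∀ n → n ℕ.< 2 ℕ.^ n
      n<2^n zero    = s≤s z≤n
      n<2^n (suc n) = ℕ.≤-trans (ℕ.+-mono-≤ {1} (ℕ.≤-trans (s≤s z≤n) (n<2^n n)) (n<2^n n)) (ℕ.+-monoʳ-≤ (2 ℕ.^ n) (ℕ.m≤m+n (2 ℕ.^ n) 0))

    Ball-ℝ : ℝ → ℤ → Set
    Ball-ℝ B x = Counted x × ιₙ ℤ.∣ x ∣ ≤ B

    upper-estimate : ∃ λ C → 1 ℕ.≤ C × (∀ B → 0# < B → 1# ≤ log B →
      ∃ λ w → Cover (Ball-ℝ B) w × ιₙ w ≤ ιₙ C * (exp (β * log B) * log B ^ s))
    upper-estimate =
      let c₁ , 1≤c₁lg2 = ≤-archimedean-ratio 1# 0<lg2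
          t , θ≤t = ≤-archimedean-ℝ θ
          c = c₁ ℕ.+ 2
          E = (CA ℕ.* (8 ℕ.* K ℕ.+ 2)) ℕ.* κ ℕ.* t
      in suc (2 ℕ.+ c ℕ.^ s ℕ.* E) , s≤s z≤n , λ B 0<B 1≤b →
        let m , B≤m = ≤-archimedean-ℝ B
            J′ , J′≤ , J′≰ = crossing (λ j → ιₙ (2 ℕ.^ j) ≤ B) (≤-trans (0≤⇒1≤exp (≤-trans 0≤1 1≤b)) (≈⇒≤ (exp-log 0<B))) m
                               (λ q → <⇒≱ (ιₙ-mono-< (n<2^n m)) (≤-trans q B≤m))
            J = suc J′
            b = log B
            G = exp (β * b)
            J′lg2≤b : ιₙ J′ * lg2 ≤ b
            J′lg2≤b = ≤-trans (≈⇒≥ (log-ιₙ-^ J′ (s≤s z≤n))) (log-mono (ιₙ-mono-< (ℕ.m^n>0 2 J′)) J′≤)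
            sucJ≤ : ιₙ (suc J) ≤ ιₙ c * b
            sucJ≤ = begin
              ιₙ (2 ℕ.+ J′)                       ≈⟨ ≈-trans (ιₙ-+ 2 J′) (solve 1 (λ j → con (+ 2) :+ j := con (+ 2) :* con (+ 1) :+ j :* con (+ 1)) ≈-refl (ιₙ J′)) ⟩
              ιₙ 2 * 1# + ιₙ J′ * 1#              ≤⟨ +-mono-≤ (*-monoʳ-≤ (0≤ιₙ 2) 1≤b) (*-monoʳ-≤ (0≤ιₙ J′) 1≤c₁lg2) ⟩
              ιₙ 2 * b + ιₙ J′ * (ιₙ c₁ * lg2)    ≈⟨ +-cong ≈-refl (solve 3 (λ j c l → j :* (c :* l) := c :* (j :* l)) ≈-refl (ιₙ J′) (ιₙ c₁) lg2) ⟩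
              ιₙ 2 * b + ιₙ c₁ * (ιₙ J′ * lg2)    ≤⟨ +-monoʳ-≤ _ (*-monoʳ-≤ (0≤ιₙ c₁) J′lg2≤b) ⟩
              ιₙ 2 * b + ιₙ c₁ * b                ≈⟨ solve 2 (λ c b → con (+ 2) :* b :+ c :* b := (c :+ con (+ 2)) :* b) ≈-refl (ιₙ c₁) b ⟩
              (ιₙ c₁ + ιₙ 2) * b                  ≈⟨ *-cong (≈-sym (ιₙ-+ c₁ 2)) ≈-refl ⟩
              ιₙ c * b                            ∎
            θ^J≤ : θ ^ J ≤ ιₙ t * G
            θ^J≤ = *-mono-≤ (≤-trans 0≤1 1≤θ) (0≤exp _) θ≤t (begin
              θ ^ J′                        ≈⟨ ≈-sym (exp-ιₙ* J′ (β * lg2)) ⟩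
              exp (ιₙ J′ * (β * lg2))       ≈⟨ exp-cong (solve 3 (λ j a l → j :* (a :* l) := a :* (j :* l)) ≈-refl (ιₙ J′) β lg2) ⟩
              exp (β * (ιₙ J′ * lg2))       ≤⟨ exp-mono (*-monoʳ-≤ (<⇒≤ 0<β) J′lg2≤b) ⟩
              G                             ∎)
            0≤b = ≤-trans 0≤1 1≤b
            1≤Gb : 1# ≤ G * b ^ s
            1≤Gb = ≤-trans (≈⇒≥ (*-identityˡ 1#)) (*-mono-≤ 0≤1 (≤-trans 0≤1 (≥1⇒1≤^ s 1≤b)) (0≤⇒1≤exp (*-nonNeg (<⇒≤ 0<β) 0≤b)) (≥1⇒1≤^ s 1≤b))
            w , cov , bound = ball-cover J J ℕ.≤-refl
        in w , cover-⊆ (λ x (cx , x≤B) → cx , ℕ.<⇒≤ (ℕ.≰⇒> λ q → J′≰ (≤-trans (ιₙ-mono q) x≤B))) cov , (begin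
          ιₙ w                                                          ≤⟨ bound ⟩
          ιₙ 3 + ιₙ (Γ J) * (ιₙ κ * θ ^ J)                              ≤⟨ +-mono-≤ (≤-trans (≈⇒≤ (solve 0 (con (+ 3) := con (+ 3) :* con (+ 1)) ≈-refl)) (*-monoʳ-≤ (0≤ιₙ 3) 1≤Gb)) (*-mono-≤ (0≤ιₙ (Γ J)) (*-nonNeg (0≤ιₙ κ) (*-nonNeg (0≤ιₙ t) (0≤exp _)))
                                                                             (≤-trans (≈⇒≤ (≈-trans (ιₙ-* _ _) (*-cong (ιₙ-^ (suc J) s) ≈-refl))) (*-monoˡ-≤ (0≤ιₙ _) (^-mono s (0≤ιₙ (suc J)) sucJ≤)))
                                                                             (*-monoʳ-≤ (0≤ιₙ κ) θ^J≤)) ⟩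
          ιₙ 3 * (G * b ^ s) + (ιₙ c * b) ^ s * ιₙ (CA ℕ.* (8 ℕ.* K ℕ.+ 2)) * (ιₙ κ * (ιₙ t * G))
            ≈⟨ +-cong ≈-refl (*-cong (*-cong (≈-trans (*-^ (ιₙ c) b s) (*-cong (≈-sym (ιₙ-^ c s)) ≈-refl)) ≈-refl) ≈-refl) ⟩
          ιₙ 3 * (G * b ^ s) + (ιₙ (c ℕ.^ s) * b ^ s) * ιₙ (CA ℕ.* (8 ℕ.* K ℕ.+ 2)) * (ιₙ κ * (ιₙ t * G))
            ≈⟨ solve 6 (λ g x c e k t → con (+ 3) :* (g :* x) :+ (c :* x) :* e :* (k :* (t :* g)) := (con (+ 3) :+ c :* (e :* k :* t)) :* (g :* x)) ≈-refl G (b ^ s) (ιₙ (c ℕ.^ s)) (ιₙ (CA ℕ.* (8 ℕ.* K ℕ.+ 2))) (ιₙ κ) (ιₙ t) ⟩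
          (ιₙ 3 + ιₙ (c ℕ.^ s) * (ιₙ (CA ℕ.* (8 ℕ.* K ℕ.+ 2)) * ιₙ κ * ιₙ t)) * (G * b ^ s)
            ≈⟨ *-cong (+-cong ≈-refl (*-cong ≈-refl (≈-trans (*-cong (≈-sym (ιₙ-* _ κ)) ≈-refl) (≈-sym (ιₙ-* _ t))))) ≈-refl ⟩
          (ιₙ 3 + ιₙ (c ℕ.^ s) * ιₙ E) * (G * b ^ s)                    ≈⟨ *-cong (≈-trans (+-cong ≈-refl (≈-sym (ιₙ-* (c ℕ.^ s) E))) (≈-sym (ιₙ-+ 3 (c ℕ.^ s ℕ.* E)))) ≈-refl ⟩
          ιₙ (3 ℕ.+ c ℕ.^ s ℕ.* E) * (G * b ^ s)                        ∎)

    private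
      product≥1 : ∀ {P} → All (λ p → 2 ℕ.≤ p × Comaximal (+ 1) (+ p) × Comaximal (+ p₀) (+ p)) P → 1 ℕ.≤ product P
      product≥1 [] = ℕ.≤-refl
      product≥1 ((2≤p , _) ∷ h) = ℕ.*-mono-≤ (ℕ.≤-trans (s≤s z≤n) 2≤p) (product≥1 h)

      Q : ℕ
      Q = product P

      C′ : ℕ
      C′ = suc (proj₁ (Growth.eval-upper f n (proj₂ deg)))

      f-upper : ∀ x → 1 ℕ.≤ ℤ.∣ x ∣ → ℤ.∣ eval f x ∣ ℕ.≤ C′ ℕ.* ℤ.∣ x ∣ ℕ.^ n
      f-upper x 1≤x = ℕ.≤-trans (proj₂ (Growth.eval-upper f n (proj₂ deg)) x 1≤x) (ℕ.*-monoˡ-≤ (ℤ.∣ x ∣ ℕ.^ n) {proj₁ (Growth.eval-upper f n (proj₂ deg))} {C′} (ℕ.n≤1+n (proj₁ (Growth.eval-upper f n (proj₂ deg)))))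

      X₀ : ℕ
      X₀ = proj₁ (proj₂ (Growth.eval-lower f n deg))

      f≢0 : ∀ x → X₀ ℕ.< ℤ.∣ x ∣ → 1 ℕ.≤ ℤ.∣ eval f x ∣
      f≢0 x X₀<x = ℕ.n≢0⇒n>0 λ e → ℕ.<⇒≱ (ℕ.m^n>0 ℤ.∣ x ∣ {{ℕ.>-nonZero 1≤x}} n)
        (ℕ.≤-trans (proj₂ (proj₂ (Growth.eval-lower f n deg)) x (ℕ.<⇒≤ X₀<x) 1≤x) (ℕ.≤-reflexive (trans (cong (c ℕ.*_) e) (ℕ.*-zeroʳ c))))
        where
        c = proj₁ (Growth.eval-lower f n deg)
        1≤x = ℕ.≤-trans (s≤s z≤n) X₀<x

      counted : ∀ {M D B} x → 1 ℕ.≤ M → exp (ε * log (ιₙ C′) + α * log B) ≤ ιₙ M → X₀ ℕ.< ℤ.∣ x ∣ → ιₙ ℤ.∣ x ∣ ≤ B →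
                Tuple NearCenter x (p₀ ∷ P) D → M ℕ.≤ D → Counted x
      counted {M} {D} {B} x 1≤M M≥ X₀<x x≤B t M≤D = 1≤y , (begin
        ε * log (ιₙ y)                                            ≤⟨ *-monoʳ-≤ 0≤ε (log-mono (ιₙ-mono-< 1≤y) (ιₙ-mono (f-upper x 1≤x))) ⟩
        ε * log (ιₙ (C′ ℕ.* ℤ.∣ x ∣ ℕ.^ n))                       ≈⟨ *-cong ≈-refl (≈-trans (log-ιₙ-* {C′} (s≤s z≤n) (ℕ.m^n>0 ℤ.∣ x ∣ {{ℕ.>-nonZero 1≤x}} n)) (+-cong ≈-refl (log-ιₙ-^ n 1≤x))) ⟩
        ε * (log (ιₙ C′) + ιₙ n * log (ιₙ ℤ.∣ x ∣))               ≤⟨ *-monoʳ-≤ 0≤ε (+-monoʳ-≤ _ (*-monoʳ-≤ (0≤ιₙ n) (log-mono (ιₙ-mono-< 1≤x) x≤B))) ⟩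
        ε * (log (ιₙ C′) + ιₙ n * log B)                          ≈⟨ solve 4 (λ e l n b → e :* (l :+ n :* b) := e :* l :+ (n :* e) :* b) ≈-refl ε (log (ιₙ C′)) (ιₙ n) (log B) ⟩
        ε * log (ιₙ C′) + (ιₙ n * ε) * log B                      ≈⟨ +-cong ≈-refl (*-cong (≈-sym Rα≈nε) ≈-refl) ⟩
        ε * log (ιₙ C′) + (ιₙ Rₘ * α) * log B                     ≤⟨ +-monoˡ-≤ _ (x≤ιₙa*x 1≤Rₘ (*-nonNeg 0≤ε (0≤log {C′} (s≤s z≤n)))) ⟩
        ιₙ Rₘ * (ε * log (ιₙ C′)) + (ιₙ Rₘ * α) * log B           ≈⟨ solve 4 (λ r e a b → r :* e :+ (r :* a) :* b := r :* (e :+ a :* b)) ≈-refl (ιₙ Rₘ) (ε * log (ιₙ C′)) α (log B) ⟩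
        ιₙ Rₘ * (ε * log (ιₙ C′) + α * log B)                     ≤⟨ *-monoʳ-≤ (0≤ιₙ Rₘ) (exp-cancel-≤ (≤-trans M≥ (≤-trans (ιₙ-mono M≤D) (≈⇒≥ (exp-log (ιₙ-mono-< (ℕ.≤-trans 1≤M M≤D))))))) ⟩
        ιₙ Rₘ * log (ιₙ D)                                        ≤⟨ proj₂ (low x D 1≤y t) ⟩
        Σlog x S                                                  ∎)
        where
        y = ℤ.∣ eval f x ∣
        1≤x = ℕ.≤-trans (s≤s z≤n) X₀<x
        1≤y = f≢0 x X₀<x
        low : LowerBound S (p₀ ∷ P)
        low = subst (LowerBound S) with-root≡ (Σlog-lower S primes)

      K₂ : ∃ λ K → 1 ℕ.≤ K × exp (ε * log (ιₙ C′)) ≤ ιₙ K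
      K₂ = let K , K≥ = ≤-archimedean-ℝ (exp (ε * log (ιₙ C′))) in suc K , s≤s z≤n , ≤-trans K≥ (ιₙ-mono (ℕ.n≤1+n K))

      slope : ∃ λ c → 1 ℕ.≤ c × log (ιₙ Q) ≤ ιₙ c * α
      slope = let c , c≥ = ≤-archimedean-ratio (log (ιₙ Q)) 0<α in suc c , s≤s z≤n , ≤-trans c≥ (*-monoˡ-≤ (<⇒≤ 0<α) (ιₙ-mono (ℕ.n≤1+n c)))

      W : ℕ
      W = p₀ ℕ.* proj₁ K₂ ℕ.* Q

      1≤W : 1 ℕ.≤ W
      1≤W = ℕ.*-mono-≤ (ℕ.*-mono-≤ (ℕ.≤-trans (s≤s z≤n) 2≤p₀) (proj₁ (proj₂ K₂))) (product≥1 coprime)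

      module LargeB (B : ℝ) (0<B : 0# < B) (c b₁ : ℕ) (1≤c : 1 ℕ.≤ c) (slope : log (ιₙ Q) ≤ ιₙ c * α)
          (K : ℕ) (1≤K : 1 ℕ.≤ K) (K≥ : exp (ε * log (ιₙ C′)) ≤ ιₙ K) (W≡ : W ≡ p₀ ℕ.* K ℕ.* Q)
          (8W≤ : ιₙ (8 ℕ.* W) ≤ ιₙ b₁ * β) (b≥ : ιₙ (c ℕ.+ (4 ℕ.* X₀ ℕ.+ b₁)) ≤ log B) where

        b E G : ℝ
        b = log B
        E = exp (α * b)
        G = exp (β * b)

        c≤b : ιₙ c ≤ b
        c≤b = ≤-trans (ιₙ-mono (ℕ.m≤m+n c _)) b≥

        4X₀≤b : ιₙ (4 ℕ.* X₀) ≤ b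
        4X₀≤b = ≤-trans (ιₙ-mono (ℕ.≤-trans (ℕ.m≤m+n _ b₁) (ℕ.m≤n+m _ c))) b≥

        b₁≤b : ιₙ b₁ ≤ b
        b₁≤b = ≤-trans (ιₙ-mono (ℕ.≤-trans (ℕ.m≤n+m b₁ (4 ℕ.* X₀)) (ℕ.m≤n+m _ c))) b≥

        0≤b : 0# ≤ b
        0≤b = ≤-trans (0≤ιₙ c) c≤b

        1≤E : 1# ≤ E
        1≤E = 0≤⇒1≤exp (*-nonNeg (<⇒≤ 0<α) 0≤b)

        EG≈B : E * G ≈ B
        EG≈B = ≈-trans (≈-sym (exp-+ _ _)) (≈-trans (exp-cong (solve 2 (λ a b → a :* b :+ (con (+ 1) :- a) :* b := b) ≈-refl α b)) (exp-log 0<B))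

        b≤B : b ≤ E * G
        b≤B = ≤-trans (≤-trans (≤-trans (≈⇒≥ (+-identityˡ b)) (+-monoˡ-≤ b 0≤1)) (1+x≤exp 0≤b)) (≈⇒≤ (≈-trans (exp-log 0<B) (≈-sym EG≈B)))

        8W≤G : ιₙ (8 ℕ.* W) ≤ G
        8W≤G = begin
          ιₙ (8 ℕ.* W)       ≤⟨ 8W≤ ⟩
          ιₙ b₁ * β          ≤⟨ *-monoˡ-≤ (<⇒≤ 0<β) b₁≤b ⟩
          b * β              ≈⟨ *-comm b β ⟩
          β * b              ≤⟨ ≤-trans (≤-trans (≈⇒≥ (+-identityˡ _)) (+-monoˡ-≤ _ 0≤1)) (1+x≤exp (*-nonNeg (<⇒≤ 0<β) 0≤b)) ⟩
          G                  ∎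

        modulus : ∃ λ M₁ → 1 ℕ.≤ M₁ × E ≤ ιₙ M₁ × ιₙ M₁ ≤ ιₙ 2 * E
        modulus = from (minimum (λ m → E ≤ ιₙ m) (proj₁ (≤-archimedean-ℝ E)) (proj₂ (≤-archimedean-ℝ E)))
          where
          from : (∃ λ m → E ≤ ιₙ m × (∀ j → E ≤ ιₙ j → m ℕ.≤ j)) → ∃ λ M₁ → 1 ℕ.≤ M₁ × E ≤ ιₙ M₁ × ιₙ M₁ ≤ ιₙ 2 * E
          from (zero , E≤0 , _) = ⊥-elim (<⇒≱ (exp-pos _) E≤0)
          from (suc m , E≤ , least) = suc m , s≤s z≤n , E≤ , (begin
            ιₙ (suc m)      ≈⟨ ιₙ-suc m ⟩
            1# + ιₙ m       ≤⟨ +-mono-≤ 1≤E (<⇒≤ (≰⇒> λ E≤m → ℕ.<-irrefl refl (least m E≤m))) ⟩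
            E + E           ≈⟨ solve 1 (λ e → e :+ e := con (+ 2) :* e) ≈-refl E ⟩
            ιₙ 2 * E        ∎)

        exponent : ∃ λ L → ιₙ (c ℕ.* L) ≤ b × ¬ ιₙ (c ℕ.* suc L) ≤ b
        exponent = let m , b≤m = ≤-archimedean-ℝ b in
          crossing (λ k → ιₙ (c ℕ.* k) ≤ b) (≤-trans (≈⇒≤ (≈-reflexive (cong ιₙ (ℕ.*-zeroʳ c)))) 0≤b) (suc m)
            (λ q → <⇒≱ (ιₙ-mono-< (ℕ.≤-trans (ℕ.n<1+n m) (ℕ.m≤n*m (suc m) c {{ℕ.>-nonZero 1≤c}}))) (≤-trans q b≤m))

        module Construction (M₁ : ℕ) (1≤M₁ : 1 ℕ.≤ M₁) (E≤M₁ : E ≤ ιₙ M₁) (M₁≤2E : ιₙ M₁ ≤ ιₙ 2 * E)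
            (L : ℕ) (cL≤b : ιₙ (c ℕ.* L) ≤ b) (b<cL : ¬ ιₙ (c ℕ.* suc L) ≤ b) where

          M : ℕ
          M = K ℕ.* M₁

          step : ℕ
          step = p₀ ℕ.* M ℕ.* (1 ℕ.* Q)

          step≡ : step ≡ W ℕ.* M₁
          step≡ = trans (+-*-Solver.solve 4 (λ p k m q → p S.:* (k S.:* m) S.:* (S.con 1 S.:* q) S.:= p S.:* k S.:* q S.:* m) refl p₀ K M₁ Q) (cong (ℕ._* M₁) (sym W≡))
            where module S = +-*-Solver

          1≤step : 1 ℕ.≤ step
          1≤step = subst (1 ℕ.≤_) (sym step≡) (ℕ.*-mono-≤ 1≤W 1≤M₁)

          number : ∃ λ J → ιₙ (X₀ ℕ.+ J ℕ.* step) ≤ B × ¬ ιₙ (X₀ ℕ.+ suc J ℕ.* step) ≤ B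
          number = let m , B≤m = ≤-archimedean-ℝ B in
            crossing (λ k → ιₙ (X₀ ℕ.+ k ℕ.* step) ≤ B)
              (≤-trans (ιₙ-mono (ℕ.≤-trans (ℕ.≤-reflexive (ℕ.+-identityʳ X₀)) (ℕ.m≤n*m X₀ 4))) (≤-trans 4X₀≤b (≤-trans b≤B (≈⇒≤ EG≈B)))) (suc m)
              (λ q → <⇒≱ (ιₙ-mono-< (ℕ.≤-trans (ℕ.≤-trans (ℕ.n<1+n m) (ℕ.m≤m*n (suc m) step {{ℕ.>-nonZero 1≤step}})) (ℕ.m≤n+m _ X₀))) (≤-trans q B≤m))

          Q^L≤M : 1 ℕ.* Q ℕ.^ L ℕ.≤ M
          Q^L≤M = ℕ.≤-trans (ℕ.≤-reflexive (ℕ.*-identityˡ _)) (ℕ.≤-trans (ιₙ-cancel (begin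
            ιₙ (Q ℕ.^ L)                  ≈⟨ ≈-sym (exp-log (ιₙ-mono-< (ℕ.m^n>0 Q {{ℕ.>-nonZero (product≥1 coprime)}} L))) ⟩
            exp (log (ιₙ (Q ℕ.^ L)))      ≤⟨ exp-mono (begin
              log (ιₙ (Q ℕ.^ L))            ≈⟨ log-ιₙ-^ L (product≥1 coprime) ⟩
              ιₙ L * log (ιₙ Q)             ≤⟨ *-monoʳ-≤ (0≤ιₙ L) slope ⟩
              ιₙ L * (ιₙ c * α)             ≈⟨ ≈-trans (solve 3 (λ l c a → l :* (c :* a) := a :* (c :* l)) ≈-refl (ιₙ L) (ιₙ c) α) (*-cong ≈-refl (≈-sym (ιₙ-* c L))) ⟩
              α * ιₙ (c ℕ.* L)              ≤⟨ *-monoʳ-≤ (<⇒≤ 0<α) cL≤b ⟩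
              α * b                         ∎) ⟩
            E                             ≤⟨ E≤M₁ ⟩
            ιₙ M₁                         ∎)) (ℕ.m≤n*m M₁ K {{ℕ.>-nonZero 1≤K}}))

          M≥ : exp (ε * log (ιₙ C′) + α * log B) ≤ ιₙ M
          M≥ = ≤-trans (≈⇒≤ (exp-+ _ _)) (≤-trans (*-mono-≤ (0≤exp _) (0≤ιₙ M₁) K≥ E≤M₁) (≈⇒≥ (ιₙ-* K M₁)))

          b≤2cL : b ≤ ιₙ (2 ℕ.* c) * ιₙ L
          b≤2cL = from L refl
            where
            from : ∀ L′ → L′ ≡ L → b ≤ ιₙ (2 ℕ.* c) * ιₙ L
            from zero    refl = ⊥-elim (b<cL (≤-trans (≈⇒≤ (≈-reflexive (cong ιₙ (ℕ.*-identityʳ c)))) c≤b))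
            from (suc l) refl = ≤-trans (<⇒≤ (≰⇒> b<cL)) (≤-trans (ιₙ-mono (ℕ.≤-trans (ℕ.*-monoʳ-≤ c (ℕ.+-monoʳ-≤ 1 (s≤s (ℕ.≤-trans (ℕ.m≤n+m l l) (ℕ.≤-reflexive (cong (l ℕ.+_) (sym (ℕ.+-identityʳ l))))))))
                (ℕ.≤-trans (ℕ.*-monoʳ-≤ c (ℕ.≤-reflexive (sym (cong suc (ℕ.+-suc l (l ℕ.+ 0)))))) (ℕ.≤-reflexive (S.solve 2 (λ c m → c S.:* (S.con 2 S.:* m) S.:= S.con 2 S.:* c S.:* m) refl c (suc l))))))
              (≈⇒≤ (ιₙ-* (2 ℕ.* c) (suc l))))
              where module S = +-*-Solver

          module Final (J : ℕ) (J≤ : ιₙ (X₀ ℕ.+ J ℕ.* step) ≤ B) (J≰ : ¬ ιₙ (X₀ ℕ.+ suc J ℕ.* step) ≤ B) where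

            Bₙ : ℕ
            Bₙ = X₀ ℕ.+ J ℕ.* step

            module Lw = Lower root-center Bₙ M L J X₀ p₀ 2≤p₀

            many : Many (Ball-ℝ B) (L ℕ.^ s ℕ.* J)
            many = many-⊆ in-ball (Lw.lower P 1 1 1 0ℤ refl ℕ.≤-refl ℕ.≤-refl (comaximal-1 _) coprime coprimes
              (λ p _ → root-center-coherent p) Q^L≤M ℕ.≤-refl)
              where
              in-ball : ∀ x → Lw.Large 1 1 0ℤ P x → Ball-ℝ B x
              in-ball x (_ , X₀<x , x≤Bₙ , k₀ , D , near , t , M≤) =
                counted x (ℕ.*-mono-≤ 1≤K 1≤M₁) M≥ X₀<x x≤B (near ∷ t) (ℕ.≤-trans M≤ (ℕ.≤-reflexive (cong (ℕ._* D) (ℕ.*-identityˡ (p₀ ℕ.^ k₀))))) , x≤B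
                where
                x≤B = ≤-trans (ιₙ-mono x≤Bₙ) J≤

            G≤4WJ : G ≤ ιₙ 4 * ιₙ W * ιₙ J
            G≤4WJ = *-cancelˡ-≤ (*-pos (ιₙ-mono-< {0} {2} (s≤s z≤n)) (exp-pos (α * b))) (≤-via
              (+-mono-≤ (+-mono-≤ (*-monoʳ-≤ (0≤ιₙ 4) B<) (≤-trans 4X₀≤′ b≤B))
                (+-mono-≤ (*-monoʳ-≤ (*-nonNeg (0≤ιₙ 4) (*-nonNeg (0≤ιₙ W) (+-nonNeg 0≤1 (0≤ιₙ J)))) M₁≤2E) (*-monoʳ-≤ (0≤exp (α * b)) 8W≤′)))
              (solve 6 (λ e g x w j m → con (+ 2) :* e :* (con (+ 4) :* w :* j) :- con (+ 2) :* e :* g :=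
                 ((con (+ 4) :* (x :+ (con (+ 1) :+ j) :* (w :* m)) :+ e :* g) :+ ((con (+ 4) :* (w :* (con (+ 1) :+ j))) :* (con (+ 2) :* e) :+ e :* g))
                   :- ((con (+ 4) :* (e :* g) :+ con (+ 4) :* x) :+ ((con (+ 4) :* (w :* (con (+ 1) :+ j))) :* m :+ e :* (con (+ 8) :* w)))) ≈-refl E G (ιₙ X₀) (ιₙ W) (ιₙ J) (ιₙ M₁)))
              where
              B< : E * G ≤ ιₙ X₀ + (1# + ιₙ J) * (ιₙ W * ιₙ M₁)
              B< = begin
                E * G                                    ≈⟨ EG≈B ⟩
                B                                        ≤⟨ <⇒≤ (≰⇒> J≰) ⟩
                ιₙ (X₀ ℕ.+ suc J ℕ.* step)               ≈⟨ ≈-trans (ιₙ-+ X₀ _) (+-cong ≈-refl (≈-trans (ιₙ-* (suc J) step) (*-cong (ιₙ-suc J) (≈-trans (≈-reflexive (cong ιₙ step≡)) (ιₙ-* W M₁))))) ⟩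
                ιₙ X₀ + (1# + ιₙ J) * (ιₙ W * ιₙ M₁)     ∎
              4X₀≤′ : ιₙ 4 * ιₙ X₀ ≤ b
              4X₀≤′ = ≤-trans (≈⇒≥ (ιₙ-* 4 X₀)) 4X₀≤b
              8W≤′ : ιₙ 8 * ιₙ W ≤ G
              8W≤′ = ≤-trans (≈⇒≥ (ιₙ-* 8 W)) 8W≤G

            estimate : G * b ^ s ≤ ιₙ (4 ℕ.* W ℕ.* (2 ℕ.* c) ℕ.^ s) * ιₙ (L ℕ.^ s ℕ.* J)
            estimate = begin
              G * b ^ s                                                            ≤⟨ *-mono-≤ (0≤exp _) (^-nonNeg s (*-nonNeg (0≤ιₙ _) (0≤ιₙ L))) G≤4WJ (^-mono s 0≤b b≤2cL) ⟩
              ιₙ 4 * ιₙ W * ιₙ J * (ιₙ (2 ℕ.* c) * ιₙ L) ^ s                        ≈⟨ *-cong ≈-refl (*-^ _ _ s) ⟩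
              ιₙ 4 * ιₙ W * ιₙ J * (ιₙ (2 ℕ.* c) ^ s * ιₙ L ^ s)                    ≈⟨ solve 4 (λ w j c l → w :* j :* (c :* l) := (w :* c) :* (l :* j)) ≈-refl (ιₙ 4 * ιₙ W) (ιₙ J) (ιₙ (2 ℕ.* c) ^ s) (ιₙ L ^ s) ⟩
              (ιₙ 4 * ιₙ W * ιₙ (2 ℕ.* c) ^ s) * (ιₙ L ^ s * ιₙ J)                  ≈⟨ *-cong (*-cong (≈-sym (ιₙ-* 4 W)) (≈-sym (ιₙ-^ (2 ℕ.* c) s))) (*-cong (≈-sym (ιₙ-^ L s)) ≈-refl) ⟩
              (ιₙ (4 ℕ.* W) * ιₙ ((2 ℕ.* c) ℕ.^ s)) * (ιₙ (L ℕ.^ s) * ιₙ J)         ≈⟨ *-cong (≈-sym (ιₙ-* (4 ℕ.* W) _)) (≈-sym (ιₙ-* (L ℕ.^ s) J)) ⟩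
              ιₙ (4 ℕ.* W ℕ.* (2 ℕ.* c) ℕ.^ s) * ιₙ (L ℕ.^ s ℕ.* J)                 ∎

    lower-estimate : ∃ λ T → ∃ λ b₀ → 1 ℕ.≤ T × (∀ B → 0# < B → ιₙ b₀ ≤ log B →
      ∃ λ w → Many (Ball-ℝ B) w × exp (β * log B) * log B ^ s ≤ ιₙ T * ιₙ w)
    lower-estimate =
      let c , 1≤c , sl = slope
          K , 1≤K , K≥ = K₂
          b₁ , 8W≤ = ≤-archimedean-ratio (ιₙ (8 ℕ.* W)) 0<β
      in 4 ℕ.* W ℕ.* (2 ℕ.* c) ℕ.^ s , c ℕ.+ (4 ℕ.* X₀ ℕ.+ b₁) ,
         ℕ.*-mono-≤ (ℕ.*-mono-≤ {1} {4} (s≤s z≤n) 1≤W) (ℕ.m^n>0 (2 ℕ.* c) {{ℕ.>-nonZero (ℕ.*-mono-≤ {1} {2} (s≤s z≤n) 1≤c)}} s) ,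
         λ B 0<B b≥ → build B 0<B c b₁ 1≤c sl K 1≤K K≥ refl 8W≤ b≥
      where
      build : ∀ B (0<B : 0# < B) c b₁ (1≤c : 1 ℕ.≤ c) (sl : log (ιₙ Q) ≤ ιₙ c * α) K (1≤K : 1 ℕ.≤ K) (K≥ : exp (ε * log (ιₙ C′)) ≤ ιₙ K)
        (W≡ : W ≡ p₀ ℕ.* K ℕ.* Q) (8W≤ : ιₙ (8 ℕ.* W) ≤ ιₙ b₁ * β) (b≥ : ιₙ (c ℕ.+ (4 ℕ.* X₀ ℕ.+ b₁)) ≤ log B) →
        ∃ λ w → Many (Ball-ℝ B) w × exp (β * log B) * log B ^ s ≤ ιₙ (4 ℕ.* W ℕ.* (2 ℕ.* c) ℕ.^ s) * ιₙ w
      build B 0<B c b₁ 1≤c sl K 1≤K K≥ W≡ 8W≤ b≥ =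
        let M₁ , 1≤M₁ , E≤ , M₁≤ = LB.modulus
            L , L≤ , L≰ = LB.exponent
            J , J≤ , J≰ = LB.Construction.number M₁ 1≤M₁ E≤ M₁≤ L L≤ L≰
        in L ℕ.^ s ℕ.* J , LB.Construction.Final.many M₁ 1≤M₁ E≤ M₁≤ L L≤ L≰ J J≤ J≰ , LB.Construction.Final.estimate M₁ 1≤M₁ E≤ M₁≤ L L≤ L≰ J J≤ J≰
        where module LB = LargeB B 0<B c b₁ 1≤c sl K 1≤K K≥ W≡ 8W≤ b≥

open import Data.Nat.Base as ℕ using (_≤_; _∸_)

module Asymptotics (em : ExcludedMiddle 0ℓ) where
  open Reals em renaming (_≤_ to _≤ʳ_)
  open Exponential em using (exp; exp-unfold)
  open Logarithm em
  open Powers em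
  open NormalizedPart em
  open Counting em
  open Congruence
  open ℤ[X] using (eval)

  open CommutativeRing commutativeRing using (zeroʳ; *-identityʳ)

  *-cancelˡ-< : ∀ {x y z} → 0# < z → z * x < z * y → x < y
  *-cancelˡ-< 0<z p = ≰⇒> λ y≤x → <⇒≱ p (*-monoʳ-≤ (<⇒≤ 0<z) y≤x)

  ÷-inverse : ∀ x d → 1 ≤ d → ιₙ d * (x ÷ d) ≈ x
  ÷-inverse x d 1≤d = ≈-trans (*-cong ≈-refl (≈-reflexive (÷-/ x d))) (/-inverse x d {{ℕ.>-nonZero 1≤d}})

  ratio-* : ∀ n ε d → 1 ≤ d → ιₙ d * ((fromℕ n *ᴿ ε) ÷ d) ≈ ιₙ n * ε
  ratio-* n ε d 1≤d = ≈-trans (÷-inverse (fromℕ n *ᴿ ε) d 1≤d) (*ᴿ-cong {fromℕ n} {ε} {ιₙ n} {ε} (fromℕ-≈ n) ≈-refl)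

  record Between (F : ℝ → ℕ) (g : ℝ → ℝ) : Set where
    constructor mkBetween
    field
      {C T b₀} : ℕ
      1≤C      : 1 ≤ C
      1≤T      : 1 ≤ T
      bounds   : ∀ B → 0# < B → 1# ≤ʳ log B → ιₙ b₀ ≤ʳ log B → ιₙ (F B) ≤ʳ ιₙ C * g B × g B ≤ʳ ιₙ T * ιₙ (F B)

  ≍-intro : ∀ (F : ℝ → ℕ) (G g : ℝ → ℝ) → (∀ B → 0# < B → G B ≈ g B) → Between F g → (λ B → fromℕ (F B)) ≍ G
  ≍-intro F G g G≈g (mkBetween {C} {T} {b₀} 1≤C 1≤T bounds) =
    1ᴿ ÷ T , fromℕ C , 0<⇒0ᴿ< 0<c₁ , 0<⇒0ᴿ< (<-≤-trans (ιₙ-mono-< 1≤C) (≈⇒≥ (fromℕ-≈ C))) ,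
    fromℕ N , 0<⇒0ᴿ< (<-≤-trans 0<N (≈⇒≥ (fromℕ-≈ N))) , λ B N≤B →
      let e≤B = ≤-trans N≥ (≤ᴿ⇒≤′ {fromℕ N} {B} {ιₙ N} {B} (fromℕ-≈ N) ≈-refl N≤B)
          0<B = <-≤-trans (exp-pos _) e≤B
          log≥ = ≤-trans (≈⇒≥ (log-exp (ιₙ (suc b₀)))) (log-mono (exp-pos _) e≤B)
          upper , lower = bounds B 0<B (≤-trans (ιₙ-mono (s≤s z≤n)) log≥) (≤-trans (ιₙ-mono (ℕ.n≤1+n b₀)) log≥)
      in ≤⇒≤ᴿ′ {1ᴿ ÷ T *ᴿ G B} {fromℕ (F B)} {(1ᴿ ÷ T) * g B} {ιₙ (F B)} (*ᴿ-cong ≈-refl (G≈g B 0<B)) (fromℕ-≈ (F B))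
           (*-cancelˡ-≤ (ιₙ-mono-< 1≤T) (≤-trans (≈⇒≤ (≈-trans (≈-sym (*-assoc _ _ _)) (≈-trans (*-cong T*c₁ ≈-refl) (*-identityˡ _)))) lower)) ,
         ≤⇒≤ᴿ′ {fromℕ (F B)} {fromℕ C *ᴿ G B} {ιₙ (F B)} {ιₙ C * g B} (fromℕ-≈ (F B)) (*ᴿ-cong (fromℕ-≈ C) (G≈g B 0<B)) upper
    where
    T*c₁ : ιₙ T * (1ᴿ ÷ T) ≈ 1#
    T*c₁ = ≈-trans (÷-inverse 1ᴿ T 1≤T) (fromℕ-≈ 1)
    0<c₁ : 0# < 1ᴿ ÷ T
    0<c₁ = *-cancelˡ-< (ιₙ-mono-< 1≤T) (≤-<-trans (≈⇒≤ (zeroʳ _)) (<-≤-trans 0<1 (≈⇒≥ T*c₁)))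
    N : ℕ
    N = proj₁ (≤-archimedean-ℝ (exp (ιₙ (suc b₀))))
    N≥ : exp (ιₙ (suc b₀)) ≤ʳ ιₙ N
    N≥ = proj₂ (≤-archimedean-ℝ (exp (ιₙ (suc b₀))))
    0<N : 0# < ιₙ N
    0<N = <-≤-trans (exp-pos _) N≥

  power-exp : ∀ ε k → 1 ≤ k → Classical._^ᴿ_ em (fromℕ k) ε ≈ exp (ε * log (ιₙ k))
  power-exp ε k 1≤k = ≈-trans (^ᴿ-def ε 0<k) (exp-cong (*-cong ≈-refl (log-cong 0<k (fromℕ-≈ k))))
    where
    0<k : 0# < fromℕ k
    0<k = <-≤-trans (ιₙ-mono-< 1≤k) (≈⇒≥ (fromℕ-≈ k))

  power-positive⇒1≤ : ∀ ε k → 0ᴿ <ᴿ Classical._^ᴿ_ em (fromℕ k) ε → 1 ≤ k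
  power-positive⇒1≤ ε zero    p = ⊥-elim (<⇒≱ (0ᴿ<⇒0< p)
    (≈⇒≤ (≈-reflexive (^ᴿ-zero ε λ 0<0 → <⇒≱ 0<0 (≈⇒≤ (fromℕ-≈ 0))))))
  power-positive⇒1≤ ε (suc k) _ = s≤s z≤n

  1≤⇒power-positive : ∀ ε k → 1 ≤ k → 0ᴿ <ᴿ Classical._^ᴿ_ em (fromℕ k) ε
  1≤⇒power-positive ε k 1≤k = 0<⇒0ᴿ< (<-≤-trans (exp-pos _) (≈⇒≥ (power-exp ε k 1≤k)))

  Selected : ℤ[X].Poly → List ℕ → ℝ → ℝ → ℤ → Set
  Selected f S ε B x = fromℕ ℤ.∣ x ∣ ≤ᴿ B × 0ᴿ <ᴿ Classical._^ᴿ_ em (fromℕ ℤ.∣ eval f x ∣) ε ×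
    Classical._^ᴿ_ em (fromℕ ℤ.∣ eval f x ∣) ε ≤ᴿ Classical.normalizedPart em f S (eval f x)

  Ñ-≤ : ∀ f S ε B {w} → Cover (Selected f S ε B) w → Classical.Ñ em f S ε B ≤ w
  Ñ-≤ f S ε B {w} c = #-≤ {w = w} c

  Ñ-≥ : ∀ f S ε B {w u} → Cover (Selected f S ε B) w → Many (Selected f S ε B) u → u ≤ Classical.Ñ em f S ε B
  Ñ-≥ f S ε B {w} {u} c m = #-≥ {w = w} {u} c m

  module _ (f : ℤ[X].Poly) (S : List ℕ) (1≤S : All (1 ≤_) S) (ε B : ℝ) where

    InBall : ℤ → Set
    InBall x = (1 ≤ ℤ.∣ eval f x ∣ × ε * log (ιₙ ℤ.∣ eval f x ∣) ≤ʳ log-sum (valuation (eval f x)) (ratio f S) S) × ιₙ ℤ.∣ x ∣ ≤ʳ B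

    selected⇒in-ball : ∀ x → Selected f S ε B x → InBall x
    selected⇒in-ball x (x≤B , 0<y^ε , y^ε≤) =
      let 1≤y = power-positive⇒1≤ ε ℤ.∣ eval f x ∣ 0<y^ε in
      (1≤y , exp-cancel-≤ (≤ᴿ⇒≤′ (power-exp ε ℤ.∣ eval f x ∣ 1≤y) (normalizedPart-exp f S (eval f x) 1≤S) y^ε≤)) ,
      ≤ᴿ⇒≤′ {fromℕ ℤ.∣ x ∣} {B} {ιₙ ℤ.∣ x ∣} {B} (fromℕ-≈ ℤ.∣ x ∣) ≈-refl x≤B

    in-ball⇒selected : ∀ x → InBall x → Selected f S ε B x
    in-ball⇒selected x ((1≤y , c) , x≤B) =
      ≤⇒≤ᴿ′ {fromℕ ℤ.∣ x ∣} {B} {ιₙ ℤ.∣ x ∣} {B} (fromℕ-≈ ℤ.∣ x ∣) ≈-refl x≤B ,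
      1≤⇒power-positive ε ℤ.∣ eval f x ∣ 1≤y ,
      ≤⇒≤ᴿ′ (power-exp ε ℤ.∣ eval f x ∣ 1≤y) (normalizedPart-exp f S (eval f x) 1≤S) (exp-mono c)

  pairwise-comaximal : ∀ {P} → All Prime P → Unique P → AllPairs (λ p q → Comaximal (+ p) (+ q)) P
  pairwise-comaximal []        []       = []
  pairwise-comaximal (pp ∷ ps) (u ∷ us) = All.zipWith (λ (qq , p≢q) → primes-comaximal pp qq p≢q) (ps , u) ∷ pairwise-comaximal ps us

  <-÷ : ∀ ε R n → 1 ≤ n → ε <ᴿ fromℕ R ÷ n → ιₙ n * ε < ιₙ R
  <-÷ ε R n 1≤n ε< = <-≤-trans (*-monoʳ-< (ιₙ-mono-< 1≤n) (<ᴿ⇒< {ε} {fromℕ R ÷ n} ε<)) (≈⇒≤ (≈-trans (÷-inverse (fromℕ R) n 1≤n) (fromℕ-≈ R)))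

  power-log-≈ : ∀ α k B → 0# < B → Classical._^ᴿ_ em B (1ᴿ -ᴿ α) *ᴿ Classical.log em B ^ₙ k ≈ exp ((1# - α) * log B) * log B ^ k
  power-log-≈ α k B 0<B = ≈-trans (≈-* _ (Classical._^ᴿ_ em B (1ᴿ -ᴿ α)) (Classical.log em B ^ₙ k) (λ n → refl)) (*-cong (≈-trans (^ᴿ-def (1ᴿ -ᴿ α) 0<B) (exp-cong (*-cong (1-≈ α) ≈-refl)))
    (≈-reflexive (trans (cong (_^ₙ k) (log-unfold B)) (^ₙ-^ (log B) k))))
    where
    1-≈ : ∀ a → 1ᴿ -ᴿ a ≈ 1# - a
    1-≈ a = ≈-trans (≈-reflexive (+ᴿ-+ 1ᴿ (-ᴿ a))) (+-cong (fromℕ-≈ 1) (≈-reflexive (-ᴿ-neg a)))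

  module _ (f : ℤ[X].Poly) (n : ℕ) (deg : ℤ[X].HasDegree f n) (1≤n : 1 ≤ n) (S : List ℕ) (unique : Unique S) (primes : All Prime S) where
    open RootData em f n deg
    open LogSumBounds em f n deg S

    with-root-primes : All Prime (with-root S)
    with-root-primes = All.filter⁺ (λ p → em) primes

    with-root-unique : Unique (with-root S)
    with-root-unique = Unique.filter⁺ (λ p → em) unique

    with-root-roots : All HasRoot (with-root S)
    with-root-roots = All.all-filter (λ p → em) S

    1≤Rₘ : 1 ≤ length (with-root S) → 1 ≤ Rₘ
    1≤Rₘ 1≤s′ = go (with-root S) 1≤s′ with-root-primes with-root-roots
      where
      go : ∀ ps → 1 ≤ length ps → All Prime ps → All HasRoot ps → 1 ≤ foldr ℕ._⊔_ 0 (map (Classical.R em f) ps)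
      go (p ∷ ps) _ (pp ∷ _) (root ∷ _) = ℕ.≤-trans (R-positive pp root) (ℕ.m≤m⊔n _ _)

    Ñ-between : ∀ ε α F k R → (∀ B {w} → Cover (Selected f S ε B) w → F B ≤ w) →
                (∀ B {w u} → Cover (Selected f S ε B) w → Many (Selected f S ε B) u → u ≤ F B) →
                0# ≤ʳ ε → 0# < α → 0# < 1# - α → Rₘ ≡ R → 1 ≤ R → ιₙ R * α ≈ ιₙ n * ε →
                1 ≤ length (with-root S) → k ≡ length (with-root S) ∸ 1 →
                Between F (λ B → exp ((1# - α) * log B) * log B ^ k)
    Ñ-between ε α F k R F-≤ F-≥ 0≤ε 0<α 0<β Rₘ≡R 1≤R Rα≈nε = go (with-root S) refl with-root-primes with-root-unique Rₘ≡R 1≤R Rα≈nε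
      where
      1≤S : All (1 ≤_) S
      1≤S = All.map (λ pp → ℕ.≤-trans (s≤s z≤n) (prime≥2 pp)) primes

      go : ∀ {k R} ps → with-root S ≡ ps → All Prime ps → Unique ps → Rₘ ≡ R → 1 ≤ R → ιₙ R * α ≈ ιₙ n * ε →
           1 ≤ length ps → k ≡ length ps ∸ 1 → Between F (λ B → exp ((1# - α) * log B) * log B ^ k)
      go (p₀ ∷ P) eq (pp₀ ∷ pps) (u ∷ us) refl 1≤R Rα≈nε _ refl =
        let C , 1≤C , up = E.upper-estimate 0≤ε 0<α 0<β 1≤R Rα≈nε
            T , b₀ , 1≤T , lo = E.lower-estimate 0≤ε 0<α 0<β 1≤R Rα≈nε
        in mkBetween {C = C} {T} {b₀} 1≤C 1≤T λ B 0<B 1≤b b₀≤b →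
          let w , cover , w≤ = up B 0<B 1≤b
              u , many , ≤u  = lo B 0<B b₀≤b
              cover′ = cover-⊆ (selected⇒in-ball f S 1≤S ε B) cover
          in ≤-trans (ιₙ-mono (F-≤ B cover′)) w≤ ,
             ≤-trans ≤u (*-monoʳ-≤ (0≤ιₙ T) (ιₙ-mono (F-≥ B cover′ (many-⊆ (in-ball⇒selected f S 1≤S ε B) many))))
        where
        module E = Estimates em f n deg 1≤n S primes p₀ P eq (prime≥2 pp₀)
          (All.zipWith (λ {p} (pp , p₀≢p) → prime≥2 pp , comaximal-1 (+ p) , primes-comaximal pp₀ pp p₀≢p) (pps , u))
          (pairwise-comaximal pps us) ε α

    counting-≍ : ∀ ε α F G k R → (∀ B {w} → Cover (Selected f S ε B) w → F B ≤ w) →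
                 (∀ B {w u} → Cover (Selected f S ε B) w → Many (Selected f S ε B) u → u ≤ F B) →
                 (∀ B → 0# < B → G B ≈ exp ((1# - α) * log B) * log B ^ k) →
                 0# < ε → Rₘ ≡ R → 1 ≤ R → ιₙ R * α ≈ ιₙ n * ε → ιₙ n * ε < ιₙ R →
                 1 ≤ length (with-root S) → k ≡ length (with-root S) ∸ 1 → (λ B → fromℕ (F B)) ≍ G
    counting-≍ ε α F G k R F-≤ F-≥ G≈g 0<ε Rₘ≡R 1≤R Rα≈nε nε<R 1≤s′ k≡ =
      ≍-intro F G _ G≈g (Ñ-between ε α F k R F-≤ F-≥ (<⇒≤ 0<ε) 0<α (x<y⇒0<y-x α<1) Rₘ≡R 1≤R Rα≈nε 1≤s′ k≡)
      where
      0<α : 0# < α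
      0<α = *-cancelˡ-< (ιₙ-mono-< 1≤R) (≤-<-trans (≈⇒≤ (zeroʳ _)) (<-≤-trans (*-pos (ιₙ-mono-< 1≤n) 0<ε) (≈⇒≥ Rα≈nε)))

      α<1 : α < 1#
      α<1 = *-cancelˡ-< (ιₙ-mono-< 1≤R) (≤-<-trans (≈⇒≤ Rα≈nε) (<-≤-trans nε<R (≈⇒≥ (*-identityʳ _))))

    counting-≍-power : ∀ ε α F k R → (∀ B {w} → Cover (Selected f S ε B) w → F B ≤ w) →
                       (∀ B {w u} → Cover (Selected f S ε B) w → Many (Selected f S ε B) u → u ≤ F B) →
                       0# < ε → Rₘ ≡ R → 1 ≤ R → ιₙ R * α ≈ ιₙ n * ε → ιₙ n * ε < ιₙ R →
                       1 ≤ length (with-root S) → k ≡ length (with-root S) ∸ 1 →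
                       (λ B → fromℕ (F B)) ≍ (λ B → Classical._^ᴿ_ em B (1ᴿ -ᴿ α) *ᴿ Classical.log em B ^ₙ k)
    counting-≍-power ε α F k R F-≤ F-≥ 0<ε Rₘ≡R 1≤R Rα≈nε nε<R 1≤s′ k≡ =
      let r = counting-≍ ε α F _ k R F-≤ F-≥ (power-log-≈ α k) 0<ε Rₘ≡R 1≤R Rα≈nε nε<R 1≤s′ k≡ in r

    counting-≍-ratio : ∀ ε F k R → (∀ B {w} → Cover (Selected f S ε B) w → F B ≤ w) →
                       (∀ B {w u} → Cover (Selected f S ε B) w → Many (Selected f S ε B) u → u ≤ F B) →
                       0ᴿ <ᴿ ε → Rₘ ≡ R → 1 ≤ R → ε <ᴿ fromℕ R ÷ n →
                       1 ≤ length (with-root S) → k ≡ length (with-root S) ∸ 1 →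
                       (λ B → fromℕ (F B)) ≍ (λ B → Classical._^ᴿ_ em B (1ᴿ -ᴿ (fromℕ n *ᴿ ε) ÷ R) *ᴿ Classical.log em B ^ₙ k)
    counting-≍-ratio ε F k R F-≤ F-≥ 0<ε Rₘ≡R 1≤R ε< 1≤s′ k≡ =
      let r = counting-≍-power ε _ F k R F-≤ F-≥ (0ᴿ<⇒0< 0<ε) Rₘ≡R 1≤R (ratio-* n ε R 1≤R) (<-÷ ε R n 1≤n ε<) 1≤s′ k≡ in r

    Rₘ-Rmax : Rₘ ≡ Classical.Rmax em f S
    Rₘ-Rmax = refl

    with-root-length : length (Classical.primesWithRoot em f S) ∸ 1 ≡ length (with-root S) ∸ 1
    with-root-length = refl

  -- The conclusions are bound by let, so that their types are inferred from
  -- the signatures before they are compared with the goal: otherwise Agda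
  -- unfolds the reals in the goal against the unsolved arguments.
  Ñ-≍ : (n : ℕ) → 1 ≤ n → (f : ℤ[X].Poly) → ℤ[X].HasDegree f n → (S : List ℕ) → Unique S → All Prime S →
    1 ≤ length (Classical.primesWithRoot em f S) → (ε : ℝ) → 0ᴿ <ᴿ ε → ε <ᴿ fromℕ (Classical.Rmax em f S) ÷ n →
    (λ B → fromℕ (Classical.Ñ em f S ε B)) ≍
    (λ B → Classical._^ᴿ_ em B (1ᴿ -ᴿ (fromℕ n *ᴿ ε) ÷ Classical.Rmax em f S) *ᴿ Classical.log em B ^ₙ (length (Classical.primesWithRoot em f S) ∸ 1))
  Ñ-≍ n 1≤n f deg S unique primes 1≤s′ ε 0<ε ε< =
    let r = counting-≍-ratio f n deg 1≤n S unique primes ε _ _ _ (λ B → Ñ-≤ f S ε B) (λ B → Ñ-≥ f S ε B) 0<ε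
              (Rₘ-Rmax f n deg 1≤n S unique primes) (1≤Rₘ f n deg 1≤n S unique primes 1≤s′) ε< 1≤s′
              (with-root-length f n deg 1≤n S unique primes)
    in r

theorem2 :
    (em : ExcludedMiddle 0ℓ) →
    (n : ℕ) → 1 ≤ n →
    (f : ℤ[X].Poly) → ℤ[X].HasDegree f n →
    (S : List ℕ) → Unique S → All Prime S →
    (let s′ = length (Classical.primesWithRoot em f S)) → 1 ≤ s′ →
    (ε : ℝ) → 0ᴿ <ᴿ ε → ε <ᴿ fromℕ (Classical.Rmax em f S) ÷ n →
    (λ B → fromℕ (Classical.Ñ em f S ε B)) ≍
    (λ B → Classical._^ᴿ_ em B (1ᴿ -ᴿ (fromℕ n *ᴿ ε) ÷ Classical.Rmax em f S) *ᴿ Classical.log em B ^ₙ (s′ ∸ 1))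
theorem2 = Asymptotics.Ñ-≍
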